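{- Let $t\ge2$ be odd, $r\ge1$, $N=t+2r$, $\zeta=e^{2\pi i/t}$, and let $\lambda=(\lambda_1\ge\dots\ge\lambda_N\ge0)$ be a partition with at most $N$ parts. Then $$s_\lambda\bigl(1,\zeta,\dots,\zeta^{t-1},z_1,z_1^{ -1},\dots,z_r,z_r^{ -1}\bigr)\equiv0\quad\text{(identically in }z_1,\dots,z_r)$$ if and only if some residue class modulo $t$ contains none of the numbers $\beta_j=\lambda_j+N-j$, $1\le j\le N$.
   Context: $s_\lambda$ is the Schur polynomial in $N$ variables and $z_1,\dots,z_r$ are independent indeterminates. -}

module Defs where

open import Algebra.Apartness.Bundles using (HeytingField; HeytingCommutativeRing)
open import Algebra.Bundles using (CommutativeRing; Semiring; RawSemiring)
import Algebra.Definitions.RawSemiring as RawSemiringDefs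
open import Data.Bool.Base using (if_then_else_)
open import Data.Fin.Base as Fin using (Fin; zero; suc; toℕ)
import Data.Fin.Properties as Fin
import Data.Integer.Base as ℤ
import Data.Integer.Properties as ℤ
open import Data.List.Base as List using (List; []; _∷_; _++_; allFin)
open import Data.Nat.Base using (ℕ; zero; suc; _+_; _*_; _∸_; _<_; _≥_; ∣_-_∣)
open import Data.Nat.Divisibility using (_∣_)
import Data.Nat.Properties as ℕ
open import Data.Product.Base using (_×_; _,_)
open import Data.Vec.Base as Vec using (Vec)
import Data.Vec.Functional as Vector
import Data.Vec.Properties as Vec
open import Level using (Level; _⊔_)
open import Relation.Binary.Core using (Rel)
open import Relation.Binary.PropositionalEquality using (_≡_)
open import Relation.Nullary.Decidable using (Dec; does; _×-dec_; _→-dec_)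

record Partition (N : ℕ) : Set where
  field
    part       : Fin N → ℕ
    decreasing : ∀ i j → i Fin.≤ j → part i ≥ part j

open Partition public

-- Indices start at 0, so λⱼ + N - j becomes part j + (N - (j + 1)); the
-- truncated subtraction is exact because j < N.

β : ∀ {N} → Partition N → Fin N → ℕ
β {N} lam j = part lam j + (N ∸ suc (toℕ j))

infix 4 _≡_[mod_]

_≡_[mod_] : ℕ → ℕ → ℕ → Set
a ≡ b [mod t ] = t ∣ ∣ a - b ∣

Filling : ∀ {N} → Partition N → Set
Filling {N} lam = (i : Fin N) → Fin (part lam i) → Fin N

Semistandard : ∀ {N} (lam : Partition N) → Filling lam → Set
Semistandard lam T =
    (∀ i j j′ → j Fin.≤ j′ → T i j Fin.≤ T i j′)
  × (∀ i i′ → i Fin.< i′ → ∀ j j′ → toℕ j ≡ toℕ j′ → T i j Fin.< T i′ j′)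

semistandard? : ∀ {N} (lam : Partition N) (T : Filling lam) →
                Dec (Semistandard lam T)
semistandard? lam T =
    (Fin.all? λ i → Fin.all? λ j → Fin.all? λ j′ →
       (j Fin.≤? j′) →-dec (T i j Fin.≤? T i j′))
  ×-dec
    (Fin.all? λ i → Fin.all? λ i′ → (i Fin.<? i′) →-dec
       (Fin.all? λ j → Fin.all? λ j′ →
         (toℕ j ℕ.≟ toℕ j′) →-dec (T i j Fin.<? T i′ j′)))

-- All dependent functions f with f i drawn from the i-th list, each once.

choices : ∀ {a} n {A : Fin n → Set a} →
          ((i : Fin n) → List (A i)) → List ((i : Fin n) → A i)
choices zero        xss = (λ ()) ∷ []
choices (suc n) {A} xss =
  List.cartesianProductWith cons (xss zero) (choices n (λ i → xss (suc i)))
  where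
  cons : A zero → ((i : Fin n) → A (suc i)) → (i : Fin (suc n)) → A i
  cons x f zero    = x
  cons x f (suc i) = f i

fillings : ∀ {N} (lam : Partition N) → List (Filling lam)
fillings {N} lam =
  choices N (λ i → choices (part lam i) (λ _ → allFin N))

tableaux : ∀ {N} (lam : Partition N) → List (Filling lam)
tableaux lam = List.filter (semistandard? lam) (fillings lam)

-- The Schur polynomial is the sum, over all semistandard tableaux of shape lam
-- with entries in {1,…,N}, of the products of the variables indexed by
-- the entries.

module _ {a ℓ} (S : RawSemiring a ℓ) where

  open RawSemiring S using (Carrier) renaming (_+_ to _⊕_; 0# to 0S)
  open RawSemiringDefs S using (product)

  schur : ∀ {N} → Partition N → (Fin N → Carrier) → Carrier
  schur lam x = List.foldr _⊕_ 0S (List.map weight (tableaux lam))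
    where
    weight : Filling lam → Carrier
    weight T = product λ i → product λ j → x (T i j)

-- A Laurent polynomial is a formal finite sum of terms (c , e), standing
-- for c z₁^e₁ ⋯ zᵣ^eᵣ.  Exponents may be repeated and coefficients may
-- vanish, so equality is equality of all coefficients.

module Laurent {c ℓ} (R : CommutativeRing c ℓ) (r : ℕ) where

  private
    module R = CommutativeRing R

  Exponent : Set
  Exponent = Vec ℤ.ℤ r

  Laurent : Set c
  Laurent = List (R.Carrier × Exponent)

  coeff : Laurent → Exponent → R.Carrier
  coeff []            e = R.0#
  coeff ((a , d) ∷ f) e =
    (if does (Vec.≡-dec ℤ._≟_ d e) then a else R.0#) R.+ coeff f e

  infix 4 _≈_

  _≈_ : Rel Laurent ℓ
  f ≈ g = ∀ e → coeff f e R.≈ coeff g e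

  mulTerm : R.Carrier × Exponent → R.Carrier × Exponent → R.Carrier × Exponent
  mulTerm (a , d) (b , e) = a R.* b , Vec.zipWith ℤ._+_ d e

  const : R.Carrier → Laurent
  const a = (a , Vec.replicate r ℤ.0ℤ) ∷ []

  rawSemiring : RawSemiring c ℓ
  rawSemiring = record
    { Carrier = Laurent
    ; _≈_     = _≈_
    ; _+_     = _++_
    ; _*_     = List.cartesianProductWith mulTerm
    ; 0#      = []
    ; 1#      = const R.1#
    }

  z^ : Fin r → ℤ.ℤ → Laurent
  z^ i k = (R.1# , Vec.replicate r ℤ.0ℤ Vec.[ i ]≔ k) ∷ []

-- The complex numbers are not available, so K is any field of
-- characteristic zero, with ζ any primitive t-th root of unity in it; K = ℂ
-- and ζ = e^(2πi/t) is one instance.  The apartness # plays the role of ≠.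

module _ {c ℓ₁ ℓ₂} (K : HeytingField c ℓ₁ ℓ₂) where

  open HeytingField K
    using (Carrier; _≈_; _#_; 0#; 1#; heytingCommutativeRing)

  ring : CommutativeRing c ℓ₁
  ring = HeytingCommutativeRing.commutativeRing heytingCommutativeRing

  open RawSemiringDefs (Semiring.rawSemiring (CommutativeRing.semiring ring))
    using (_^_) renaming (_×_ to _·_)

  CharacteristicZero : Set ℓ₂
  CharacteristicZero = ∀ n → 0 < n → (n · 1#) # 0#

  record IsPrimitiveRoot (t : ℕ) (ζ : Carrier) : Set (ℓ₁ ⊔ ℓ₂) where
    field
      ζ^t≈1 : ζ ^ t ≈ 1#
      ζ^k#1 : ∀ k → 0 < k → k < t → (ζ ^ k) # 1#

  -- The point (1, ζ, …, ζ^(t-1), z₁, z₁⁻¹, …, zᵣ, zᵣ⁻¹).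

  specialisation : ∀ t r → Carrier → Fin (t + r * 2) → Laurent.Laurent ring r
  specialisation t r ζ = powers Vector.++ Vector.concat pairs
    where
    open Laurent ring r using (Laurent; const; z^)

    powers : Vector.Vector Laurent t
    powers i = const (ζ ^ toℕ i)

    pairs : Vector.Vector (Vector.Vector Laurent 2) r
    pairs i = z^ i ℤ.1ℤ Vector.∷ z^ i ℤ.-1ℤ Vector.∷ Vector.[]

{-# OPTIONS --safe #-}

-- Branching by the largest letter turns the sum over tableaux into the
-- quotient of alternants: the column operations that clear the row of the last
-- variable in det (x i ^ β j) produce exactly the interlacing shapes.  The
-- Vandermonde product of the specialised variables is not a zero divisor, so the
-- Schur polynomial vanishes if and only if the alternant does.
--
-- The row of x = ζ^i in the alternant only sees β j modulo t.  Expanding every column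
-- over the vectors (ζ^(ia))ᵢ, a < t, and the unit vectors of the other rows gives
-- a sum over bijections τ from columns to labels: t residues a, each to be given to some
-- β j ≡ a, and the variables z k and 1 / z k, which contribute z k ^ (β j - β j′).
-- If a residue class is empty there is no such τ.
--
-- If no class is empty, let c = m / 2 + 1 / 4 for an integer m, give each residue to
-- the element of its class closest to c, and call the others upper or lower according to
-- the side of c on which they lie.  As t is odd, the number of upper elements drops by
-- at most one when m grows by one, so for some m there are r of each kind.  Match
-- the k-th farthest upper with the k-th farthest lower element.  The monomial of this τ
-- has no other source: the sum of |β j - c| over the residue labels is minimal, which
-- forces any τ with the same exponents to choose the same representatives, and then,
-- from the farthest pair on, the same pairs.  Its coefficient is a determinant δ, equal up
-- to sign to that of every other τ, so δ = 0 would annihilate all alternants, even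
-- the Vandermonde product.

module Submission where

open import Defs
open import Algebra.Apartness.Bundles using (HeytingField)
open import Algebra.Bundles using (CommutativeRing; RawSemiring; Semiring)
import Algebra.Definitions.RawSemiring as RawSemiringDefs
import Algebra.Properties.Ring as RingProperties
open import Data.Bool.Base using (Bool; true; false; if_then_else_)
open import Data.Empty using (⊥-elim)
open import Data.Fin.Base as Fin
  using (Fin; zero; suc; toℕ; inject₁; fromℕ; _↑ˡ_; _↑ʳ_; splitAt; combine; quotRem)
import Data.Fin.Properties as Fin
open import Data.Fin.Relation.Unary.Top using (view; ‵fromℕ; ‵inject₁)
import Data.Integer.Base as ℤ
import Data.Integer.Properties as ℤ
import Data.Integer.Tactic.RingSolver as ℤ-Solver
open import Data.List.Base as List using (List; []; _∷_; _++_; allFin)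
open import Data.List.Membership.Propositional using (_∈_)
open import Data.List.Membership.Propositional.Properties
  using (∈-∃++; ∈-++⁻; ∈-++⁺ˡ; ∈-++⁺ʳ; ∈-tabulate⁺; ∈-allFin)
import Data.List.Properties as List
open import Data.List.Relation.Binary.Permutation.Propositional as ↭ using (_↭_)
import Data.List.Relation.Binary.Permutation.Propositional.Properties as ↭
import Data.List.Relation.Unary.All as All
open import Data.List.Relation.Unary.AllPairs using () renaming (_∷_ to _∷ᵖ_)
open import Data.List.Relation.Unary.Any using (here; there)
open import Data.List.Relation.Unary.Unique.Propositional using (Unique)
open import Data.List.Relation.Unary.Unique.Propositional.Properties using (tabulate⁺)
import Data.Nat.Base as ℕ
open import Data.Nat.Base using (ℕ; zero; suc)
open import Data.Nat.Coprimality using (Coprime; coprime-divisor)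
open import Data.Nat.Divisibility using (_∣_; _∣?_; divides; ∣⇒≤; 0∣⇒≡0)
open import Data.Nat.DivMod
  using (_%_; _/_; m≡m%n+[m/n]*n; [m+kn]%n≡m%n; m%n<n; m<n⇒m%n≡m; %-distribˡ-+)
import Data.Nat.Properties as ℕ
import Data.Nat.Tactic.RingSolver as ℕ-Solver
open import Data.Product.Base using (Σ; ∃; _×_; _,_; proj₁; proj₂)
open import Data.Sum.Base using (_⊎_; inj₁; inj₂; [_,_]′)
open import Data.Vec.Base as Vec using (Vec)
import Data.Vec.Properties as Vec
open import Function.Base using (_∘_; id)
open import Function.Bundles using (_⇔_; mk⇔; Equivalence)
open import Function.Definitions using (Injective)
open import Level using (Level; _⊔_)
open import Relation.Binary.Definitions using (tri<; tri≈; tri>)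
open import Relation.Binary.PropositionalEquality as ≡
  using (_≡_; _≢_; cong; cong₂; cong-app; subst; subst₂)
import Relation.Binary.Reasoning.Setoid as SetoidReasoning
open import Relation.Nullary.Decidable as Dec using (Dec; yes; no; does; _×-dec_; _→-dec_; ¬?)
open import Relation.Nullary.Negation using (¬_; contradiction)

-- Being zero is not decidable in a Heyting field, so the Laurent ring is not treated as a domain
-- and no leading coefficient is searched for. Differences of two specialised variables are shown to
-- be cancellable (`Regular`), and nonvanishing takes the form of an implication from a zero to 1 =
-- 0. Determinants matter only through multilinearity and alternation; as top coordinates in an
-- exterior algebra they need no formula for the sign of a permutation. The shift 1/4 excludes ties:
-- 2 c = m + 1/2 is not an integer, so no two elements are mirror images about c. The obstacle to
-- isolating a monomial is that its exponents give only the differences of paired elements, not the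
-- elements. The sum of all exponents, however, is at most the sum of the distances to c over the
-- labels of variables, with equality exactly when every pair straddles c in the right order. Since
-- the sum of the distances over all elements is fixed, an assignment with the same exponents cannot
-- have smaller distances at the variables, hence none larger at the residues.

infixr 5 _∷ᵈ_

_∷ᵈ_ : ∀ {a n} {A : Fin (suc n) → Set a} →
       A zero → ((i : Fin n) → A (suc i)) → (i : Fin (suc n)) → A i
(x ∷ᵈ f) zero    = x
(x ∷ᵈ f) (suc i) = f i

snocᵈ : ∀ {a n} {A : Fin (suc n) → Set a} →
        ((i : Fin n) → A (inject₁ i)) → A (fromℕ n) → (i : Fin (suc n)) → A i
snocᵈ {n = zero}  f x zero    = x
snocᵈ {n = suc n} f x zero    = f zero
snocᵈ {n = suc n} {A = A} f x (suc i) = snocᵈ {A = λ j → A (suc j)} (λ j → f (suc j)) x i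

snocᵈ-inject₁ : ∀ {a n} {A : Fin (suc n) → Set a} (f : (i : Fin n) → A (inject₁ i)) x i →
                snocᵈ {A = A} f x (inject₁ i) ≡ f i
snocᵈ-inject₁ f x zero    = ≡.refl
snocᵈ-inject₁ {A = A} f x (suc i) = snocᵈ-inject₁ {A = λ j → A (suc j)} (λ j → f (suc j)) x i

snocᵈ-fromℕ : ∀ {a n} {A : Fin (suc n) → Set a} (f : (i : Fin n) → A (inject₁ i)) x →
              snocᵈ {A = A} f x (fromℕ n) ≡ x
snocᵈ-fromℕ {n = zero}  f x = ≡.refl
snocᵈ-fromℕ {n = suc n} {A = A} f x = snocᵈ-fromℕ {A = λ j → A (suc j)} (λ j → f (suc j)) x

-- Finite sums and products in a commutative ring

module Sums {a ℓ} (S : CommutativeRing a ℓ) where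

  open CommutativeRing S public hiding (ring; zero)
  open RingProperties (CommutativeRing.ring S) public
  open SetoidReasoning setoid public

  interchange : ∀ x y z w → (x + y) + (z + w) ≈ (x + z) + (y + w)
  interchange x y z w = begin
    (x + y) + (z + w) ≈⟨ +-assoc x y _ ⟩
    x + (y + (z + w)) ≈⟨ +-congˡ (+-assoc y z w) ⟨
    x + ((y + z) + w) ≈⟨ +-congˡ (+-congʳ (+-comm y z)) ⟩
    x + ((z + y) + w) ≈⟨ +-congˡ (+-assoc z y w) ⟩
    x + (z + (y + w)) ≈⟨ +-assoc x z _ ⟨
    (x + z) + (y + w) ∎

  *-interchange : ∀ x y z w → (x * y) * (z * w) ≈ (x * z) * (y * w)
  *-interchange x y z w = begin
    (x * y) * (z * w) ≈⟨ *-assoc x y _ ⟩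
    x * (y * (z * w)) ≈⟨ *-congˡ (*-assoc y z w) ⟨
    x * ((y * z) * w) ≈⟨ *-congˡ (*-congʳ (*-comm y z)) ⟩
    x * ((z * y) * w) ≈⟨ *-congˡ (*-assoc z y w) ⟩
    x * (z * (y * w)) ≈⟨ *-assoc x z _ ⟨
    (x * z) * (y * w) ∎

  *-swapˡ : ∀ x y z → x * (y * z) ≈ y * (x * z)
  *-swapˡ x y z = begin
    x * (y * z) ≈⟨ *-assoc x y z ⟨
    (x * y) * z ≈⟨ *-congʳ (*-comm x y) ⟩
    (y * x) * z ≈⟨ *-assoc y x z ⟩
    y * (x * z) ∎

  ∑ : ∀ {b} {A : Set b} → List A → (A → Carrier) → Carrier
  ∑ []       f = 0#
  ∑ (x ∷ xs) f = f x + ∑ xs f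

  module _ {b} {A : Set b} where

    ∑-cong : ∀ (xs : List A) {f g} → (∀ x → f x ≈ g x) → ∑ xs f ≈ ∑ xs g
    ∑-cong []       e = refl
    ∑-cong (x ∷ xs) e = +-cong (e x) (∑-cong xs e)

    ∑-zero : ∀ (xs : List A) {f} → (∀ x → f x ≈ 0#) → ∑ xs f ≈ 0#
    ∑-zero []       e = refl
    ∑-zero (x ∷ xs) e = trans (+-cong (e x) (∑-zero xs e)) (+-identityʳ 0#)

    ∑-+ : ∀ (xs : List A) f g → ∑ xs (λ x → f x + g x) ≈ ∑ xs f + ∑ xs g
    ∑-+ []       f g = sym (+-identityʳ 0#)
    ∑-+ (x ∷ xs) f g = trans (+-congˡ (∑-+ xs f g)) (interchange _ _ _ _)

    ∑-++ : ∀ (xs ys : List A) f → ∑ (xs ++ ys) f ≈ ∑ xs f + ∑ ys f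
    ∑-++ []       ys f = sym (+-identityˡ _)
    ∑-++ (x ∷ xs) ys f = trans (+-congˡ (∑-++ xs ys f)) (sym (+-assoc _ _ _))

    *-distribˡ-∑ : ∀ c (xs : List A) f → c * ∑ xs f ≈ ∑ xs (λ x → c * f x)
    *-distribˡ-∑ c []       f = zeroʳ c
    *-distribˡ-∑ c (x ∷ xs) f = trans (distribˡ c _ _) (+-congˡ (*-distribˡ-∑ c xs f))

    *-distribʳ-∑ : ∀ c (xs : List A) f → ∑ xs f * c ≈ ∑ xs (λ x → f x * c)
    *-distribʳ-∑ c []       f = zeroˡ c
    *-distribʳ-∑ c (x ∷ xs) f = trans (distribʳ c _ _) (+-congˡ (*-distribʳ-∑ c xs f))

  module _ {b} {A : Set b} where

    ∑-swap : ∀ {d} {B : Set d} (xs : List A) (ys : List B) (f : A → B → Carrier) →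
             ∑ xs (λ x → ∑ ys (f x)) ≈ ∑ ys (λ y → ∑ xs (λ x → f x y))
    ∑-swap []       ys f = sym (∑-zero ys (λ _ → refl))
    ∑-swap (x ∷ xs) ys f = trans (+-congˡ (∑-swap xs ys f)) (sym (∑-+ ys _ _))

    ∑-map : ∀ {d} {B : Set d} (h : B → A) (xs : List B) f → ∑ (List.map h xs) f ≈ ∑ xs (f ∘ h)
    ∑-map h []       f = refl
    ∑-map h (x ∷ xs) f = +-congˡ (∑-map h xs f)

    ∑-cartesianProductWith : ∀ {d e} {B : Set d} {C : Set e} (h : B → C → A) xs ys f →
      ∑ (List.cartesianProductWith h xs ys) f ≈ ∑ xs (λ x → ∑ ys (λ y → f (h x y)))
    ∑-cartesianProductWith h []       ys f = refl
    ∑-cartesianProductWith h (x ∷ xs) ys f = begin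
      ∑ (List.map (h x) ys ++ List.cartesianProductWith h xs ys) f
        ≈⟨ ∑-++ (List.map (h x) ys) _ f ⟩
      ∑ (List.map (h x) ys) f + ∑ (List.cartesianProductWith h xs ys) f
        ≈⟨ +-cong (∑-map (h x) ys f) (∑-cartesianProductWith h xs ys f) ⟩
      ∑ ys (λ y → f (h x y)) + ∑ xs (λ x → ∑ ys (λ y → f (h x y))) ∎

  ∑-tabulate-last : ∀ {b} {A : Set b} n (g : Fin (suc n) → A) f →
    ∑ (List.tabulate g) f ≈ ∑ (List.tabulate (g ∘ inject₁)) f + f (g (fromℕ n))
  ∑-tabulate-last zero    g f = +-comm _ _
  ∑-tabulate-last (suc n) g f =
    trans (+-congˡ (∑-tabulate-last n (g ∘ suc) f)) (sym (+-assoc _ _ _))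

  ∑-tabulate : ∀ {b} {A : Set b} n (g : Fin n → A) f → ∑ (List.tabulate g) f ≈ ∑ (allFin n) (f ∘ g)
  ∑-tabulate zero    g f = refl
  ∑-tabulate (suc n) g f = +-congˡ (trans (∑-tabulate n (g ∘ suc) f) (sym (∑-tabulate n suc (f ∘ g))))

  ∑-allFin-last : ∀ n f → ∑ (allFin (suc n)) f ≈ ∑ (allFin n) (f ∘ inject₁) + f (fromℕ n)
  ∑-allFin-last n f = trans (∑-tabulate-last n id f) (+-congʳ (∑-tabulate n inject₁ f))

  ∑-allFin-single : ∀ n i f → (∀ j → j ≢ i → f j ≈ 0#) → ∑ (allFin n) f ≈ f i
  ∑-allFin-single (suc n) zero f h = trans
    (+-congˡ (trans (∑-tabulate n suc f) (∑-zero (allFin n) (λ j → h (suc j) (λ ())))))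
    (+-identityʳ _)
  ∑-allFin-single (suc n) (suc i) f h = trans
    (+-cong (h zero (λ ())) (trans (∑-tabulate n suc f)
      (∑-allFin-single n i (f ∘ suc) (λ j j≢i → h (suc j) (j≢i ∘ Fin.suc-injective)))))
    (+-identityˡ _)

  -- Has the shape of the conditional in `coeff`, so that coefficients are sums of `when` terms by
  -- unfolding.
  when : ∀ {p} {P : Set p} → Dec P → Carrier → Carrier
  when P? x = if does P? then x else 0#

  module _ {p} {P : Set p} where

    when-true : (P? : Dec P) → P → ∀ {x} → when P? x ≈ x
    when-true (yes _) p = refl
    when-true (no ¬p) p = contradiction p ¬p

    when-false : (P? : Dec P) → ¬ P → ∀ {x} → when P? x ≈ 0#
    when-false (yes p) ¬p = contradiction p ¬p
    when-false (no _)  ¬p = refl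

    when-zero : (P? : Dec P) → ∀ {x} → (P → x ≈ 0#) → when P? x ≈ 0#
    when-zero (yes p) h = h p
    when-zero (no _)  h = refl

    when-cong : (P? : Dec P) → ∀ {x y} → (P → x ≈ y) → when P? x ≈ when P? y
    when-cong (yes p) h = h p
    when-cong (no _)  h = refl

    when-* : (P? : Dec P) → ∀ x y → when P? x * y ≈ when P? (x * y)
    when-* (yes _) x y = refl
    when-* (no _)  x y = zeroˡ y

    *-when : (P? : Dec P) → ∀ x y → x * when P? y ≈ when P? (x * y)
    *-when (yes _) x y = refl
    *-when (no _)  x y = zeroʳ x

    when-∑ : ∀ {b} {A : Set b} (P? : Dec P) (xs : List A) f →
             when P? (∑ xs f) ≈ ∑ xs (λ x → when P? (f x))
    when-∑ (yes _) xs f = refl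
    when-∑ (no _)  xs f = sym (∑-zero xs (λ _ → refl))

    when-⇔ : ∀ {q} {Q : Set q} (P? : Dec P) (Q? : Dec Q) → (P → Q) → (Q → P) →
             ∀ {x y} → x ≈ y → when P? x ≈ when Q? y
    when-⇔ (yes _) (yes _) f g e = e
    when-⇔ (no _)  (no _)  f g e = refl
    when-⇔ (yes p) (no ¬q) f g e = contradiction (f p) ¬q
    when-⇔ (no ¬p) (yes q) f g e = contradiction (g q) ¬p

    when-× : ∀ {q} {Q : Set q} (P? : Dec P) (Q? : Dec Q) {x : Carrier} →
             when P? (when Q? x) ≈ when (P? ×-dec Q?) x
    when-× (yes _) (yes _) = refl
    when-× (yes _) (no _)  = refl
    when-× (no _)  _       = refl

  ∑-filter : ∀ {b p} {A : Set b} {P : A → Set p} (P? : ∀ x → Dec (P x)) (xs : List A) f →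
             ∑ (List.filter P? xs) f ≈ ∑ xs (λ x → when (P? x) (f x))
  ∑-filter P? []       f = refl
  ∑-filter P? (x ∷ xs) f with P? x
  ... | yes _ = +-congˡ (∑-filter P? xs f)
  ... | no  _ = trans (∑-filter P? xs f) (sym (+-identityˡ _))

  open RawSemiringDefs (Semiring.rawSemiring (CommutativeRing.semiring S)) public using (product; _^_)

  product-cong : ∀ {n} {f g : Fin n → Carrier} → (∀ i → f i ≈ g i) → product f ≈ product g
  product-cong {zero}  e = refl
  product-cong {suc n} e = *-cong (e zero) (product-cong (e ∘ suc))

  product-* : ∀ {n} (f g : Fin n → Carrier) →
              product (λ i → f i * g i) ≈ product f * product g
  product-* {zero}  f g = sym (*-identityʳ 1#)
  product-* {suc n} f g = trans (*-congˡ (product-* (f ∘ suc) (g ∘ suc))) (*-interchange _ _ _ _)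

  product-last : ∀ n (f : Fin (suc n) → Carrier) →
                 product f ≈ product (f ∘ inject₁) * f (fromℕ n)
  product-last zero    f = *-comm _ _
  product-last (suc n) f = trans (*-congˡ (product-last n (f ∘ suc))) (sym (*-assoc _ _ _))

  product-one : ∀ {n} {f : Fin n → Carrier} → (∀ i → f i ≈ 1#) → product f ≈ 1#
  product-one {zero}  e = refl
  product-one {suc n} e = trans (*-cong (e zero) (product-one (e ∘ suc))) (*-identityʳ 1#)

  product-when : ∀ {n p} {P : Fin n → Set p} (P? : ∀ i → Dec (P i)) (f : Fin n → Carrier) →
                 product (λ i → when (P? i) (f i)) ≈ when (Fin.all? P?) (product f)
  product-when {zero}  P? f = sym (when-true (Fin.all? P?) (λ ()))
  product-when {suc n} P? f = begin
    when (P? zero) (f zero) * product (λ i → when (P? (suc i)) (f (suc i)))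
      ≈⟨ *-congˡ (product-when (P? ∘ suc) (f ∘ suc)) ⟩
    when (P? zero) (f zero) * when (Fin.all? (P? ∘ suc)) (product (f ∘ suc))
      ≈⟨ when-* (P? zero) _ _ ⟩
    when (P? zero) (f zero * when (Fin.all? (P? ∘ suc)) (product (f ∘ suc)))
      ≈⟨ when-cong (P? zero) (λ _ → *-when (Fin.all? (P? ∘ suc)) _ _) ⟩
    when (P? zero) (when (Fin.all? (P? ∘ suc)) (product f))
      ≈⟨ when-× (P? zero) (Fin.all? (P? ∘ suc)) ⟩
    when (P? zero ×-dec Fin.all? (P? ∘ suc)) (product f)
      ≈⟨ when-⇔ (P? zero ×-dec Fin.all? (P? ∘ suc)) (Fin.all? P?)
           (λ { (p , ps) zero → p ; (p , ps) (suc i) → ps i })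
           (λ ps → ps zero , ps ∘ suc) refl ⟩
    when (Fin.all? P?) (product f) ∎

  ^-+ : ∀ x m n → x ^ (m ℕ.+ n) ≈ x ^ m * x ^ n
  ^-+ x zero    n = sym (*-identityˡ _)
  ^-+ x (suc m) n = trans (*-congˡ (^-+ x m n)) (sym (*-assoc _ _ _))

  -- The members of `choices` agree only pointwise with functions built by `_∷ᵈ_` or `snocᵈ`;
  -- without function extensionality each summand has to respect pointwise equality.
  Extensional : ∀ {b n} {A : Fin n → Set b} → (((i : Fin n) → A i) → Carrier) → Set _
  Extensional G = ∀ f g → (∀ i → f i ≡ g i) → G f ≈ G g

  module _ {b : Level} where

    ∑-choices-zero : ∀ {A : Fin 0 → Set b} (xss : (i : Fin 0) → List (A i)) {G} →
                     Extensional G → ∀ f → ∑ (choices 0 xss) G ≈ G f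
    ∑-choices-zero xss ext f = trans (+-identityʳ _) (ext _ f (λ ()))

    ∑-choices-suc : ∀ {n} {A : Fin (suc n) → Set b} (xss : ∀ i → List (A i)) {G} → Extensional G →
      ∑ (choices (suc n) xss) G ≈ ∑ (xss zero) (λ x → ∑ (choices n (xss ∘ suc)) (λ f → G (x ∷ᵈ f)))
    ∑-choices-suc {n} xss ext = trans (∑-cartesianProductWith _ (xss zero) _ _)
      (∑-cong (xss zero) (λ x → ∑-cong (choices n _) (λ f →
        ext _ _ (λ { zero → ≡.refl ; (suc i) → ≡.refl }))))

    ∷ᵈ-ext : ∀ {n} {A : Fin (suc n) → Set b} {G : (∀ i → A i) → Carrier} → Extensional G →
             ∀ x → Extensional (λ f → G (x ∷ᵈ f))
    ∷ᵈ-ext ext x f g e = ext _ _ (λ { zero → ≡.refl ; (suc i) → e i })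

    -- `choices` splits off the first index, whereas the branching has to treat the last row of a
    -- shape separately.
    ∑-choices-last : ∀ n {A : Fin (suc n) → Set b} (xss : ∀ i → List (A i)) {G} → Extensional G →
      ∑ (choices (suc n) xss) G
        ≈ ∑ (choices n (xss ∘ inject₁)) (λ f → ∑ (xss (fromℕ n)) (λ x → G (snocᵈ f x)))
    ∑-choices-last zero xss {G} ext = begin
      ∑ (choices 1 xss) G ≈⟨ ∑-choices-suc xss ext ⟩
      ∑ (xss zero) (λ x → ∑ (choices 0 (xss ∘ suc)) (λ f → G (x ∷ᵈ f)))
        ≈⟨ ∑-cong (xss zero) (λ x → trans (∑-choices-zero (xss ∘ suc) (∷ᵈ-ext ext x) (λ ()))
             (ext _ (snocᵈ (λ ()) x) (λ { zero → ≡.refl }))) ⟩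
      ∑ (xss zero) (λ x → G (snocᵈ (λ ()) x))
        ≈⟨ ∑-choices-zero (xss ∘ inject₁) (λ f g e → ∑-cong (xss zero) (λ x →
             ext (snocᵈ f x) (snocᵈ g x) (λ { zero → ≡.refl }))) (λ ()) ⟨
      ∑ (choices 0 (xss ∘ inject₁)) (λ f → ∑ (xss zero) (λ x → G (snocᵈ f x))) ∎
    ∑-choices-last (suc n) {A} xss {G} ext = begin
      ∑ (choices (suc (suc n)) xss) G ≈⟨ ∑-choices-suc xss ext ⟩
      ∑ (xss zero) (λ x → ∑ (choices (suc n) (xss ∘ suc)) (λ f → G (x ∷ᵈ f)))
        ≈⟨ ∑-cong (xss zero) (λ x → ∑-choices-last n (xss ∘ suc) (∷ᵈ-ext ext x)) ⟩
      ∑ (xss zero) (λ x → ∑ (choices n (λ i → xss (suc (inject₁ i))))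
        (λ f → ∑ (xss (suc (fromℕ n))) (λ y → G (x ∷ᵈ snocᵈ f y))))
        ≈⟨ ∑-cong (xss zero) (λ x → ∑-cong (choices n _) (λ f → ∑-cong (xss (fromℕ (suc n)))
             (λ y → ext _ (snocᵈ (x ∷ᵈ f) y) (λ { zero → ≡.refl ; (suc i) → ≡.refl })))) ⟩
      ∑ (xss zero) (λ x → ∑ (choices n (λ i → xss (suc (inject₁ i))))
        (λ f → ∑ (xss (suc (fromℕ n))) (λ y → G (snocᵈ (x ∷ᵈ f) y))))
        ≈⟨ ∑-choices-suc (xss ∘ inject₁) (λ f g e → ∑-cong (xss (fromℕ (suc n)))
             (λ y → ext _ _ (snoc-cong f g e y))) ⟨
      ∑ (choices (suc n) (xss ∘ inject₁)) (λ f → ∑ (xss (fromℕ (suc n))) (λ x → G (snocᵈ f x))) ∎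
      where
      snoc-cong : ∀ {n} {A : Fin (suc n) → Set b} (f g : ∀ i → A (inject₁ i)) →
                  (∀ i → f i ≡ g i) → ∀ y i → snocᵈ {A = A} f y i ≡ snocᵈ {A = A} g y i
      snoc-cong {zero}  f g e y zero    = ≡.refl
      snoc-cong {suc n} f g e y zero    = e zero
      snoc-cong {suc n} {A} f g e y (suc i) =
        snoc-cong {A = λ j → A (suc j)} (λ j → f (suc j)) (λ j → g (suc j)) (λ j → e (suc j)) y i

-- Injections of a finite set into itself

⊆⇒↭ : ∀ {a} {A : Set a} {xs ys : List A} → Unique xs → (∀ {z} → z ∈ xs → z ∈ ys) →
      List.length ys ℕ.≤ List.length xs → xs ↭ ys
⊆⇒↭ {xs = []}     {[]}    u sub le = ↭.refl
⊆⇒↭ {xs = x ∷ xs} {ys} (x∉xs ∷ᵖ u) sub le with ys₁ , ys₂ , ≡.refl ← ∈-∃++ (sub (here ≡.refl)) =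
  ↭.trans (↭.prep x (⊆⇒↭ u sub′ le′)) (↭.↭-sym (↭.shift x ys₁ ys₂))
  where
  sub′ : ∀ {z} → z ∈ xs → z ∈ ys₁ ++ ys₂
  sub′ {z} z∈xs with ∈-++⁻ ys₁ (sub (there z∈xs))
  ... | inj₁ z∈ys₁             = ∈-++⁺ˡ z∈ys₁
  ... | inj₂ (here ≡.refl)     = contradiction ≡.refl (All.lookup x∉xs z∈xs)
  ... | inj₂ (there z∈ys₂)     = ∈-++⁺ʳ ys₁ z∈ys₂
  le′ : List.length (ys₁ ++ ys₂) ℕ.≤ List.length xs
  le′ = ℕ.s≤s⁻¹ (subst (ℕ._≤ suc (List.length xs)) (↭.↭-length (↭.shift x ys₁ ys₂)) le)

injective⇒surjective : ∀ {n} {f : Fin n → Fin n} → Injective _≡_ _≡_ f →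
                       ∀ y → ∃ λ x → f x ≡ y
injective⇒surjective {suc n} {f} inj y with Fin.any? (λ x → f x Fin.≟ y)
... | yes hit = hit
... | no miss with i , j , lt , e ← Fin.pigeonhole (ℕ.n<1+n n) (λ x → Fin.punchOut (miss ∘ (x ,_) ∘ ≡.sym))
  = contradiction (inj (Fin.punchOut-injective (miss ∘ (i ,_) ∘ ≡.sym) (miss ∘ (j ,_) ∘ ≡.sym) e)) (Fin.<⇒≢ lt)

-- `_↭_` is generated by swaps of neighbours, exactly the moves that change a wedge product by the
-- factor -1.
tabulate-↭ : ∀ {n} {f g : Fin n → Fin n} → Injective _≡_ _≡_ f → Injective _≡_ _≡_ g →
             List.tabulate f ↭ List.tabulate g
tabulate-↭ {f = f} {g} f-inj g-inj = ⊆⇒↭ (tabulate⁺ f-inj) sub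
  (ℕ.≤-reflexive (≡.trans (List.length-tabulate g) (≡.sym (List.length-tabulate f))))
  where
  sub : ∀ {z} → z ∈ List.tabulate f → z ∈ List.tabulate g
  sub {z} _ with x , ≡.refl ← injective⇒surjective g-inj z = ∈-tabulate⁺ x

-- Exterior algebra and determinants

-- Λ n is the exterior algebra of the free module of rank n, an element being
-- the family of its coordinates, indexed by the subsets of the basis.  The head
-- of a subset says whether it contains the last basis vector.

module Exterior {a ℓ} (S : CommutativeRing a ℓ) where

  open Sums S

  Vect : ℕ → Set a
  Vect n = Fin n → Carrier

  Λ : ℕ → Set a
  Λ n = Vec Bool n → Carrier

  infixr 7 _∧_

  -- Let e be the last basis vector, ψ = ψ₀ + e ∧ ψ₁ and c = c′ + k e. The part of c ∧ ψ that
  -- contains e is e ∧ (k ψ₀ - c′ ∧ ψ₁); the minus sign comes from moving e past c′.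
  _∧_ : ∀ {n} → Vect n → Λ n → Λ n
  (c ∧ ψ) Vec.[]              = 0#
  (c ∧ ψ) (true Vec.∷ s)  =
    c (fromℕ _) * ψ (false Vec.∷ s) - ((c ∘ inject₁) ∧ (ψ ∘ (true Vec.∷_))) s
  (c ∧ ψ) (false Vec.∷ s) = ((c ∘ inject₁) ∧ (ψ ∘ (false Vec.∷_))) s

  ∧-cong : ∀ {n} {c d : Vect n} {ψ φ : Λ n} → (∀ i → c i ≈ d i) → (∀ s → ψ s ≈ φ s) →
           ∀ s → (c ∧ ψ) s ≈ (d ∧ φ) s
  ∧-cong e f Vec.[]              = refl
  ∧-cong e f (true Vec.∷ s)  = +-cong (*-cong (e _) (f _))
    (-‿cong (∧-cong (e ∘ inject₁) (f ∘ (true Vec.∷_)) s))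
  ∧-cong e f (false Vec.∷ s) = ∧-cong (e ∘ inject₁) (f ∘ (false Vec.∷_)) s

  ∧-congˡ : ∀ {n} (c : Vect n) {ψ φ : Λ n} → (∀ s → ψ s ≈ φ s) → ∀ s → (c ∧ ψ) s ≈ (c ∧ φ) s
  ∧-congˡ c = ∧-cong {c = c} (λ _ → refl)

  ∧-congʳ : ∀ {n} {c d : Vect n} (ψ : Λ n) → (∀ i → c i ≈ d i) → ∀ s → (c ∧ ψ) s ≈ (d ∧ ψ) s
  ∧-congʳ ψ e = ∧-cong {ψ = ψ} e (λ _ → refl)

  private
    +-sub : ∀ x y z w → (x + y) - (z + w) ≈ (x - z) + (y - w)
    +-sub x y z w = trans (+-congˡ (sym (-‿+-comm z w))) (interchange _ _ _ _)

    *-sub : ∀ k x y → k * x - k * y ≈ k * (x - y)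
    *-sub k x y = trans (+-congˡ (-‿distribʳ-* k y)) (sym (distribˡ k x (- y)))

    sub-zero : ∀ {x y} → x ≈ 0# → y ≈ 0# → x - y ≈ 0#
    sub-zero e f = trans (+-cong e (trans (-‿cong f) -0#≈0#)) (+-identityʳ 0#)

  ∧-+ʳ : ∀ {n} (c : Vect n) (ψ φ : Λ n) s →
         (c ∧ (λ u → ψ u + φ u)) s ≈ (c ∧ ψ) s + (c ∧ φ) s
  ∧-+ʳ c ψ φ Vec.[]              = sym (+-identityʳ 0#)
  ∧-+ʳ c ψ φ (true Vec.∷ s)  = trans
    (+-cong (distribˡ _ _ _) (-‿cong (∧-+ʳ (c ∘ inject₁) _ _ s))) (+-sub _ _ _ _)
  ∧-+ʳ c ψ φ (false Vec.∷ s) = ∧-+ʳ (c ∘ inject₁) _ _ s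

  ∧-+ˡ : ∀ {n} (c d : Vect n) (ψ : Λ n) s →
         ((λ i → c i + d i) ∧ ψ) s ≈ (c ∧ ψ) s + (d ∧ ψ) s
  ∧-+ˡ c d ψ Vec.[]              = sym (+-identityʳ 0#)
  ∧-+ˡ c d ψ (true Vec.∷ s)  = trans
    (+-cong (distribʳ _ _ _) (-‿cong (∧-+ˡ (c ∘ inject₁) _ _ s))) (+-sub _ _ _ _)
  ∧-+ˡ c d ψ (false Vec.∷ s) = ∧-+ˡ (c ∘ inject₁) _ _ s

  ∧-*ʳ : ∀ {n} k (c : Vect n) (ψ : Λ n) s → (c ∧ (λ u → k * ψ u)) s ≈ k * (c ∧ ψ) s
  ∧-*ʳ k c ψ Vec.[]              = sym (zeroʳ k)
  ∧-*ʳ k c ψ (true Vec.∷ s)  = trans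
    (+-cong (*-swapˡ _ _ _) (-‿cong (∧-*ʳ k (c ∘ inject₁) _ s))) (*-sub _ _ _)
  ∧-*ʳ k c ψ (false Vec.∷ s) = ∧-*ʳ k (c ∘ inject₁) _ s

  ∧-*ˡ : ∀ {n} k (c : Vect n) (ψ : Λ n) s → ((λ i → k * c i) ∧ ψ) s ≈ k * (c ∧ ψ) s
  ∧-*ˡ k c ψ Vec.[]              = sym (zeroʳ k)
  ∧-*ˡ k c ψ (true Vec.∷ s)  = trans
    (+-cong (*-assoc _ _ _) (-‿cong (∧-*ˡ k (c ∘ inject₁) _ s))) (*-sub _ _ _)
  ∧-*ˡ k c ψ (false Vec.∷ s) = ∧-*ˡ k (c ∘ inject₁) _ s

  ∧-zeroʳ : ∀ {n} (c : Vect n) {ψ : Λ n} → (∀ s → ψ s ≈ 0#) → ∀ s → (c ∧ ψ) s ≈ 0#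
  ∧-zeroʳ c e Vec.[]              = refl
  ∧-zeroʳ c e (true Vec.∷ s)  =
    sub-zero (trans (*-congˡ (e _)) (zeroʳ _)) (∧-zeroʳ (c ∘ inject₁) (e ∘ (true Vec.∷_)) s)
  ∧-zeroʳ c e (false Vec.∷ s) = ∧-zeroʳ (c ∘ inject₁) (e ∘ (false Vec.∷_)) s

  ∧-zeroˡ : ∀ {n} {c : Vect n} (ψ : Λ n) → (∀ i → c i ≈ 0#) → ∀ s → (c ∧ ψ) s ≈ 0#
  ∧-zeroˡ ψ e Vec.[]              = refl
  ∧-zeroˡ ψ e (true Vec.∷ s)  =
    sub-zero (trans (*-congʳ (e _)) (zeroˡ _)) (∧-zeroˡ (ψ ∘ (true Vec.∷_)) (e ∘ inject₁) s)
  ∧-zeroˡ ψ e (false Vec.∷ s) = ∧-zeroˡ (ψ ∘ (false Vec.∷_)) (e ∘ inject₁) s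

  -- Proved by induction on the rank and not from antisymmetry, which would only show that twice the
  -- value vanishes. The two mixed terms cancel and c′ ∧ c′ ∧ ψ₁ is the induction hypothesis.
  ∧-self : ∀ {n} (c : Vect n) (ψ : Λ n) s → (c ∧ c ∧ ψ) s ≈ 0#
  ∧-self c ψ Vec.[]              = refl
  ∧-self {suc n} c ψ (true Vec.∷ s)  = begin
    k * (c′ ∧ ψf) s - (c′ ∧ (λ u → k * ψf u - (c′ ∧ ψt) u)) s
      ≈⟨ +-congˡ (-‿cong (trans (∧-+ʳ c′ _ _ s) (+-cong (∧-*ʳ k c′ ψf s) negated))) ⟩
    k * (c′ ∧ ψf) s - (k * (c′ ∧ ψf) s + 0#) ≈⟨ +-congˡ (-‿cong (+-identityʳ _)) ⟩
    k * (c′ ∧ ψf) s - k * (c′ ∧ ψf) s ≈⟨ -‿inverseʳ _ ⟩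
    0# ∎
    where
    k = c (fromℕ n)
    c′ = c ∘ inject₁
    ψf = ψ ∘ (false Vec.∷_)
    ψt = ψ ∘ (true Vec.∷_)
    negated : (c′ ∧ (λ u → - (c′ ∧ ψt) u)) s ≈ 0#
    negated = begin
      (c′ ∧ (λ u → - (c′ ∧ ψt) u)) s       ≈⟨ ∧-congˡ c′ (λ u → sym (-1*x≈-x _)) s ⟩
      (c′ ∧ (λ u → - 1# * (c′ ∧ ψt) u)) s ≈⟨ ∧-*ʳ (- 1#) c′ _ s ⟩
      - 1# * (c′ ∧ c′ ∧ ψt) s              ≈⟨ *-congˡ (∧-self c′ ψt s) ⟩
      - 1# * 0#                             ≈⟨ zeroʳ _ ⟩
      0#                                    ∎
  ∧-self c ψ (false Vec.∷ s) = ∧-self (c ∘ inject₁) _ s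

  -- Polarisation of `∧-self` at c + d.
  ∧-antisym : ∀ {n} (c d : Vect n) (ψ : Λ n) s → (c ∧ d ∧ ψ) s ≈ - 1# * (d ∧ c ∧ ψ) s
  ∧-antisym c d ψ s = trans (+-inverseˡ-unique _ _ (begin
    (c ∧ d ∧ ψ) s + (d ∧ c ∧ ψ) s
      ≈⟨ +-cong (trans (sym (+-identityˡ _)) (+-congʳ (sym (∧-self c ψ s))))
                (trans (sym (+-identityʳ _)) (+-congˡ (sym (∧-self d ψ s)))) ⟩
    ((c ∧ c ∧ ψ) s + (c ∧ d ∧ ψ) s) + ((d ∧ c ∧ ψ) s + (d ∧ d ∧ ψ) s)
      ≈⟨ +-cong (split c) (split d) ⟨
    (c ∧ c+d ∧ ψ) s + (d ∧ c+d ∧ ψ) s ≈⟨ ∧-+ˡ c d _ s ⟨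
    (c+d ∧ c+d ∧ ψ) s ≈⟨ ∧-self c+d ψ s ⟩
    0# ∎)) (sym (-1*x≈-x _))
    where
    c+d : Vect _
    c+d i = c i + d i
    split : ∀ b → (b ∧ c+d ∧ ψ) s ≈ (b ∧ c ∧ ψ) s + (b ∧ d ∧ ψ) s
    split b = trans (∧-congˡ b (∧-+ˡ c d ψ) s) (∧-+ʳ b _ _ s)

  ∧-∑ʳ : ∀ {n b} {A : Set b} (c : Vect n) (xs : List A) (k : A → Carrier) (ψ : A → Λ n) s →
         (c ∧ (λ u → ∑ xs (λ x → k x * ψ x u))) s ≈ ∑ xs (λ x → k x * (c ∧ ψ x) s)
  ∧-∑ʳ c []       k ψ s = ∧-zeroʳ c (λ _ → refl) s
  ∧-∑ʳ c (x ∷ xs) k ψ s = trans (∧-+ʳ c _ _ s) (+-cong (∧-*ʳ (k x) c (ψ x) s) (∧-∑ʳ c xs k ψ s))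

  ∧-∑ˡ : ∀ {n b} {A : Set b} (xs : List A) (k : A → Carrier) (c : A → Vect n) (ψ : Λ n) s →
         ((λ i → ∑ xs (λ x → k x * c x i)) ∧ ψ) s ≈ ∑ xs (λ x → k x * (c x ∧ ψ) s)
  ∧-∑ˡ []       k c ψ s = ∧-zeroˡ ψ (λ _ → refl) s
  ∧-∑ˡ (x ∷ xs) k c ψ s = trans (∧-+ˡ _ _ ψ s) (+-cong (∧-*ˡ (k x) (c x) ψ s) (∧-∑ˡ xs k c ψ s))

  unit : ∀ {n} → Λ n
  unit Vec.[]              = 1#
  unit (true Vec.∷ s)  = 0#
  unit (false Vec.∷ s) = unit s

  wedges : ∀ {n} k → (Fin k → Vect n) → Λ n → Λ n
  wedges zero    c ψ = ψ
  wedges (suc k) c ψ = c zero ∧ wedges k (c ∘ suc) ψ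

  full : ∀ {n} → Vec Bool n
  full = Vec.replicate _ true

  -- Coordinates refer to basis vectors in decreasing order, so this is the usual determinant times
  -- (-1)^(n(n-1)/2). That sign turns the alternant of the empty shape into `vandermonde`, whose
  -- factors are later minus earlier variables.
  det : ∀ n → (Fin n → Vect n) → Carrier
  det n c = wedges n c unit full

  wedges-cong : ∀ {n} k {c d : Fin k → Vect n} {ψ φ : Λ n} →
                (∀ j i → c j i ≈ d j i) → (∀ s → ψ s ≈ φ s) → ∀ s → wedges k c ψ s ≈ wedges k d φ s
  wedges-cong zero    e f s = f s
  wedges-cong (suc k) e f s = ∧-cong (e zero) (wedges-cong k (e ∘ suc) f) s

  wedges-last : ∀ {n} k (c : Fin (suc k) → Vect n) ψ s →
                wedges (suc k) c ψ s ≈ wedges k (c ∘ inject₁) (c (fromℕ k) ∧ ψ) s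
  wedges-last zero    c ψ s = refl
  wedges-last (suc k) c ψ s = ∧-congˡ (c zero) (wedges-last k (c ∘ suc) ψ) s

  -- Serves twice: to produce the sum over interlacing shapes in `alternant-step` and the sum over
  -- assignments of labels in `alternant-expand`.
  wedges-multilinear : ∀ {n b} k {A : Fin k → Set b} (xss : ∀ j → List (A j))
    (m : ∀ j → A j → Carrier) (v : ∀ j → A j → Vect n) ψ s →
    wedges k (λ j i → ∑ (xss j) (λ x → m j x * v j x i)) ψ s
      ≈ ∑ (choices k xss) (λ f → product (λ j → m j (f j)) * wedges k (λ j → v j (f j)) ψ s)
  wedges-multilinear zero    xss m v ψ s = sym (trans (+-identityʳ _) (*-identityˡ _))
  wedges-multilinear (suc k) xss m v ψ s = begin
    ((λ i → ∑ (xss zero) (λ x → m zero x * v zero x i)) ∧ rest) s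
      ≈⟨ ∧-∑ˡ (xss zero) (m zero) (v zero) rest s ⟩
    ∑ (xss zero) (λ x → m zero x * (v zero x ∧ rest) s)
      ≈⟨ ∑-cong (xss zero) (λ x → trans (*-congˡ (trans
           (∧-congˡ (v zero x) (wedges-multilinear k (xss ∘ suc) (m ∘ suc) (v ∘ suc) ψ) s)
           (∧-∑ʳ (v zero x) (choices k (xss ∘ suc)) _ _ s))) (*-distribˡ-∑ (m zero x) (choices k _) _)) ⟩
    ∑ (xss zero) (λ x → ∑ (choices k (xss ∘ suc)) (λ f →
      m zero x * (product (λ j → m (suc j) (f j)) *
        (v zero x ∧ wedges k (λ j → v (suc j) (f j)) ψ) s)))
      ≈⟨ ∑-cong (xss zero) (λ x → ∑-cong (choices k _) (λ f → *-assoc _ _ _)) ⟨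
    ∑ (xss zero) (λ x → ∑ (choices k (xss ∘ suc)) (λ f → term (x ∷ᵈ f)))
      ≈⟨ ∑-choices-suc xss term-ext ⟨
    ∑ (choices (suc k) xss) term ∎
    where
    rest = wedges k (λ j i → ∑ (xss (suc j)) (λ x → m (suc j) x * v (suc j) x i)) ψ
    term : _ → Carrier
    term f = product (λ j → m j (f j)) * wedges (suc k) (λ j → v j (f j)) ψ s
    term-ext : Extensional term
    term-ext f g e = *-cong (product-cong (λ j → reflexive (cong (m j) (e j))))
      (wedges-cong (suc k) (λ j i → reflexive (cong (λ y → v j y i) (e j))) (λ _ → refl) s)

  ∧-wedges-self : ∀ {n} k (c : Fin k → Vect n) j ψ s → (c j ∧ wedges k c ψ) s ≈ 0#
  ∧-wedges-self (suc k) c zero    ψ s = ∧-self (c zero) _ s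
  ∧-wedges-self (suc k) c (suc j) ψ s = begin
    (c (suc j) ∧ c zero ∧ wedges k (c ∘ suc) ψ) s        ≈⟨ ∧-antisym _ _ _ s ⟩
    - 1# * (c zero ∧ c (suc j) ∧ wedges k (c ∘ suc) ψ) s
      ≈⟨ *-congˡ (∧-zeroʳ (c zero) (∧-wedges-self k (c ∘ suc) j ψ) s) ⟩
    - 1# * 0#                                             ≈⟨ zeroʳ _ ⟩
    0#                                                    ∎

  wedges-alternating : ∀ {n} k (c : Fin k → Vect n) ψ i j → i Fin.< j →
                       (∀ l → c i l ≈ c j l) → ∀ s → wedges k c ψ s ≈ 0#
  wedges-alternating (suc k) c ψ zero    (suc j) lt e s = trans
    (∧-congʳ (wedges k (c ∘ suc) ψ) e s) (∧-wedges-self k (c ∘ suc) j ψ s)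
  wedges-alternating (suc k) c ψ (suc i) (suc j) lt e s =
    ∧-zeroʳ (c zero) (wedges-alternating k (c ∘ suc) ψ i j (ℕ.s<s⁻¹ lt) e) s

  -- Once the later columns are restored by induction, the multiple of column j + 1 added to column
  -- j is wedged with that same column and dies.
  wedges-column-op : ∀ {n} k (c d : Fin (suc k) → Vect n) (m : Fin k → Carrier) →
    (∀ j i → d (inject₁ j) i ≈ c (inject₁ j) i + m j * c (suc j) i) →
    (∀ i → d (fromℕ k) i ≈ c (fromℕ k) i) →
    ∀ ψ s → wedges (suc k) d ψ s ≈ wedges (suc k) c ψ s
  wedges-column-op zero    c d m e f ψ s = ∧-congʳ ψ f s
  wedges-column-op (suc k) c d m e f ψ s = begin
    (d zero ∧ wedges (suc k) (d ∘ suc) ψ) s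
      ≈⟨ ∧-cong (e zero) (wedges-column-op k (c ∘ suc) (d ∘ suc) (m ∘ suc) (e ∘ suc) f ψ) s ⟩
    ((λ i → c zero i + m zero * c (suc zero) i) ∧ rest) s ≈⟨ ∧-+ˡ _ _ rest s ⟩
    (c zero ∧ rest) s + ((λ i → m zero * c (suc zero) i) ∧ rest) s
      ≈⟨ +-congˡ (trans (∧-*ˡ (m zero) _ rest s) (trans (*-congˡ (∧-self (c (suc zero)) _ s)) (zeroʳ _))) ⟩
    (c zero ∧ rest) s + 0# ≈⟨ +-identityʳ _ ⟩
    (c zero ∧ rest) s ∎
    where rest = wedges (suc k) (c ∘ suc) ψ

  -- The last basis vector has to be moved past each of the k columns; every passage costs one sign,
  -- which is put on the column.
  wedges-headless : ∀ {n} k (c : Fin k → Vect (suc n)) → (∀ j → c j (fromℕ n) ≈ 0#) → ∀ ψ s →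
    wedges k c ψ (true Vec.∷ s) ≈ wedges k (λ j i → - c j (inject₁ i)) (ψ ∘ (true Vec.∷_)) s
  wedges-headless zero    c e ψ s = refl
  wedges-headless (suc k) c e ψ s = begin
    c zero (fromℕ _) * _ - ((c zero ∘ inject₁) ∧ ψ′) s
      ≈⟨ +-congʳ (trans (*-congʳ (e zero)) (zeroˡ _)) ⟩
    0# - ((c zero ∘ inject₁) ∧ ψ′) s ≈⟨ +-identityˡ _ ⟩
    - ((c zero ∘ inject₁) ∧ ψ′) s ≈⟨ -1*x≈-x _ ⟨
    - 1# * ((c zero ∘ inject₁) ∧ ψ′) s ≈⟨ ∧-*ˡ (- 1#) _ ψ′ s ⟨
    ((λ i → - 1# * c zero (inject₁ i)) ∧ ψ′) s
      ≈⟨ ∧-cong (λ i → -1*x≈-x _) (wedges-headless k (c ∘ suc) (e ∘ suc) ψ) s ⟩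
    wedges (suc k) (λ j i → - c j (inject₁ i)) (ψ ∘ (true Vec.∷_)) s ∎
    where ψ′ = wedges k (c ∘ suc) ψ ∘ (true Vec.∷_)

  -- Only the last column can supply the last basis vector. The signs are left on the other columns
  -- because `telescope` describes the negatives of the cleared columns.
  det-expand : ∀ n (c : Fin (suc n) → Vect (suc n)) → (∀ j → c (inject₁ j) (fromℕ n) ≈ 0#) →
    det (suc n) c ≈ c (fromℕ n) (fromℕ n) * det n (λ j i → - c (inject₁ j) (inject₁ i))
  det-expand n c e = begin
    wedges (suc n) c unit (true Vec.∷ full) ≈⟨ wedges-last n c unit (true Vec.∷ full) ⟩
    wedges n (c ∘ inject₁) (c (fromℕ n) ∧ unit) (true Vec.∷ full)
      ≈⟨ wedges-headless n (c ∘ inject₁) e _ full ⟩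
    wedges n c′ (λ s → h * unit s - ((c (fromℕ n) ∘ inject₁) ∧ (λ _ → 0#)) s) full
      ≈⟨ wedges-cong n (λ _ _ → refl) (λ s → trans (+-congˡ (trans
           (-‿cong (∧-zeroʳ _ (λ _ → refl) s)) -0#≈0#)) (+-identityʳ _)) full ⟩
    wedges n c′ (λ s → h * unit s) full ≈⟨ pull n c′ full ⟩
    h * det n c′ ∎
    where
    h = c (fromℕ n) (fromℕ n)
    c′ : Fin n → Vect n
    c′ j i = - c (inject₁ j) (inject₁ i)
    pull : ∀ k (d : Fin k → Vect n) s → wedges k d (λ u → h * unit u) s ≈ h * wedges k d unit s
    pull zero    d s = refl
    pull (suc k) d s = trans (∧-congˡ (d zero) (pull k (d ∘ suc)) s) (∧-*ʳ h (d zero) _ s)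

  private
    -- The factor by which the diagonal map with entries `D` acts on the coordinate of a subset.
    weight : ∀ {n} → Vect n → Λ n
    weight D Vec.[]              = 1#
    weight D (true Vec.∷ s)  = weight (D ∘ inject₁) s * D (fromℕ _)
    weight D (false Vec.∷ s) = weight (D ∘ inject₁) s

    ∧-scale : ∀ {n} (D c : Vect n) (ψ : Λ n) s →
              ((λ i → D i * c i) ∧ (λ u → weight D u * ψ u)) s ≈ weight D s * (c ∧ ψ) s
    ∧-scale D c ψ Vec.[] = sym (zeroʳ _)
    ∧-scale {suc n} D c ψ (true Vec.∷ s) = begin
      (D (fromℕ n) * c (fromℕ n)) * (w s * ψ (false Vec.∷ s))
        - ((λ i → D (inject₁ i) * c (inject₁ i)) ∧ (λ u → (w u * D (fromℕ n)) * ψ (true Vec.∷ u))) s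
        ≈⟨ +-cong (trans (*-interchange _ _ _ _) (*-congʳ (*-comm _ _)))
             (-‿cong (trans (∧-congˡ _ (λ u → trans (*-congʳ (*-comm _ _)) (*-assoc _ _ _)) s)
               (trans (∧-*ʳ (D (fromℕ n)) _ _ s) (trans (*-congˡ (∧-scale (D ∘ inject₁) (c ∘ inject₁) _ s))
                 (trans (sym (*-assoc _ _ _)) (*-congʳ (*-comm _ _))))))) ⟩
      (w s * D (fromℕ n)) * (c (fromℕ n) * ψ (false Vec.∷ s))
        - (w s * D (fromℕ n)) * ((c ∘ inject₁) ∧ (ψ ∘ (true Vec.∷_))) s ≈⟨ *-sub _ _ _ ⟩
      (w s * D (fromℕ n)) * (c ∧ ψ) (true Vec.∷ s) ∎
      where w = weight (D ∘ inject₁)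
    ∧-scale D c ψ (false Vec.∷ s) = ∧-scale (D ∘ inject₁) (c ∘ inject₁) _ s

    wedges-scale : ∀ {n} k (D : Vect n) (c : Fin k → Vect n) s →
      wedges k (λ j i → D i * c j i) unit s ≈ weight D s * wedges k c unit s
    wedges-scale zero    D c s = weight-unit D s
      where
      weight-unit : ∀ {n} (D : Vect n) s → unit s ≈ weight D s * unit s
      weight-unit D Vec.[]              = sym (*-identityʳ 1#)
      weight-unit D (true Vec.∷ s)  = sym (zeroʳ _)
      weight-unit D (false Vec.∷ s) = weight-unit (D ∘ inject₁) s
    wedges-scale (suc k) D c s = trans (∧-congˡ _ (wedges-scale k D (c ∘ suc)) s)
      (∧-scale D (c zero) _ s)

    weight-full : ∀ n (D : Vect n) → weight D full ≈ product D
    weight-full zero    D = refl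
    weight-full (suc n) D = trans (*-congʳ (weight-full n (D ∘ inject₁))) (sym (product-last n D))

  det-scale : ∀ n (D : Vect n) (c : Fin n → Vect n) →
              det n (λ j i → D i * c j i) ≈ product D * det n c
  det-scale n D c = trans (wedges-scale n D c full) (*-congʳ (weight-full n D))

  module _ {p} {P : Carrier → Set p} (P-0 : P 0#) (P-1 : P 1#)
           (P-sub : ∀ {x y} → P x → P y → P (x - y)) (P-* : ∀ {x y} → P x → P y → P (x * y)) where

    private
      ∧-closed : ∀ {n} {c : Vect n} {ψ : Λ n} → (∀ i → P (c i)) → (∀ s → P (ψ s)) → ∀ s → P ((c ∧ ψ) s)
      ∧-closed p q Vec.[]              = P-0
      ∧-closed p q (true Vec.∷ s)  = P-sub (P-* (p _) (q _)) (∧-closed (p ∘ inject₁) (q ∘ (true Vec.∷_)) s)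
      ∧-closed p q (false Vec.∷ s) = ∧-closed (p ∘ inject₁) (q ∘ (false Vec.∷_)) s

      wedges-closed : ∀ {n} k {c : Fin k → Vect n} → (∀ j i → P (c j i)) → ∀ s → P (wedges k c unit s)
      wedges-closed zero    p s = unit-closed s
        where
        unit-closed : ∀ {n} (s : Vec Bool n) → P (unit s)
        unit-closed Vec.[]              = P-1
        unit-closed (true Vec.∷ s)  = P-0
        unit-closed (false Vec.∷ s) = unit-closed s
      wedges-closed (suc k) p s = ∧-closed (p zero) (wedges-closed k (p ∘ suc)) s

    -- Differences and products are all that `_∧_` uses. The instance needed takes for `P` the
    -- constant Laurent polynomials.
    det-closed : ∀ n {c : Fin n → Vect n} → (∀ j i → P (c j i)) → P (det n c)
    det-closed n p = wedges-closed n p full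

  module _ {n} (b : Fin n → Vect n) where

    private
      wedgeList : List (Fin n) → Λ n → Λ n
      wedgeList []       ψ = ψ
      wedgeList (i ∷ is) ψ = b i ∧ wedgeList is ψ

      wedges-tabulate : ∀ k (f : Fin k → Fin n) ψ s →
                        wedges k (b ∘ f) ψ s ≈ wedgeList (List.tabulate f) ψ s
      wedges-tabulate zero    f ψ s = refl
      wedges-tabulate (suc k) f ψ s = ∧-congˡ (b (f zero)) (wedges-tabulate k (f ∘ suc) ψ) s

      -- The sign is kept as an unspecified factor ε independent of ψ and s, since only vanishing is
      -- transferred from one ordering to another.
      wedgeList-↭ : ∀ {is js} → is ↭ js → ∃ λ ε → ∀ ψ s → wedgeList is ψ s ≈ ε * wedgeList js ψ s
      wedgeList-↭ ↭.refl = 1# , λ ψ s → sym (*-identityˡ _)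
      wedgeList-↭ (↭.prep i p) with ε , e ← wedgeList-↭ p =
        ε , λ ψ s → trans (∧-congˡ (b i) (e ψ) s) (∧-*ʳ ε (b i) _ s)
      wedgeList-↭ (↭.swap i j p) with ε , e ← wedgeList-↭ p =
        - 1# * ε , λ ψ s → begin
          (b i ∧ b j ∧ _) s              ≈⟨ ∧-antisym (b i) (b j) _ s ⟩
          - 1# * (b j ∧ b i ∧ _) s       ≈⟨ *-congˡ (∧-congˡ (b j) (∧-congˡ (b i) (e ψ)) s) ⟩
          - 1# * (b j ∧ b i ∧ (λ u → ε * _)) s
            ≈⟨ *-congˡ (trans (∧-congˡ (b j) (∧-*ʳ ε (b i) _) s) (∧-*ʳ ε (b j) _ s)) ⟩
          - 1# * (ε * (b j ∧ b i ∧ _) s) ≈⟨ *-assoc _ _ _ ⟨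
          - 1# * ε * (b j ∧ b i ∧ _) s   ∎
      wedgeList-↭ (↭.trans p q) with ε , e ← wedgeList-↭ p | δ , f ← wedgeList-↭ q =
        ε * δ , λ ψ s → trans (e ψ s) (trans (*-congˡ (f ψ s)) (sym (*-assoc _ _ _)))

    det-permute : ∀ {f g : Fin n → Fin n} → Injective _≡_ _≡_ f → Injective _≡_ _≡_ g →
                  det n (b ∘ g) ≈ 0# → det n (b ∘ f) ≈ 0#
    det-permute {f} {g} f-inj g-inj e
      with ε , h ← wedgeList-↭ (tabulate-↭ {f = f} {g} f-inj g-inj) = begin
      det n (b ∘ f)                               ≈⟨ wedges-tabulate n f unit full ⟩
      wedgeList (List.tabulate f) unit full       ≈⟨ h unit full ⟩
      ε * wedgeList (List.tabulate g) unit full   ≈⟨ *-congˡ (wedges-tabulate n g unit full) ⟨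
      ε * det n (b ∘ g)                           ≈⟨ *-congˡ e ⟩
      ε * 0#                                      ≈⟨ zeroʳ ε ⟩
      0#                                          ∎

    det-noninjective : ∀ {f : Fin n → Fin n} i j → i Fin.< j → f i ≡ f j → det n (b ∘ f) ≈ 0#
    det-noninjective {f} i j lt e =
      wedges-alternating n (b ∘ f) unit i j lt (λ l → reflexive (cong (λ k → b k l) e)) full

-- Semistandard tableaux and removal of the largest letter

Shape : ℕ → Set
Shape k = Fin k → ℕ

Decreasing : ∀ {k} → Shape k → Set
Decreasing κ = ∀ i j → i Fin.≤ j → κ j ℕ.≤ κ i

Tableau : ∀ {k} → ℕ → Shape k → Set
Tableau n κ = ∀ i → Fin (κ i) → Fin n

Monotone : ∀ {m n} → (Fin m → Fin n) → Set
Monotone f = ∀ j j′ → j Fin.≤ j′ → f j Fin.≤ f j′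

ColumnStrict : ∀ {k n} (κ : Shape k) → Tableau n κ → Set
ColumnStrict κ T =
  ∀ i i′ → i Fin.< i′ → ∀ j j′ → toℕ j ≡ toℕ j′ → T i j Fin.< T i′ j′

IsSemistandard : ∀ {k n} (κ : Shape k) → Tableau n κ → Set
IsSemistandard κ T = (∀ i → Monotone (T i)) × ColumnStrict κ T

-- Spelled like `semistandard?`, so that `schur≈schurSum` needs no comparison of the two deciders.
isSemistandard? : ∀ {k n} (κ : Shape k) (T : Tableau n κ) → Dec (IsSemistandard κ T)
isSemistandard? κ T =
    (Fin.all? λ i → Fin.all? λ j → Fin.all? λ j′ →
       (j Fin.≤? j′) →-dec (T i j Fin.≤? T i j′))
  ×-dec
    (Fin.all? λ i → Fin.all? λ i′ → (i Fin.<? i′) →-dec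
       (Fin.all? λ j → Fin.all? λ j′ →
         (toℕ j ℕ.≟ toℕ j′) →-dec (T i j Fin.<? T i′ j′)))

-- A weakly increasing row is determined by its entries other than the largest
-- letter, which come first.

extend : ∀ {n} ℓ (m : Fin (suc ℓ)) → (Fin (toℕ m) → Fin n) → Fin ℓ → Fin (suc n)
extend (suc ℓ) zero    g j       = fromℕ _
extend (suc ℓ) (suc m) g zero    = inject₁ (g zero)
extend (suc ℓ) (suc m) g (suc j) = extend ℓ m (g ∘ suc) j

extend-cong : ∀ {n} ℓ m {f g : Fin (toℕ m) → Fin n} → (∀ j → f j ≡ g j) →
              ∀ j → extend ℓ m f j ≡ extend ℓ m g j
extend-cong (suc ℓ) zero    e j       = ≡.refl
extend-cong (suc ℓ) (suc m) e zero    = cong inject₁ (e zero)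
extend-cong (suc ℓ) (suc m) e (suc j) = extend-cong ℓ m (e ∘ suc) j

extend-view : ∀ {n} ℓ m (g : Fin (toℕ m) → Fin n) j →
  (∃ λ j′ → toℕ j′ ≡ toℕ j × extend ℓ m g j ≡ inject₁ (g j′)) ⊎
  (toℕ m ℕ.≤ toℕ j × extend ℓ m g j ≡ fromℕ n)
extend-view (suc ℓ) zero    g j       = inj₂ (ℕ.z≤n , ≡.refl)
extend-view (suc ℓ) (suc m) g zero    = inj₁ (zero , ≡.refl , ≡.refl)
extend-view (suc ℓ) (suc m) g (suc j) with extend-view ℓ m (g ∘ suc) j
... | inj₁ (j′ , e , f) = inj₁ (suc j′ , cong suc e , f)
... | inj₂ (le , f)     = inj₂ (ℕ.s≤s le , f)

embed : ∀ ℓ (m : Fin (suc ℓ)) → Fin (toℕ m) → Fin ℓ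
embed ℓ m j = Fin.inject≤ j (Fin.toℕ≤pred[n] m)

extend-embed : ∀ {n} ℓ m (g : Fin (toℕ m) → Fin n) j → extend ℓ m g (embed ℓ m j) ≡ inject₁ (g j)
extend-embed ℓ m g j with extend-view ℓ m g (embed ℓ m j)
... | inj₁ (j′ , e , f) = ≡.trans f (cong (inject₁ ∘ g)
  (Fin.toℕ-injective (≡.trans e (Fin.toℕ-inject≤ j _))))
... | inj₂ (le , f) = contradiction (ℕ.<-≤-trans (Fin.toℕ<n j)
  (subst (toℕ m ℕ.≤_) (Fin.toℕ-inject≤ j _) le)) (ℕ.<-irrefl ≡.refl)

Subshape : ∀ {k} → Shape k → Set
Subshape κ = ∀ i → Fin (suc (κ i))

shape : ∀ {k} {κ : Shape k} → Subshape κ → Shape k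
shape μ i = toℕ (μ i)

extendAll : ∀ {k n} {κ : Shape k} (μ : Subshape κ) → Tableau n (shape μ) → Tableau (suc n) κ
extendAll {κ = κ} μ T i = extend (κ i) (μ i) (T i)

HorizontalStrip : ∀ {k} (κ : Shape k) → Subshape κ → Set
HorizontalStrip κ μ = ∀ i i′ → i Fin.< i′ → κ i′ ℕ.≤ toℕ (μ i)

horizontalStrip? : ∀ {k} (κ : Shape k) μ → Dec (HorizontalStrip κ μ)
horizontalStrip? κ μ = Fin.all? λ i → Fin.all? λ i′ → (i Fin.<? i′) →-dec (κ i′ ℕ.≤? toℕ (μ i))

strip-decreasing : ∀ {k} {κ : Shape k} μ → HorizontalStrip κ μ → Decreasing (shape μ)
strip-decreasing μ h i j i≤j with Fin._≟_ i j
... | yes ≡.refl = ℕ.≤-refl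
... | no  i≢j    = ℕ.≤-trans (Fin.toℕ≤pred[n] (μ j)) (h i j (Fin.≤∧≢⇒< i≤j i≢j))

module _ {k n} {κ : Shape k} (κ↓ : Decreasing κ) (μ : Subshape κ) (T : Tableau n (shape μ)) where

  private
    inner : ∀ i j → toℕ (extendAll μ T i (embed (κ i) (μ i) j)) ≡ toℕ (T i j)
    inner i j = ≡.trans (cong toℕ (extend-embed (κ i) (μ i) (T i) j)) (Fin.toℕ-inject₁ _)

    toℕ-embed : ∀ i j → toℕ (embed (κ i) (μ i) j) ≡ toℕ j
    toℕ-embed i j = Fin.toℕ-inject≤ j _

  extend-semistandard⁻ : IsSemistandard κ (extendAll μ T) →
                         HorizontalStrip κ μ × IsSemistandard (shape μ) T
  extend-semistandard⁻ (rows , cols) = strip , rows′ , cols′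
    where
    rows′ : ∀ i → Monotone (T i)
    rows′ i j j′ le = subst₂ ℕ._≤_ (inner i j) (inner i j′) (rows i _ _
      (subst₂ ℕ._≤_ (≡.sym (toℕ-embed i j)) (≡.sym (toℕ-embed i j′)) le))
    cols′ : ColumnStrict (shape μ) T
    cols′ i i′ lt j j′ e = subst₂ ℕ._<_ (inner i j) (inner i′ j′) (cols i i′ lt _ _
      (≡.trans (toℕ-embed i j) (≡.trans e (≡.sym (toℕ-embed i′ j′)))))
    strip : HorizontalStrip κ μ
    strip i i′ lt with κ i′ ℕ.≤? toℕ (μ i)
    ... | yes le = le
    -- Column `toℕ (μ i)` would hold the largest letter in row i and still have a cell in the lower
    -- row i′, for which no larger letter is left.
    ... | no ¬le = contradiction (cols i i′ lt j j′ (≡.trans toℕ-j (≡.sym (Fin.toℕ-fromℕ< μ<κ′))))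
      (ℕ.≤⇒≯ (subst (toℕ (extendAll μ T i′ j′) ℕ.≤_) (≡.sym top-entry) (Fin.≤fromℕ _)))
      where
      μ<κ′ = ℕ.≰⇒> ¬le
      μ<κ = ℕ.<-≤-trans μ<κ′ (κ↓ i i′ (ℕ.<⇒≤ lt))
      j  = Fin.fromℕ< μ<κ
      j′ = Fin.fromℕ< μ<κ′
      toℕ-j : toℕ j ≡ toℕ (μ i)
      toℕ-j = Fin.toℕ-fromℕ< μ<κ
      top-entry : toℕ (extendAll μ T i j) ≡ toℕ (fromℕ n)
      top-entry with extend-view (κ i) (μ i) (T i) j
      ... | inj₂ (_ , e) = cong toℕ e
      ... | inj₁ (l , e , _) = contradiction (subst (ℕ._< toℕ (μ i)) (≡.trans e toℕ-j) (Fin.toℕ<n l))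
        (ℕ.<-irrefl ≡.refl)

  extend-semistandard⁺ : HorizontalStrip κ μ → IsSemistandard (shape μ) T →
                         IsSemistandard κ (extendAll μ T)
  extend-semistandard⁺ strip (rows , cols) = rows′ , cols′
    where
    rows′ : ∀ i → Monotone (extendAll μ T i)
    rows′ i j j′ le with extend-view (κ i) (μ i) (T i) j′ | extend-view (κ i) (μ i) (T i) j
    ... | inj₂ (_ , e)      | _                 rewrite e = Fin.≤fromℕ _
    ... | inj₁ (l′ , q , e) | inj₂ (m≤j , _)    = contradiction
      (ℕ.<-≤-trans (subst (ℕ._< toℕ (μ i)) q (Fin.toℕ<n l′)) (ℕ.≤-trans m≤j le)) (ℕ.<-irrefl ≡.refl)
    ... | inj₁ (l′ , q , e) | inj₁ (l , p , e′) rewrite e | e′ | Fin.toℕ-inject₁ (T i l) | Fin.toℕ-inject₁ (T i l′)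
      = rows i l l′ (subst₂ ℕ._≤_ (≡.sym p) (≡.sym q) le)
    cols′ : ColumnStrict κ (extendAll μ T)
    cols′ i i′ lt j j′ eq with extend-view (κ i) (μ i) (T i) j | extend-view (κ i′) (μ i′) (T i′) j′
    ... | inj₂ (m≤j , _)   | _ = contradiction
      (ℕ.<-≤-trans (Fin.toℕ<n j′) (ℕ.≤-trans (strip i i′ lt) (subst (toℕ (μ i) ℕ.≤_) eq m≤j)))
      (ℕ.<-irrefl ≡.refl)
    ... | inj₁ (l , p , e) | inj₂ (_ , e′) rewrite e | e′ | Fin.toℕ-inject₁ (T i l) | Fin.toℕ-fromℕ n =
      Fin.toℕ<n (T i l)
    ... | inj₁ (l , p , e) | inj₁ (l′ , q , e′)
      rewrite e | e′ | Fin.toℕ-inject₁ (T i l) | Fin.toℕ-inject₁ (T i′ l′) =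
      cols i i′ lt l l′ (≡.trans p (≡.trans eq (≡.sym q)))

-- Sums over tableaux

module Tableaux {a ℓ} (S : CommutativeRing a ℓ) where

  open Sums S

  -- Compares tableaux whose shapes are only propositionally equal; matching cells by their
  -- positions as numbers avoids transport of the rows.
  Similar : ∀ {k n} {κ κ′ : Shape k} → Tableau n κ → Tableau n κ′ → Set
  Similar T T′ = ∀ i j j′ → toℕ j ≡ toℕ j′ → T i j ≡ T′ i j′

  rowsOf : ∀ n m → List (Fin m → Fin n)
  rowsOf n m = choices m (λ _ → allFin n)

  tableauxOf : ∀ {k} n (κ : Shape k) → List (Tableau n κ)
  tableauxOf n κ = choices _ (λ i → rowsOf n (κ i))

  TableauExt : ∀ {k n} {κ : Shape k} → (Tableau n κ → Carrier) → Set _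
  TableauExt G = ∀ T T′ → (∀ i j → T i j ≡ T′ i j) → G T ≈ G T′

  ext⇒Extensional : ∀ {k n} {κ : Shape k} {G : Tableau n κ → Carrier} → TableauExt G → Extensional G
  ext⇒Extensional ext T T′ e = ext T T′ (λ i → cong-app (e i))

  ∷ᵈ-ext₁ : ∀ {k n} {κ : Shape (suc k)} {G : Tableau n κ → Carrier} → TableauExt G →
            ∀ f → TableauExt (λ T → G (f ∷ᵈ T))
  ∷ᵈ-ext₁ ext f T T′ e = ext _ _ (λ { zero j → ≡.refl ; (suc i) → e i })

  ∑-tableaux-cong : ∀ {k n} {κ κ′ : Shape k} → (∀ i → κ i ≡ κ′ i) →
    {G : Tableau n κ → Carrier} {G′ : Tableau n κ′ → Carrier} → TableauExt G → TableauExt G′ →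
    (∀ T T′ → Similar T T′ → G T ≈ G′ T′) → ∑ (tableauxOf n κ) G ≈ ∑ (tableauxOf n κ′) G′
  ∑-tableaux-cong {zero} e ext ext′ h = +-congʳ (h _ _ (λ ()))
  ∑-tableaux-cong {suc k} {n} {κ} {κ′} e {G} {G′} ext ext′ h = begin
    ∑ (tableauxOf n κ) G ≈⟨ ∑-choices-suc (λ i → rowsOf n (κ i)) (ext⇒Extensional ext) ⟩
    ∑ (rowsOf n (κ zero)) (λ f → ∑ (tableauxOf n (κ ∘ suc)) (λ T → G (f ∷ᵈ T)))
      ≈⟨ ∑-rows-cong (e zero) (λ f f′ f~f′ → ∑-tableaux-cong (e ∘ suc) (∷ᵈ-ext₁ ext f) (∷ᵈ-ext₁ ext′ f′)
           (λ T T′ T~T′ → h _ _ (λ { zero → f~f′ ; (suc i) → T~T′ i }))) ⟩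
    ∑ (rowsOf n (κ′ zero)) (λ f → ∑ (tableauxOf n (κ′ ∘ suc)) (λ T → G′ (f ∷ᵈ T)))
      ≈⟨ ∑-choices-suc (λ i → rowsOf n (κ′ i)) (ext⇒Extensional ext′) ⟨
    ∑ (tableauxOf n κ′) G′ ∎
    where
    ∑-rows-cong : ∀ {m m′} → m ≡ m′ → {R : (Fin m → Fin n) → Carrier} {R′ : (Fin m′ → Fin n) → Carrier} →
      (∀ f f′ → (∀ j j′ → toℕ j ≡ toℕ j′ → f j ≡ f′ j′) → R f ≈ R′ f′) →
      ∑ (rowsOf n m) R ≈ ∑ (rowsOf n m′) R′
    ∑-rows-cong {m} ≡.refl h = ∑-cong (rowsOf n m) (λ f → h f f (λ j j′ e → cong f (Fin.toℕ-injective e)))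

  -- Split by the first entry. A smaller letter lengthens the part before the largest letter by one;
  -- the largest letter forces, through `van`, the whole row to consist of it, which is the summand
  -- at m = 0.
  ∑-row-extend : ∀ {n} ℓ (G : (Fin ℓ → Fin (suc n)) → Carrier) → Extensional G →
    (∀ f → ¬ Monotone f → G f ≈ 0#) →
    ∑ (rowsOf (suc n) ℓ) G
      ≈ ∑ (allFin (suc ℓ)) (λ m → ∑ (rowsOf n (toℕ m)) (λ g → G (extend ℓ m g)))
  ∑-row-extend {n} zero G ext van = begin
    ∑ (rowsOf (suc n) 0) G ≈⟨ ∑-choices-zero {A = λ _ → Fin (suc n)} (λ _ → allFin (suc n)) ext (extend 0 zero (λ ())) ⟩
    G (extend 0 zero (λ ())) ≈⟨ trans (+-identityʳ _) (∑-choices-zero {A = λ _ → Fin n} (λ _ → allFin n)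
      (λ f g e → ext (extend 0 zero f) (extend 0 zero g) (λ ())) (λ ())) ⟨
    ∑ (allFin 1) (λ m → ∑ (rowsOf n (toℕ m)) (λ g → G (extend 0 m g))) ∎
  ∑-row-extend {n} (suc ℓ) G ext van = begin
    ∑ (rowsOf (suc n) (suc ℓ)) G ≈⟨ ∑-choices-suc (λ _ → allFin (suc n)) ext ⟩
    ∑ (allFin (suc n)) H ≈⟨ ∑-allFin-last n H ⟩
    ∑ (allFin n) (H ∘ inject₁) + H (fromℕ n) ≈⟨ +-cong smaller largest ⟩
    ∑ (allFin (suc ℓ)) (λ m → ∑ (rowsOf n (suc (toℕ m))) (λ g → G (extend (suc ℓ) (suc m) g)))
      + ∑ (rowsOf n 0) (λ g → G (extend (suc ℓ) zero g)) ≈⟨ +-comm _ _ ⟩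
    ∑ (rowsOf n 0) (λ g → G (extend (suc ℓ) zero g))
      + ∑ (allFin (suc ℓ)) (λ m → ∑ (rowsOf n (suc (toℕ m))) (λ g → G (extend (suc ℓ) (suc m) g)))
      ≈⟨ +-congˡ (∑-tabulate (suc ℓ) suc _) ⟨
    ∑ (allFin (suc (suc ℓ))) (λ m → ∑ (rowsOf n (toℕ m)) (λ g → G (extend (suc ℓ) m g))) ∎
    where
    H : Fin (suc n) → Carrier
    H c = ∑ (rowsOf (suc n) ℓ) (λ f → G (c ∷ᵈ f))
    H-extend : ∀ c → H c ≈ ∑ (allFin (suc ℓ)) (λ m → ∑ (rowsOf n (toℕ m)) (λ g → G (c ∷ᵈ extend ℓ m g)))
    H-extend c = ∑-row-extend ℓ (λ f → G (c ∷ᵈ f)) (∷ᵈ-ext ext c)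
      (λ f ¬mono → van _ (λ mono → ¬mono (λ j j′ le → mono (suc j) (suc j′) (ℕ.s≤s le))))
    smaller : ∑ (allFin n) (H ∘ inject₁) ≈
      ∑ (allFin (suc ℓ)) (λ m → ∑ (rowsOf n (suc (toℕ m))) (λ g → G (extend (suc ℓ) (suc m) g)))
    smaller = begin
      ∑ (allFin n) (H ∘ inject₁) ≈⟨ ∑-cong (allFin n) (H-extend ∘ inject₁) ⟩
      ∑ (allFin n) (λ c → ∑ (allFin (suc ℓ)) (λ m → ∑ (rowsOf n (toℕ m)) (λ g → G (inject₁ c ∷ᵈ extend ℓ m g))))
        ≈⟨ ∑-swap (allFin n) (allFin (suc ℓ)) _ ⟩
      ∑ (allFin (suc ℓ)) (λ m → ∑ (allFin n) (λ c → ∑ (rowsOf n (toℕ m)) (λ g → G (inject₁ c ∷ᵈ extend ℓ m g))))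
        ≈⟨ ∑-cong (allFin (suc ℓ)) (λ m → trans
             (∑-cong (allFin n) (λ c → ∑-cong (rowsOf n (toℕ m)) (λ g →
               ext _ (extend (suc ℓ) (suc m) (c ∷ᵈ g)) (λ { zero → ≡.refl ; (suc j) → ≡.refl }))))
             (sym (∑-choices-suc (λ _ → allFin n)
               (λ f g e → ext _ _ (extend-cong (suc ℓ) (suc m) e))))) ⟩
      _ ∎
    -- A smaller letter directly after the largest one breaks monotonicity. The copy `ℓ′` exposes
    -- whether there is a second cell.
    vanish : ∀ ℓ′ → ℓ ≡ ℓ′ → ∑ (allFin ℓ) (λ m → ∑ (rowsOf n (suc (toℕ m)))
      (λ g → G (fromℕ n ∷ᵈ extend ℓ (suc m) g))) ≈ 0#
    vanish zero     ≡.refl = refl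
    vanish (suc ℓ′) ≡.refl = ∑-zero (allFin ℓ) (λ m → ∑-zero (rowsOf n (suc (toℕ m))) (λ g → van _ (λ mono →
      contradiction (ℕ.<-≤-trans (subst₂ ℕ._<_ (≡.sym (Fin.toℕ-inject₁ (g zero))) (≡.sym (Fin.toℕ-fromℕ n))
        (Fin.toℕ<n (g zero))) (mono zero (suc zero) ℕ.z≤n)) (ℕ.<-irrefl ≡.refl))))
    largest : H (fromℕ n) ≈ ∑ (rowsOf n 0) (λ g → G (extend (suc ℓ) zero g))
    largest = begin
      H (fromℕ n) ≈⟨ H-extend (fromℕ n) ⟩
      ∑ (rowsOf n 0) (λ g → G (fromℕ n ∷ᵈ extend ℓ zero g)) + ∑ (List.tabulate suc) rest
        ≈⟨ +-cong (∑-cong (rowsOf n 0) (λ g → ext (fromℕ n ∷ᵈ extend ℓ zero g) _ (λ { zero → ≡.refl ; (suc j) → constant ℓ g j })))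
             (trans (∑-tabulate ℓ suc rest) (vanish ℓ ≡.refl)) ⟩
      ∑ (rowsOf n 0) (λ g → G (extend (suc ℓ) zero g)) + 0# ≈⟨ +-identityʳ _ ⟩
      _ ∎
      where
      rest : Fin (suc ℓ) → Carrier
      rest m = ∑ (rowsOf n (toℕ m)) (λ g → G (fromℕ n ∷ᵈ extend ℓ m g))
      constant : ∀ ℓ (g : Fin 0 → Fin n) j → extend ℓ zero g j ≡ fromℕ n
      constant (suc ℓ) g j = ≡.refl

  ∑-tableaux-extend : ∀ {k n} (κ : Shape k) (G : Tableau (suc n) κ → Carrier) → TableauExt G →
    (∀ T → ¬ (∀ i → Monotone (T i)) → G T ≈ 0#) →
    ∑ (tableauxOf (suc n) κ) G ≈
      ∑ (choices k (λ i → allFin (suc (κ i)))) (λ μ → ∑ (tableauxOf n (shape μ)) (λ T → G (extendAll μ T)))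
  ∑-tableaux-extend {zero} {n} κ G ext van = begin
    ∑ (tableauxOf (suc n) κ) G ≈⟨ trans (+-identityʳ _) (ext _ _ (λ ())) ⟩
    G (λ ()) ≈⟨ trans (+-identityʳ _) (trans (+-identityʳ _) (ext _ _ (λ ()))) ⟨
    _ ∎
  ∑-tableaux-extend {suc k} {n} κ G ext van = begin
    ∑ (tableauxOf (suc n) κ) G ≈⟨ ∑-choices-suc (λ i → rowsOf (suc n) (κ i)) (ext⇒Extensional ext) ⟩
    ∑ (rowsOf (suc n) (κ zero)) (λ f → ∑ (tableauxOf (suc n) (κ ∘ suc)) (λ T → G (f ∷ᵈ T)))
      ≈⟨ ∑-row-extend (κ zero) _ (λ f f′ e → ∑-cong (tableauxOf (suc n) (κ ∘ suc)) (λ T →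
           ext _ _ (λ { zero → e ; (suc i) j → ≡.refl })))
           (λ f ¬mono → ∑-zero (tableauxOf (suc n) (κ ∘ suc)) (λ T → van _ (λ mono → ¬mono (mono zero)))) ⟩
    ∑ (allFin (suc (κ zero))) (λ m → ∑ (rowsOf n (toℕ m)) (λ g →
      ∑ (tableauxOf (suc n) (κ ∘ suc)) (λ T → G (extend (κ zero) m g ∷ᵈ T))))
      ≈⟨ ∑-cong (allFin (suc (κ zero))) (λ m → ∑-cong (rowsOf n (toℕ m)) (λ g →
           ∑-tableaux-extend (κ ∘ suc) _ (∷ᵈ-ext₁ ext _) (λ T ¬mono → van _ (λ mono → ¬mono (mono ∘ suc))))) ⟩
    ∑ (allFin (suc (κ zero))) (λ m → ∑ (rowsOf n (toℕ m)) (λ g →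
      ∑ (choices k (λ i → allFin (suc (κ (suc i))))) (λ μ →
        ∑ (tableauxOf n (shape μ)) (λ T → G (extend (κ zero) m g ∷ᵈ extendAll μ T)))))
      ≈⟨ ∑-cong (allFin (suc (κ zero))) (λ m → ∑-swap (rowsOf n (toℕ m)) (choices k _) _) ⟩
    ∑ (allFin (suc (κ zero))) (λ m → ∑ (choices k (λ i → allFin (suc (κ (suc i))))) (λ μ →
      ∑ (rowsOf n (toℕ m)) (λ g →
        ∑ (tableauxOf n (shape μ)) (λ T → G (extend (κ zero) m g ∷ᵈ extendAll μ T)))))
      ≈⟨ ∑-cong (allFin (suc (κ zero))) (λ m → ∑-cong (choices k _) (λ μ → trans
           (∑-cong (rowsOf n (toℕ m)) (λ g → ∑-cong (tableauxOf n (shape μ)) (λ T →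
             ext _ (extendAll (m ∷ᵈ μ) (g ∷ᵈ T)) (λ { zero j → ≡.refl ; (suc i) j → ≡.refl }))))
           (sym (∑-choices-suc (λ i → rowsOf n (shape (m ∷ᵈ μ) i)) (ext⇒Extensional (body-ext (m ∷ᵈ μ))))))) ⟩
    ∑ (allFin (suc (κ zero))) (λ m → ∑ (choices k (λ i → allFin (suc (κ (suc i))))) (λ μ → body-sum (m ∷ᵈ μ)))
      ≈⟨ ∑-choices-suc (λ i → allFin (suc (κ i))) body-sum-ext ⟨
    ∑ (choices (suc k) (λ i → allFin (suc (κ i)))) body-sum ∎
    where
    body-ext : ∀ μ → TableauExt (λ T → G (extendAll μ T))
    body-ext μ T T′ e = ext _ _ (λ i → extend-cong (κ i) (μ i) (e i))
    body-sum : Subshape κ → Carrier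
    body-sum μ = ∑ (tableauxOf n (shape μ)) (λ T → G (extendAll μ T))
    body-sum-ext : Extensional body-sum
    body-sum-ext μ ν e = ∑-tableaux-cong (λ i → cong toℕ (e i)) (body-ext μ) (body-ext ν)
      (λ T T′ T~T′ → ext _ _ (λ i j → similar (κ i) (e i) (T i) (T′ i) (T~T′ i) j))
      where
      similar : ∀ ℓ {m m′} → m ≡ m′ → ∀ (f : Fin (toℕ m) → Fin n) (f′ : Fin (toℕ m′) → Fin n) →
        (∀ j j′ → toℕ j ≡ toℕ j′ → f j ≡ f′ j′) → ∀ j → extend ℓ m f j ≡ extend ℓ m′ f′ j
      similar ℓ {m} ≡.refl f f′ h = extend-cong ℓ m (λ j → h j j ≡.refl)

-- Schur sums and the branching rule

module Bialternant {a ℓ} (S : CommutativeRing a ℓ) where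

  open Sums S
  open Exterior S using (Vect)
  open Tableaux S

  weight : ∀ {k n} {κ : Shape k} → Vect n → Tableau n κ → Carrier
  weight x T = product λ i → product λ j → x (T i j)

  term : ∀ {k n} (κ : Shape k) → Vect n → Tableau n κ → Carrier
  term κ x T = when (isSemistandard? κ T) (weight x T)

  schurSum : ∀ {k n} → Shape k → Vect n → Carrier
  schurSum {n = n} κ x = ∑ (tableauxOf n κ) (term κ x)

  schur≈schurSum : ∀ {N} (lam : Partition N) x →
    schur (Semiring.rawSemiring (CommutativeRing.semiring S)) lam x ≈ schurSum (part lam) x
  schur≈schurSum lam x = trans (reflexive (foldr-map _ (tableaux lam)))
    (∑-filter (semistandard? lam) (fillings lam) _)
    where
    foldr-map : ∀ {b} {A : Set b} (f : A → Carrier) xs → List.foldr _+_ 0# (List.map f xs) ≡ ∑ xs f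
    foldr-map f []       = ≡.refl
    foldr-map f (y ∷ ys) = cong (f y +_) (foldr-map f ys)

  private
    similar-semistandard : ∀ {k n} {κ κ′ : Shape k} {T : Tableau n κ} {T′ : Tableau n κ′} →
      (∀ i → κ i ≡ κ′ i) → Similar T T′ → IsSemistandard κ T → IsSemistandard κ′ T′
    similar-semistandard {κ = κ} {κ′} {T} {T′} e T~T′ (rows , cols) =
      (λ i j j′ le → subst₂ Fin._≤_ (back i j) (back i j′)
        (rows i _ _ (subst₂ ℕ._≤_ (≡.sym (Fin.toℕ-cast (≡.sym (e i)) j)) (≡.sym (Fin.toℕ-cast (≡.sym (e i)) j′)) le))) ,
      (λ i i′ lt j j′ eq → subst₂ Fin._<_ (back i j) (back i′ j′) (cols i i′ lt _ _
        (≡.trans (Fin.toℕ-cast (≡.sym (e i)) j) (≡.trans eq (≡.sym (Fin.toℕ-cast (≡.sym (e i′)) j′))))))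
      where
      back : ∀ i j → T i (Fin.cast (≡.sym (e i)) j) ≡ T′ i j
      back i j = T~T′ i _ j (Fin.toℕ-cast (≡.sym (e i)) j)

    similar-weight : ∀ {k n} {κ κ′ : Shape k} {T : Tableau n κ} {T′ : Tableau n κ′} (x : Vect n) →
      (∀ i → κ i ≡ κ′ i) → Similar T T′ → weight {κ = κ} x T ≈ weight {κ = κ′} x T′
    similar-weight x e T~T′ = product-cong (λ i → row (e i) (T~T′ i))
      where
      row : ∀ {m m′} → m ≡ m′ → {f : Fin m → Fin _} {f′ : Fin m′ → Fin _} →
        (∀ j j′ → toℕ j ≡ toℕ j′ → f j ≡ f′ j′) →
        product (λ j → x (f j)) ≈ product (λ j → x (f′ j))
      row ≡.refl h = product-cong (λ j → reflexive (cong x (h j j ≡.refl)))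

    similar-sym : ∀ {k n} {κ κ′ : Shape k} {T : Tableau n κ} {T′ : Tableau n κ′} →
                  Similar T T′ → Similar T′ T
    similar-sym h i j j′ e = ≡.sym (h i j′ j (≡.sym e))

    pointwise-similar : ∀ {k n} {κ : Shape k} {T T′ : Tableau n κ} →
                        (∀ i j → T i j ≡ T′ i j) → Similar T T′
    pointwise-similar {T = T} h i j j′ e = ≡.trans (cong (T i) (Fin.toℕ-injective e)) (h i j′)

    similar-term : ∀ {k n} {κ κ′ : Shape k} {T : Tableau n κ} {T′ : Tableau n κ′} (x : Vect n) →
      (∀ i → κ i ≡ κ′ i) → Similar T T′ → term κ x T ≈ term κ′ x T′
    similar-term {κ = κ} {κ′} {T} {T′} x e T~T′ = when-⇔ (isSemistandard? κ T) (isSemistandard? κ′ T′)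
      (similar-semistandard e T~T′) (similar-semistandard (≡.sym ∘ e) (similar-sym {T = T} {T′} T~T′))
      (similar-weight x e T~T′)

    term-ext : ∀ {k n} (κ : Shape k) (x : Vect n) → TableauExt (term κ x)
    term-ext κ x T T′ e = similar-term x (λ _ → ≡.refl) (pointwise-similar {T = T} {T′} e)

  schurSum-cong : ∀ {k n} {κ κ′ : Shape k} (x : Vect n) → (∀ i → κ i ≡ κ′ i) →
                  schurSum κ x ≈ schurSum κ′ x
  schurSum-cong {κ = κ} {κ′} x e = ∑-tableaux-cong e (term-ext κ x) (term-ext κ′ x)
    (λ T T′ → similar-term x e)

  schurSum-congʳ : ∀ {k n} (κ : Shape k) {x y : Vect n} → (∀ i → x i ≈ y i) → schurSum κ x ≈ schurSum κ y
  schurSum-congʳ {n = n} κ e = ∑-cong (tableauxOf n κ) (λ T → when-cong (isSemistandard? κ T)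
    (λ _ → product-cong (λ i → product-cong (λ j → e (T i j)))))

  schurSum-empty : ∀ {k n} (x : Vect n) → schurSum {k} (λ _ → 0) x ≈ 1#
  schurSum-empty {k} {n} x = trans (single k (term-ext (λ _ → 0) x))
    (trans (when-true (isSemistandard? (λ _ → 0) (void k)) ((λ i ()) , λ i i′ lt ()))
      (product-one {k} (λ _ → refl)))
    where
    void : ∀ k → Tableau {k} n (λ _ → 0)
    void k i ()
    single : ∀ k {G : Tableau {k} n (λ _ → 0) → Carrier} → TableauExt G →
             ∑ (tableauxOf n (λ _ → 0)) G ≈ G (void k)
    single zero    ext = trans (+-identityʳ _) (ext _ _ (λ ()))
    single (suc k) ext = trans (∑-choices-suc {n = k} (λ _ → rowsOf n 0) (ext⇒Extensional {κ = λ _ → 0} ext))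
      (trans (+-identityʳ _) (trans (single k (∷ᵈ-ext₁ {κ = λ _ → 0} ext _)) (ext _ _ (λ i ()))))

  -- The first column would need n + 1 distinct letters out of n.
  schurSum-too-tall : ∀ {n} (κ : Shape (suc n)) (x : Vect n) → (∀ i → 0 ℕ.< κ i) → schurSum κ x ≈ 0#
  schurSum-too-tall {n} κ x pos = ∑-zero (tableauxOf n κ) (λ T → when-false (isSemistandard? κ T) (λ (_ , cols) →
    let first = λ i → Fin.fromℕ< (pos i)
        i , j , lt , e = Fin.pigeonhole (ℕ.n<1+n n) (λ i → T i (first i))
    in Fin.<-irrefl e (cols i j lt (first i) (first j)
         (≡.trans (Fin.toℕ-fromℕ< (pos i)) (≡.sym (Fin.toℕ-fromℕ< (pos j)))))))

  schurSum-drop-row : ∀ {k n} (κ : Shape (suc k)) (x : Vect n) → κ (fromℕ k) ≡ 0 →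
                      schurSum κ x ≈ schurSum (κ ∘ inject₁) x
  schurSum-drop-row {k} {n} κ x e = trans
    (∑-choices-last k (λ i → rowsOf n (κ i)) (ext⇒Extensional (term-ext κ x)))
    (∑-cong (tableauxOf n (κ ∘ inject₁)) (λ T → trans
      (∑-rows-empty e (λ f g h → term-ext κ x _ _ (snoc-cong T f g h)) no-cells)
      (when-⇔ (isSemistandard? κ (extended T)) (isSemistandard? (κ ∘ inject₁) T)
        (drop T) (add T) (trans (product-last k (λ i → product (λ j → x (extended T i j))))
          (trans (*-cong (product-cong (λ i → reflexive (row-product T i))) (empty-product e (λ j → x (extended T (fromℕ k) j))))
            (*-identityʳ _))))))
    where
    no-cells : Fin (κ (fromℕ k)) → Fin n
    no-cells j = contradiction (subst Fin e j) Fin.¬Fin0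
    extended : Tableau n (κ ∘ inject₁) → Tableau n κ
    extended T = snocᵈ T no-cells
    row-product : ∀ (T : Tableau n (κ ∘ inject₁)) i →
      product (λ j → x (extended T (inject₁ i) j)) ≡ product (λ j → x (T i j))
    row-product T i = cong (λ (f : Fin (κ (inject₁ i)) → Fin n) → product (λ j → x (f j)))
      (snocᵈ-inject₁ T no-cells i)
    empty-product : ∀ {m} → m ≡ 0 → (f : Fin m → Carrier) → product f ≈ 1#
    empty-product ≡.refl f = refl
    ∑-rows-empty : ∀ {m} → m ≡ 0 → {G : (Fin m → Fin n) → Carrier} →
      (∀ f g → (∀ j → f j ≡ g j) → G f ≈ G g) → ∀ f → ∑ (rowsOf n m) G ≈ G f
    ∑-rows-empty ≡.refl ext f = trans (+-identityʳ _) (ext _ f (λ ()))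
    snoc-cong : ∀ T (f g : Fin (κ (fromℕ k)) → Fin n) → (∀ j → f j ≡ g j) →
                ∀ i j → snocᵈ {A = λ i → Fin (κ i) → Fin n} T f i j ≡ snocᵈ {A = λ i → Fin (κ i) → Fin n} T g i j
    snoc-cong T f g h i j with view i
    ... | ‵fromℕ      = contradiction (subst Fin e j) Fin.¬Fin0
    ... | ‵inject₁ i′ = cong-app (≡.trans (snocᵈ-inject₁ T f i′) (≡.sym (snocᵈ-inject₁ T g i′))) j
    drop : ∀ T → IsSemistandard κ (extended T) → IsSemistandard (κ ∘ inject₁) T
    drop T (rows , cols) =
      (λ i → subst Monotone (snocᵈ-inject₁ T no-cells i) (rows (inject₁ i))) ,
      (λ i i′ lt j j′ eq → subst₂ Fin._<_ (cong-app (snocᵈ-inject₁ T no-cells i) j)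
        (cong-app (snocᵈ-inject₁ T no-cells i′) j′) (cols (inject₁ i) (inject₁ i′)
          (subst₂ ℕ._<_ (≡.sym (Fin.toℕ-inject₁ i)) (≡.sym (Fin.toℕ-inject₁ i′)) lt) j j′ eq))
    add : ∀ T → IsSemistandard (κ ∘ inject₁) T → IsSemistandard κ (extended T)
    add T (rows , cols) = rows′ , cols′
      where
      rows′ : ∀ i → Monotone (extended T i)
      rows′ i with view i
      ... | ‵fromℕ      = λ j → contradiction (subst Fin e j) Fin.¬Fin0
      ... | ‵inject₁ i′ = subst Monotone (≡.sym (snocᵈ-inject₁ T no-cells i′)) (rows i′)
      cols′ : ColumnStrict κ (extended T)
      cols′ i i′ lt j j′ eq with view i | view i′
      ... | ‵fromℕ     | _          = contradiction (subst Fin e j) Fin.¬Fin0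
      ... | ‵inject₁ l | ‵fromℕ     = contradiction (subst Fin e j′) Fin.¬Fin0
      ... | ‵inject₁ l | ‵inject₁ m = subst₂ Fin._<_ (≡.sym (cong-app (snocᵈ-inject₁ T no-cells l) j))
        (≡.sym (cong-app (snocᵈ-inject₁ T no-cells m) j′))
        (cols l m (subst₂ ℕ._<_ (Fin.toℕ-inject₁ l) (Fin.toℕ-inject₁ m) lt) j j′ eq)

  weight-extend : ∀ {n} ℓ m (g : Fin (toℕ m) → Fin n) (x : Vect (suc n)) →
    product (λ j → x (extend ℓ m g j))
      ≈ x (fromℕ n) ^ (ℓ ℕ.∸ toℕ m) * product (λ j → x (inject₁ (g j)))
  weight-extend zero    zero g x = sym (*-identityʳ 1#)
  weight-extend {n} (suc ℓ) zero g x = trans (power (suc ℓ)) (sym (*-identityʳ _))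
    where
    power : ∀ m → product {m} (λ j → x (fromℕ n)) ≈ x (fromℕ n) ^ m
    power zero    = refl
    power (suc m) = *-congˡ (power m)
  weight-extend (suc ℓ) (suc m) g x = trans (*-congˡ (weight-extend ℓ m (g ∘ suc) x)) (*-swapˡ _ _ _)

  branching : ∀ {k n} (κ : Shape k) (x : Vect (suc n)) → Decreasing κ →
    schurSum κ x ≈ ∑ (choices k (λ i → allFin (suc (κ i)))) (λ μ →
      when (horizontalStrip? κ μ)
        (product (λ i → x (fromℕ n) ^ (κ i ℕ.∸ toℕ (μ i))) * schurSum (shape μ) (x ∘ inject₁)))
  branching {k} {n} κ x κ↓ = trans
    (∑-tableaux-extend κ (term κ x) (term-ext κ x)
      (λ T ¬mono → when-false (isSemistandard? κ T) (λ (rows , _) → ¬mono rows)))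
    (∑-cong (choices k (λ i → allFin (suc (κ i)))) (λ μ → begin
      ∑ (tableauxOf n (shape μ)) (λ T → term κ x (extendAll μ T))
        ≈⟨ ∑-cong (tableauxOf n (shape μ)) (step μ) ⟩
      ∑ (tableauxOf n (shape μ)) (λ T → when (horizontalStrip? κ μ) (u μ * term (shape μ) (x ∘ inject₁) T))
        ≈⟨ when-∑ (horizontalStrip? κ μ) (tableauxOf n (shape μ)) _ ⟨
      when (horizontalStrip? κ μ) (∑ (tableauxOf n (shape μ)) (λ T → u μ * term (shape μ) (x ∘ inject₁) T))
        ≈⟨ when-cong (horizontalStrip? κ μ) (λ _ → sym (*-distribˡ-∑ (u μ) (tableauxOf n (shape μ)) _)) ⟩
      when (horizontalStrip? κ μ) (u μ * schurSum (shape μ) (x ∘ inject₁)) ∎))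
    where
    u : Subshape κ → Carrier
    u μ = product (λ i → x (fromℕ n) ^ (κ i ℕ.∸ toℕ (μ i)))
    step : ∀ μ T → term κ x (extendAll μ T) ≈
      when (horizontalStrip? κ μ) (u μ * term (shape μ) (x ∘ inject₁) T)
    step μ T = begin
      when (isSemistandard? κ (extendAll μ T)) (weight x (extendAll μ T))
        ≈⟨ when-⇔ (isSemistandard? κ (extendAll μ T)) (horizontalStrip? κ μ ×-dec isSemistandard? (shape μ) T)
             (extend-semistandard⁻ κ↓ μ T) (λ (h , ss) → extend-semistandard⁺ κ↓ μ T h ss)
             (trans (product-cong (λ i → weight-extend (κ i) (μ i) (T i) x)) (product-* {k} _ _)) ⟩
      when (horizontalStrip? κ μ ×-dec isSemistandard? (shape μ) T) (u μ * weight (x ∘ inject₁) T)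
        ≈⟨ when-× (horizontalStrip? κ μ) (isSemistandard? (shape μ) T) ⟨
      when (horizontalStrip? κ μ) (when (isSemistandard? (shape μ) T) (u μ * weight (x ∘ inject₁) T))
        ≈⟨ when-cong (horizontalStrip? κ μ) (λ _ → sym (*-when (isSemistandard? (shape μ) T) _ _)) ⟩
      when (horizontalStrip? κ μ) (u μ * term (shape μ) (x ∘ inject₁) T) ∎

-- Alternants, Vandermonde products and the bialternant formula

module Alternants {a ℓ} (S : CommutativeRing a ℓ) where

  open Sums S
  open Exterior S
  open Bialternant S using (schurSum; schurSum-cong; schurSum-too-tall; schurSum-drop-row; branching)

  alternant : ∀ n → Shape n → Vect n → Carrier
  alternant n κ x = det n (λ j i → x i ^ (κ j ℕ.+ (n ℕ.∸ suc (toℕ j))))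

  vandermonde : ∀ n → Vect n → Carrier
  vandermonde zero    x = 1#
  vandermonde (suc n) x = product (λ i → x (fromℕ n) - x (inject₁ i)) * vandermonde n (x ∘ inject₁)

  -- For p at least a the summand is u^(b-p) x^(p+e) - u^(b-p-1) x^(p+1+e). With a the next part and
  -- b the current part plus one, p runs through the values that interlace between the two parts.
  telescope : ∀ u x e a b → a ℕ.≤ b →
    ∑ (allFin b) (λ p → when (a ℕ.≤? toℕ p) (u ^ (b ℕ.∸ suc (toℕ p))) * ((u - x) * x ^ (toℕ p ℕ.+ e)))
      ≈ u ^ (b ℕ.∸ a) * x ^ (a ℕ.+ e) - x ^ (b ℕ.+ e)
  telescope u x e a b le with ℕ.m≤n⇒m<n∨m≡n le
  telescope u x e a .a le | inj₂ ≡.refl = begin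
    ∑ (allFin a) _ ≈⟨ ∑-zero (allFin a) (λ p → trans
      (*-congʳ (when-false (a ℕ.≤? toℕ p) (ℕ.<⇒≱ (Fin.toℕ<n p)))) (zeroˡ _)) ⟩
    0# ≈⟨ -‿inverseʳ _ ⟨
    x ^ (a ℕ.+ e) - x ^ (a ℕ.+ e) ≈⟨ +-congʳ (*-identityˡ _) ⟨
    u ^ 0 * x ^ (a ℕ.+ e) - x ^ (a ℕ.+ e)
      ≡⟨ cong (λ z → u ^ z * x ^ (a ℕ.+ e) - x ^ (a ℕ.+ e)) (ℕ.n∸n≡0 a) ⟨
    u ^ (a ℕ.∸ a) * x ^ (a ℕ.+ e) - x ^ (a ℕ.+ e) ∎
  telescope u x e a (suc b) le | inj₁ (ℕ.s≤s a≤b) = begin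
    ∑ (allFin (suc b)) f ≈⟨ ∑-allFin-last b f ⟩
    ∑ (allFin b) (f ∘ inject₁) + f (fromℕ b)
      ≈⟨ +-cong (trans (∑-cong (allFin b) inner) (sym (*-distribˡ-∑ u (allFin b) _))) last ⟩
    u * ∑ (allFin b) g + (u - x) * X ≈⟨ +-congʳ (*-congˡ (telescope u x e a b a≤b)) ⟩
    u * (u ^ (b ℕ.∸ a) * A - X) + (u - x) * X
      ≈⟨ +-cong (distribˡ u _ _) (distribʳ X u (- x)) ⟩
    (u * (u ^ (b ℕ.∸ a) * A) + u * - X) + (u * X + - x * X)
      ≈⟨ +-cong (+-cong (sym (*-assoc _ _ _)) (sym (-‿distribʳ-* u X))) (+-congˡ (sym (-‿distribˡ-* x X))) ⟩
    (u ^ suc (b ℕ.∸ a) * A - u * X) + (u * X - x * X) ≈⟨ +-assoc _ _ _ ⟩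
    u ^ suc (b ℕ.∸ a) * A + (- (u * X) + (u * X - x * X))
      ≈⟨ +-congˡ (trans (sym (+-assoc _ _ _)) (trans (+-congʳ (-‿inverseˡ _)) (+-identityˡ _))) ⟩
    u ^ suc (b ℕ.∸ a) * A - x * X
      ≡⟨ cong (λ z → u ^ z * A - x * X) (ℕ.+-∸-assoc 1 a≤b) ⟨
    u ^ (suc b ℕ.∸ a) * A - x ^ (suc b ℕ.+ e) ∎
    where
    A = x ^ (a ℕ.+ e)
    X = x ^ (b ℕ.+ e)
    f : Fin (suc b) → Carrier
    f p = when (a ℕ.≤? toℕ p) (u ^ (b ℕ.∸ toℕ p)) * ((u - x) * x ^ (toℕ p ℕ.+ e))
    g : Fin b → Carrier
    g p = when (a ℕ.≤? toℕ p) (u ^ (b ℕ.∸ suc (toℕ p))) * ((u - x) * x ^ (toℕ p ℕ.+ e))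
    inner : ∀ p → f (inject₁ p) ≈ u * g p
    inner p rewrite Fin.toℕ-inject₁ p = begin
      when (a ℕ.≤? toℕ p) (u ^ (b ℕ.∸ toℕ p)) * R
        ≡⟨ cong (λ z → when (a ℕ.≤? toℕ p) (u ^ z) * R) (ℕ.+-∸-assoc 1 (Fin.toℕ<n p)) ⟩
      when (a ℕ.≤? toℕ p) (u * u ^ (b ℕ.∸ suc (toℕ p))) * R
        ≈⟨ *-congʳ (*-when (a ℕ.≤? toℕ p) u _) ⟨
      (u * when (a ℕ.≤? toℕ p) (u ^ (b ℕ.∸ suc (toℕ p)))) * R ≈⟨ *-assoc _ _ _ ⟩
      u * (when (a ℕ.≤? toℕ p) (u ^ (b ℕ.∸ suc (toℕ p))) * R) ∎
      where R = (u - x) * x ^ (toℕ p ℕ.+ e)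
    last : f (fromℕ b) ≈ (u - x) * X
    last rewrite Fin.toℕ-fromℕ b | ℕ.n∸n≡0 b = trans (*-congʳ (when-true (a ℕ.≤? b) a≤b)) (*-identityˡ _)

  -- The other bound, `ν i` at most `κ (inject₁ i)`, is contained in the type `Subshape`.
  Interlaces : ∀ {n} (κ : Shape (suc n)) → Subshape (κ ∘ inject₁) → Set
  Interlaces κ ν = ∀ i → κ (suc i) ℕ.≤ toℕ (ν i)

  interlaces? : ∀ {n} (κ : Shape (suc n)) ν → Dec (Interlaces κ ν)
  interlaces? κ ν = Fin.all? (λ i → κ (suc i) ℕ.≤? toℕ (ν i))

  interlaces-decreasing : ∀ {n} {κ : Shape (suc n)} {ν} → Decreasing κ → Interlaces κ ν → Decreasing (shape ν)
  interlaces-decreasing {ν = ν} κ↓ h i j i≤j with Fin._≟_ i j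
  ... | yes ≡.refl = ℕ.≤-refl
  ... | no  i≢j    = ℕ.≤-trans (Fin.toℕ≤pred[n] (ν j)) (ℕ.≤-trans
    (κ↓ (suc i) (inject₁ j) (subst (suc (toℕ i) ℕ.≤_) (≡.sym (Fin.toℕ-inject₁ j)) (Fin.≤∧≢⇒< i≤j i≢j))) (h i))

  module _ {n} (κ : Shape (suc n)) (κ↓ : Decreasing κ) (x : Vect (suc n)) where

    private
      u = x (fromℕ n)
      x′ = x ∘ inject₁
      νs = choices n (λ i → allFin (suc (κ (inject₁ i))))
      drops : Subshape (κ ∘ inject₁) → Carrier
      drops ν = product (λ i → u ^ (κ (inject₁ i) ℕ.∸ toℕ (ν i)))

    -- If the last row of μ is nonempty, so are all n + 1 rows, too many for n letters. Hence the
    -- last row of κ is filled with the largest letter, which gives `u ^ κ (fromℕ n)`, and what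
    -- remains has n rows and n letters.
    schurSum-step : schurSum κ x ≈ ∑ νs (λ ν →
      when (interlaces? κ ν) ((drops ν * u ^ κ (fromℕ n)) * schurSum (shape ν) x′))
    schurSum-step = begin
      schurSum κ x ≈⟨ branching κ x κ↓ ⟩
      ∑ (choices (suc n) (λ i → allFin (suc (κ i)))) B ≈⟨ ∑-choices-last n (λ i → allFin (suc (κ i))) B-ext ⟩
      ∑ νs (λ ν → ∑ (allFin (suc (κ (fromℕ n)))) (λ m → B (snocᵈ ν m)))
        ≈⟨ ∑-cong νs (λ ν → trans (+-cong (zero-part ν)
             (trans (∑-tabulate (κ (fromℕ n)) suc (λ m → B (snocᵈ ν m)))
               (∑-zero (allFin (κ (fromℕ n))) (suc-part ν)))) (+-identityʳ _)) ⟩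
      ∑ νs (λ ν → when (interlaces? κ ν) ((drops ν * u ^ κ (fromℕ n)) * schurSum (shape ν) x′)) ∎
      where
      B : Subshape κ → Carrier
      B μ = when (horizontalStrip? κ μ)
        (product (λ i → u ^ (κ i ℕ.∸ toℕ (μ i))) * schurSum (shape μ) x′)
      B-ext : Extensional B
      B-ext μ μ′ e = when-⇔ (horizontalStrip? κ μ) (horizontalStrip? κ μ′)
        (λ h i i′ lt → subst (λ m → κ i′ ℕ.≤ toℕ m) (e i) (h i i′ lt))
        (λ h i i′ lt → subst (λ m → κ i′ ℕ.≤ toℕ m) (≡.sym (e i)) (h i i′ lt))
        (*-cong (product-cong (λ i → reflexive (cong (λ m → u ^ (κ i ℕ.∸ toℕ m)) (e i))))
          (schurSum-cong x′ (λ i → cong toℕ (e i))))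
      snoc : Subshape (κ ∘ inject₁) → Fin (suc (κ (fromℕ n))) → Subshape κ
      snoc ν m = snocᵈ ν m
      at-last : ∀ ν m → snoc ν m (fromℕ n) ≡ m
      at-last ν m = snocᵈ-fromℕ {A = λ i → Fin (suc (κ i))} ν m
      at-body : ∀ ν m i → snoc ν m (inject₁ i) ≡ ν i
      at-body ν m i = snocᵈ-inject₁ {A = λ i → Fin (suc (κ i))} ν m i
      suc-part : ∀ ν m → B (snoc ν (suc m)) ≈ 0#
      suc-part ν m = when-zero (horizontalStrip? κ μ) (λ h → trans
        (*-congˡ (schurSum-too-tall (shape μ) x′ (λ i → ℕ.<-≤-trans
          (subst (λ z → 0 ℕ.< toℕ z) (≡.sym (at-last ν (suc m))) ℕ.z<s)
          (strip-decreasing μ h i (fromℕ n) (Fin.≤fromℕ i))))) (zeroʳ _))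
        where μ = snoc ν (suc m)
      zero-part : ∀ ν → B (snoc ν zero) ≈
        when (interlaces? κ ν) ((drops ν * u ^ κ (fromℕ n)) * schurSum (shape ν) x′)
      zero-part ν = when-⇔ (horizontalStrip? κ μ) (interlaces? κ ν) to from
        (*-cong (trans (product-last n (λ i → u ^ (κ i ℕ.∸ toℕ (μ i)))) (*-cong
            (product-cong (λ i → reflexive (cong (λ z → u ^ (κ (inject₁ i) ℕ.∸ toℕ z)) (at-body ν zero i))))
            (reflexive (cong (λ z → u ^ (κ (fromℕ n) ℕ.∸ toℕ z)) (at-last ν zero)))))
          (trans (schurSum-drop-row (shape μ) x′ (cong toℕ (at-last ν zero)))
            (schurSum-cong x′ (λ i → cong toℕ (at-body ν zero i)))))
        where
        μ = snoc ν zero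
        to : HorizontalStrip κ μ → Interlaces κ ν
        to h i = subst (λ z → κ (suc i) ℕ.≤ toℕ z) (at-body ν zero i)
          (h (inject₁ i) (suc i) (ℕ.s≤s (ℕ.≤-reflexive (Fin.toℕ-inject₁ i))))
        from : Interlaces κ ν → HorizontalStrip κ μ
        from h i i′ lt with view i
        ... | ‵fromℕ     = contradiction (ℕ.<-≤-trans lt (Fin.≤fromℕ i′)) (ℕ.<-irrefl ≡.refl)
        ... | ‵inject₁ l = subst (λ z → κ i′ ℕ.≤ toℕ z) (≡.sym (at-body ν zero l))
          (ℕ.≤-trans (κ↓ (suc l) i′ (subst (ℕ._< toℕ i′) (Fin.toℕ-inject₁ l) lt)) (h l))

    -- After the column operation the row of u has its only entry in the last column. Each remaining
    -- row i has the factor u - x i in every summand, and `det-scale` takes these factors out.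
    alternant-step : alternant (suc n) κ x ≈ u ^ κ (fromℕ n) * ∑ νs (λ ν →
      when (interlaces? κ ν) (drops ν) * (product (λ i → u - x (inject₁ i)) * alternant n (shape ν) x′))
    alternant-step = begin
      det (suc n) c ≈⟨ wedges-column-op n c d (λ j → - (u ^ δ j))
        (λ j i → reflexive (cong-app (at-body j) i)) (λ i → reflexive (cong-app at-last i)) unit full ⟨
      det (suc n) d ≈⟨ det-expand n d head-zero ⟩
      d (fromℕ n) (fromℕ n) * det n (λ j i → - d (inject₁ j) (inject₁ i))
        ≈⟨ *-cong (reflexive head-last) (wedges-cong n tail-column (λ _ → refl) full) ⟩
      u ^ κ (fromℕ n) * det n (λ j i → ∑ (allFin (suc (κ (inject₁ j)))) (λ p → m j p * v j p i))
        ≈⟨ *-congˡ (wedges-multilinear n (λ j → allFin (suc (κ (inject₁ j)))) m v unit full) ⟩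
      u ^ κ (fromℕ n) * ∑ νs (λ ν → product (λ j → m j (ν j)) * det n (λ j → v j (ν j)))
        ≈⟨ *-congˡ (∑-cong νs (λ ν → *-cong
             (product-when (λ i → κ (suc i) ℕ.≤? toℕ (ν i)) _) (det-scale n (λ i → u - x (inject₁ i)) _))) ⟩
      u ^ κ (fromℕ n) * ∑ νs (λ ν →
        when (interlaces? κ ν) (drops ν) * (product (λ i → u - x (inject₁ i)) * alternant n (shape ν) x′)) ∎
      where
      c : Fin (suc n) → Vect (suc n)
      c j i = x i ^ (κ j ℕ.+ (n ℕ.∸ toℕ j))
      -- The difference of the exponents of columns j and j + 1, so that column j of `d` vanishes in
      -- the row of u.
      δ : Fin n → ℕ
      δ j = suc (κ (inject₁ j)) ℕ.∸ κ (suc j)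
      d : Fin (suc n) → Vect (suc n)
      d = snocᵈ (λ j i → c (inject₁ j) i + - (u ^ δ j) * c (suc j) i) (c (fromℕ n))
      at-body : ∀ j → d (inject₁ j) ≡ (λ i → c (inject₁ j) i + - (u ^ δ j) * c (suc j) i)
      at-body j = snocᵈ-inject₁ {A = λ _ → Vect (suc n)} _ _ j
      at-last : d (fromℕ n) ≡ c (fromℕ n)
      at-last = snocᵈ-fromℕ {n = n} {A = λ _ → Vect (suc n)} _ _
      e : Fin n → ℕ
      e j = n ℕ.∸ suc (toℕ j)
      -- Choosing p in every column chooses ν, and the conditions on p together say that ν
      -- interlaces κ; `product-when` merges them.
      m : ∀ j → Fin (suc (κ (inject₁ j))) → Carrier
      m j p = when (κ (suc j) ℕ.≤? toℕ p) (u ^ (κ (inject₁ j) ℕ.∸ toℕ p))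
      v : ∀ j → Fin (suc (κ (inject₁ j))) → Vect n
      v j p i = (u - x (inject₁ i)) * x (inject₁ i) ^ (toℕ p ℕ.+ e j)
      exponent : ∀ j → κ (inject₁ j) ℕ.+ (n ℕ.∸ toℕ (inject₁ j)) ≡ suc (κ (inject₁ j)) ℕ.+ e j
      exponent j rewrite Fin.toℕ-inject₁ j = ≡.trans
        (cong (κ (inject₁ j) ℕ.+_) (ℕ.+-∸-assoc 1 (Fin.toℕ<n j))) (ℕ.+-suc _ _)
      κ-step : ∀ j → κ (suc j) ℕ.≤ suc (κ (inject₁ j))
      κ-step j = ℕ.m≤n⇒m≤1+n (κ↓ (inject₁ j) (suc j) (ℕ.≤-trans (ℕ.≤-reflexive (Fin.toℕ-inject₁ j)) (ℕ.n≤1+n _)))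
      negated : ∀ j i → - d (inject₁ j) i ≈
        u ^ δ j * x i ^ (κ (suc j) ℕ.+ e j) - x i ^ (suc (κ (inject₁ j)) ℕ.+ e j)
      negated j i = begin
        - d (inject₁ j) i ≡⟨ cong (λ f → - f i) (at-body j) ⟩
        - (c (inject₁ j) i + - (u ^ δ j) * c (suc j) i) ≈⟨ -‿+-comm _ _ ⟨
        - c (inject₁ j) i + - (- (u ^ δ j) * c (suc j) i)
          ≈⟨ +-congˡ (trans (-‿cong (sym (-‿distribˡ-* _ _))) (-‿involutive _)) ⟩
        - c (inject₁ j) i + u ^ δ j * c (suc j) i ≈⟨ +-comm _ _ ⟩
        u ^ δ j * c (suc j) i - c (inject₁ j) i ≡⟨ cong (λ z → u ^ δ j * c (suc j) i - x i ^ z) (exponent j) ⟩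
        u ^ δ j * x i ^ (κ (suc j) ℕ.+ e j) - x i ^ (suc (κ (inject₁ j)) ℕ.+ e j) ∎
      head-zero : ∀ j → d (inject₁ j) (fromℕ n) ≈ 0#
      head-zero j = begin
        d (inject₁ j) (fromℕ n) ≈⟨ -‿involutive _ ⟨
        - - d (inject₁ j) (fromℕ n) ≈⟨ -‿cong (negated j (fromℕ n)) ⟩
        - (u ^ δ j * u ^ (κ (suc j) ℕ.+ e j) - u ^ (suc (κ (inject₁ j)) ℕ.+ e j))
          ≈⟨ -‿cong (+-congʳ (^-+ u (δ j) _)) ⟨
        - (u ^ (δ j ℕ.+ (κ (suc j) ℕ.+ e j)) - u ^ (suc (κ (inject₁ j)) ℕ.+ e j))
          ≡⟨ cong (λ z → - (u ^ z - u ^ (suc (κ (inject₁ j)) ℕ.+ e j))) (≡.trans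
               (≡.sym (ℕ.+-assoc (δ j) _ _)) (cong (ℕ._+ e j) (ℕ.m∸n+n≡m (κ-step j)))) ⟩
        - (u ^ (suc (κ (inject₁ j)) ℕ.+ e j) - u ^ (suc (κ (inject₁ j)) ℕ.+ e j))
          ≈⟨ -‿cong (-‿inverseʳ _) ⟩
        - 0# ≈⟨ -0#≈0# ⟩
        0# ∎
      head-last : d (fromℕ n) (fromℕ n) ≡ u ^ κ (fromℕ n)
      head-last = ≡.trans (cong-app at-last (fromℕ n)) (cong (u ^_) (≡.trans
        (cong (λ z → κ (fromℕ n) ℕ.+ (n ℕ.∸ z)) (Fin.toℕ-fromℕ n))
        (≡.trans (cong (κ (fromℕ n) ℕ.+_) (ℕ.n∸n≡0 n)) (ℕ.+-identityʳ _))))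
      tail-column : ∀ j i → - d (inject₁ j) (inject₁ i) ≈ ∑ (allFin (suc (κ (inject₁ j)))) (λ p → m j p * v j p i)
      tail-column j i = trans (negated j (inject₁ i))
        (sym (telescope u (x (inject₁ i)) (e j) (κ (suc j)) (suc (κ (inject₁ j))) (κ-step j)))

  -- `schurSum-step` and `alternant-step` run over the same ν with the same powers of u, and differ
  -- by the factor D that passes into the Vandermonde product. The orientation of `det` keeps signs
  -- out.
  bialternant : ∀ n (κ : Shape n) x → Decreasing κ → schurSum κ x * vandermonde n x ≈ alternant n κ x
  bialternant zero    κ x κ↓ = trans (*-identityʳ _) (trans (+-identityʳ _) refl)
  bialternant (suc n) κ x κ↓ = begin
    schurSum κ x * (D * V) ≈⟨ *-congʳ (schurSum-step κ κ↓ x) ⟩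
    ∑ νs (λ ν → when (interlaces? κ ν) ((p ν * w) * s ν)) * (D * V) ≈⟨ *-distribʳ-∑ (D * V) νs _ ⟩
    ∑ νs (λ ν → when (interlaces? κ ν) ((p ν * w) * s ν) * (D * V)) ≈⟨ ∑-cong νs step ⟩
    ∑ νs (λ ν → w * (when (interlaces? κ ν) (p ν) * (D * alternant n (shape ν) x′)))
      ≈⟨ *-distribˡ-∑ w νs _ ⟨
    w * ∑ νs (λ ν → when (interlaces? κ ν) (p ν) * (D * alternant n (shape ν) x′))
      ≈⟨ alternant-step κ κ↓ x ⟨
    alternant (suc n) κ x ∎
    where
    u = x (fromℕ n)
    x′ = x ∘ inject₁
    w = u ^ κ (fromℕ n)
    D = product (λ i → u - x (inject₁ i))
    V = vandermonde n x′
    νs = choices n (λ i → allFin (suc (κ (inject₁ i))))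
    p : Subshape (κ ∘ inject₁) → Carrier
    p ν = product (λ i → u ^ (κ (inject₁ i) ℕ.∸ toℕ (ν i)))
    s : Subshape (κ ∘ inject₁) → Carrier
    s ν = schurSum (shape ν) x′
    step : ∀ ν → when (interlaces? κ ν) ((p ν * w) * s ν) * (D * V)
      ≈ w * (when (interlaces? κ ν) (p ν) * (D * alternant n (shape ν) x′))
    step ν = begin
      when (interlaces? κ ν) ((p ν * w) * s ν) * (D * V) ≈⟨ when-* (interlaces? κ ν) _ _ ⟩
      when (interlaces? κ ν) (((p ν * w) * s ν) * (D * V))
        ≈⟨ when-cong (interlaces? κ ν) (λ h → begin
             ((p ν * w) * s ν) * (D * V) ≈⟨ *-assoc _ _ _ ⟩
             (p ν * w) * (s ν * (D * V)) ≈⟨ *-cong (*-comm _ _) (*-swapˡ _ _ _) ⟩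
             (w * p ν) * (D * (s ν * V)) ≈⟨ *-assoc _ _ _ ⟩
             w * (p ν * (D * (s ν * V)))
               ≈⟨ *-congˡ (*-congˡ (*-congˡ (bialternant n (shape ν) x′ (interlaces-decreasing κ↓ h)))) ⟩
             w * (p ν * (D * alternant n (shape ν) x′)) ∎) ⟩
      when (interlaces? κ ν) (w * (p ν * (D * alternant n (shape ν) x′)))
        ≈⟨ *-when (interlaces? κ ν) _ _ ⟨
      w * when (interlaces? κ ν) (p ν * (D * alternant n (shape ν) x′))
        ≈⟨ *-congˡ (when-* (interlaces? κ ν) _ _) ⟨
      w * (when (interlaces? κ ν) (p ν) * (D * alternant n (shape ν) x′)) ∎

  Regular : Carrier → Set (a ⊔ ℓ)
  Regular x = ∀ y → y * x ≈ 0# → y ≈ 0#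

  product-regular : ∀ {n} (x : Fin n → Carrier) → (∀ i → Regular (x i)) → Regular (product x)
  product-regular {zero}  x reg y h = trans (sym (*-identityʳ y)) h
  product-regular {suc n} x reg y h = reg zero y
    (product-regular (x ∘ suc) (reg ∘ suc) (y * x zero) (trans (*-assoc _ _ _) h))

  vandermonde-regular : ∀ n (x : Vect n) → (∀ i j → i ≢ j → Regular (x i - x j)) → Regular (vandermonde n x)
  vandermonde-regular zero    x reg y h = trans (sym (*-identityʳ y)) h
  vandermonde-regular (suc n) x reg y h =
    product-regular (λ i → x (fromℕ n) - x (inject₁ i)) (λ i → reg (fromℕ n) (inject₁ i) Fin.fromℕ≢inject₁) y
      (vandermonde-regular n (x ∘ inject₁) (λ i j i≢j → reg _ _ (i≢j ∘ Fin.inject₁-injective)) _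
        (trans (*-assoc _ _ _) h))

-- The ring of Laurent polynomials and its cancellable elements

module LaurentRing {c ℓ} (R : CommutativeRing c ℓ) (r : ℕ) where

  open Sums R
  open Laurent R r public using (Laurent; Exponent; coeff; const; mulTerm)
  open Laurent R r using () renaming (_≈_ to _≈ᴸ_; rawSemiring to rawSemiringᴸ)
  open RawSemiring rawSemiringᴸ using () renaming (_*_ to _*ᴸ_)

  infixl 6 _⊕_ _⊖_

  _⊕_ _⊖_ : Exponent → Exponent → Exponent
  _⊕_ = Vec.zipWith ℤ._+_
  d ⊖ e = d ⊕ Vec.map ℤ.-_ e

  0ᵉ : Exponent
  0ᵉ = Vec.replicate r ℤ.0ℤ

  _≟ᵉ_ : (d e : Exponent) → Dec (d ≡ e)
  _≟ᵉ_ = Vec.≡-dec ℤ._≟_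

  ⊕-assoc : ∀ d e f → (d ⊕ e) ⊕ f ≡ d ⊕ (e ⊕ f)
  ⊕-assoc = Vec.zipWith-assoc ℤ.+-assoc

  ⊕-comm : ∀ d e → d ⊕ e ≡ e ⊕ d
  ⊕-comm = Vec.zipWith-comm ℤ.+-comm

  ⊕-identityʳ : ∀ d → d ⊕ 0ᵉ ≡ d
  ⊕-identityʳ = Vec.zipWith-identityʳ ℤ.+-identityʳ

  ⊕-⊖ : ∀ d e → (d ⊕ e) ⊖ e ≡ d
  ⊕-⊖ d e = ≡.trans (⊕-assoc d e _)
    (≡.trans (cong (d ⊕_) (Vec.zipWith-inverseʳ ℤ.+-inverseʳ e)) (⊕-identityʳ d))

  ⊖-⊕ : ∀ d e → (d ⊖ e) ⊕ e ≡ d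
  ⊖-⊕ d e = ≡.trans (⊕-assoc d _ e)
    (≡.trans (cong (d ⊕_) (Vec.zipWith-inverseˡ ℤ.+-inverseˡ e)) (⊕-identityʳ d))

  ⊖-⊖ : ∀ d e f → (d ⊖ e) ⊖ f ≡ d ⊖ (f ⊕ e)
  ⊖-⊖ d e f = ≡.trans (cong (λ g → (g ⊖ e) ⊖ f) (≡.sym (⊖-⊕ d (f ⊕ e))))
    (≡.trans (cong (λ g → (g ⊖ e) ⊖ f) (≡.sym (⊕-assoc _ f e)))
      (≡.trans (cong (_⊖ f) (⊕-⊖ _ e)) (⊕-⊖ _ f)))

  negᴸ : Laurent → Laurent
  negᴸ = List.map (λ (a , d) → - a , d)

  coeff-∑ : ∀ f e → coeff f e ≈ ∑ f (λ (a , d) → when (d ≟ᵉ e) a)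
  coeff-∑ []            e = refl
  coeff-∑ ((a , d) ∷ f) e = +-congˡ (coeff-∑ f e)

  coeff-+ : ∀ f g e → coeff (f ++ g) e ≈ coeff f e + coeff g e
  coeff-+ []      g e = sym (+-identityˡ _)
  coeff-+ (_ ∷ f) g e = trans (+-congˡ (coeff-+ f g e)) (sym (+-assoc _ _ _))

  coeff-neg : ∀ f e → coeff (negᴸ f) e ≈ - coeff f e
  coeff-neg []            e = sym -0#≈0#
  coeff-neg ((a , d) ∷ f) e = trans (+-cong (when-neg (d ≟ᵉ e)) (coeff-neg f e)) (-‿+-comm _ _)
    where
    when-neg : ∀ {p} {P : Set p} (P? : Dec P) → when P? (- a) ≈ - when P? a
    when-neg (yes _) = refl
    when-neg (no _)  = sym -0#≈0#

  -- Only the terms of g are listed; f enters through its coefficients. This makes the product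
  -- respect equality of coefficients even though lists may repeat exponents.
  coeff-* : ∀ f g e → coeff (f *ᴸ g) e ≈ ∑ g (λ (b , d) → coeff f (e ⊖ d) * b)
  coeff-* f g e = begin
    coeff (f *ᴸ g) e ≈⟨ coeff-∑ (f *ᴸ g) e ⟩
    ∑ (f *ᴸ g) (λ (a , d) → when (d ≟ᵉ e) a) ≈⟨ ∑-cartesianProductWith mulTerm f g _ ⟩
    ∑ f (λ (a , d) → ∑ g (λ (b , d′) → when ((d ⊕ d′) ≟ᵉ e) (a * b))) ≈⟨ ∑-swap f g _ ⟩
    ∑ g (λ (b , d′) → ∑ f (λ (a , d) → when ((d ⊕ d′) ≟ᵉ e) (a * b)))
      ≈⟨ ∑-cong g (λ (b , d′) → trans
           (trans (∑-cong f (λ (a , d) → trans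
             (when-⇔ ((d ⊕ d′) ≟ᵉ e) (d ≟ᵉ (e ⊖ d′)) (λ { ≡.refl → ≡.sym (⊕-⊖ d d′) })
               (λ { ≡.refl → ⊖-⊕ e d′ }) refl) (sym (when-* (d ≟ᵉ (e ⊖ d′)) a b))))
             (sym (*-distribʳ-∑ b f _)))
           (*-congʳ (sym (coeff-∑ f (e ⊖ d′))))) ⟩
    ∑ g (λ (b , d) → coeff f (e ⊖ d) * b) ∎

  coeff-*-sym : ∀ f g e → coeff (f *ᴸ g) e ≈ coeff (g *ᴸ f) e
  coeff-*-sym f g e = begin
    coeff (f *ᴸ g) e ≈⟨ trans (coeff-∑ (f *ᴸ g) e) (∑-cartesianProductWith mulTerm f g _) ⟩
    ∑ f (λ (a , d) → ∑ g (λ (b , d′) → when ((d ⊕ d′) ≟ᵉ e) (a * b))) ≈⟨ ∑-swap f g _ ⟩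
    ∑ g (λ (b , d′) → ∑ f (λ (a , d) → when ((d ⊕ d′) ≟ᵉ e) (a * b)))
      ≈⟨ ∑-cong g (λ (b , d′) → ∑-cong f (λ (a , d) → when-⇔ ((d ⊕ d′) ≟ᵉ e) ((d′ ⊕ d) ≟ᵉ e)
           (≡.trans (⊕-comm d′ d)) (≡.trans (⊕-comm d d′)) (*-comm a b))) ⟩
    ∑ g (λ (b , d′) → ∑ f (λ (a , d) → when ((d′ ⊕ d) ≟ᵉ e) (b * a)))
      ≈⟨ trans (coeff-∑ (g *ᴸ f) e) (∑-cartesianProductWith mulTerm g f _) ⟨
    coeff (g *ᴸ f) e ∎

  private
    *ᴸ-congʳ : ∀ f f′ g → f ≈ᴸ f′ → (f *ᴸ g) ≈ᴸ (f′ *ᴸ g)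
    *ᴸ-congʳ f f′ g h e = trans (coeff-* f g e)
      (trans (∑-cong g (λ (b , d) → *-congʳ (h (e ⊖ d)))) (sym (coeff-* f′ g e)))

    *ᴸ-assoc : ∀ f g h → ((f *ᴸ g) *ᴸ h) ≈ᴸ (f *ᴸ (g *ᴸ h))
    *ᴸ-assoc f g h e = begin
      coeff ((f *ᴸ g) *ᴸ h) e ≈⟨ coeff-* (f *ᴸ g) h e ⟩
      ∑ h (λ (k , d) → coeff (f *ᴸ g) (e ⊖ d) * k)
        ≈⟨ ∑-cong h (λ (k , d) → trans (*-congʳ (coeff-* f g (e ⊖ d))) (*-distribʳ-∑ k g _)) ⟩
      ∑ h (λ (k , d) → ∑ g (λ (b , d′) → (coeff f ((e ⊖ d) ⊖ d′) * b) * k))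
        ≈⟨ ∑-cong h (λ (k , d) → ∑-cong g (λ (b , d′) → trans (*-assoc _ b k)
             (*-congʳ (reflexive (cong (coeff f) (⊖-⊖ e d d′)))))) ⟩
      ∑ h (λ (k , d) → ∑ g (λ (b , d′) → coeff f (e ⊖ (d′ ⊕ d)) * (b * k))) ≈⟨ ∑-swap h g _ ⟩
      ∑ g (λ (b , d′) → ∑ h (λ (k , d) → coeff f (e ⊖ (d′ ⊕ d)) * (b * k)))
        ≈⟨ ∑-cartesianProductWith mulTerm g h _ ⟨
      ∑ (g *ᴸ h) (λ (b , d) → coeff f (e ⊖ d) * b) ≈⟨ coeff-* f (g *ᴸ h) e ⟨
      coeff (f *ᴸ (g *ᴸ h)) e ∎

    *ᴸ-identityʳ : ∀ f → (f *ᴸ const 1#) ≈ᴸ f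
    *ᴸ-identityʳ f e = trans (coeff-* f (const 1#) e) (trans (+-identityʳ _) (trans (*-identityʳ _)
      (reflexive (cong (coeff f) (≡.trans (≡.sym (⊕-identityʳ _)) (⊖-⊕ e 0ᵉ))))))

    *ᴸ-distribˡ : ∀ f g h → (f *ᴸ (g ++ h)) ≈ᴸ ((f *ᴸ g) ++ (f *ᴸ h))
    *ᴸ-distribˡ f g h e = begin
      coeff (f *ᴸ (g ++ h)) e ≈⟨ trans (coeff-* f (g ++ h) e) (∑-++ g h _) ⟩
      ∑ g _ + ∑ h _ ≈⟨ +-cong (coeff-* f g e) (coeff-* f h e) ⟨
      coeff (f *ᴸ g) e + coeff (f *ᴸ h) e ≈⟨ coeff-+ (f *ᴸ g) (f *ᴸ h) e ⟨
      coeff ((f *ᴸ g) ++ (f *ᴸ h)) e ∎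

    *ᴸ-cong : ∀ f f′ g g′ → f ≈ᴸ f′ → g ≈ᴸ g′ → (f *ᴸ g) ≈ᴸ (f′ *ᴸ g′)
    *ᴸ-cong f f′ g g′ h k e = trans (*ᴸ-congʳ f f′ g h e) (trans (coeff-*-sym f′ g e)
      (trans (*ᴸ-congʳ g g′ f′ k e) (coeff-*-sym g′ f′ e)))

    *ᴸ-distribʳ : ∀ f g h → ((g ++ h) *ᴸ f) ≈ᴸ ((g *ᴸ f) ++ (h *ᴸ f))
    *ᴸ-distribʳ f g h e = trans (coeff-*-sym (g ++ h) f e) (trans (*ᴸ-distribˡ f g h e)
      (trans (coeff-+ (f *ᴸ g) (f *ᴸ h) e) (trans (+-cong (coeff-*-sym f g e) (coeff-*-sym f h e))
        (sym (coeff-+ (g *ᴸ f) (h *ᴸ f) e)))))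

  -- Its operations are those of `rawSemiring`, so that results about commutative rings speak
  -- directly of the Schur polynomial in the theorem.
  laurentRing : CommutativeRing c ℓ
  laurentRing = record
    { Carrier = Laurent ; _≈_ = _≈ᴸ_ ; _+_ = _++_ ; _*_ = _*ᴸ_ ; -_ = negᴸ ; 0# = [] ; 1# = const 1#
    ; isCommutativeRing = record
      { isRing = record
        { +-isAbelianGroup = record
          { isGroup = record
            { isMonoid = record
              { isSemigroup = record
                { isMagma = record
                  { isEquivalence = record
                    { refl = λ e → refl ; sym = λ h e → sym (h e) ; trans = λ h k e → trans (h e) (k e) }
                  ; ∙-cong = λ {f} {f′} {g} {g′} h k e →
                      trans (coeff-+ f g e) (trans (+-cong (h e) (k e)) (sym (coeff-+ f′ g′ e)))
                  }
                ; assoc = λ f g h e → reflexive (cong (λ k → coeff k e) (List.++-assoc f g h))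
                }
              ; identity = (λ f e → refl) , (λ f e → reflexive (cong (λ k → coeff k e) (List.++-identityʳ f)))
              }
            ; inverse = (λ f e → trans (coeff-+ (negᴸ f) f e)
                          (trans (+-congʳ (coeff-neg f e)) (-‿inverseˡ _)))
                      , (λ f e → trans (coeff-+ f (negᴸ f) e)
                          (trans (+-congˡ (coeff-neg f e)) (-‿inverseʳ _)))
            ; ⁻¹-cong = λ {f} {g} h e → trans (coeff-neg f e) (trans (-‿cong (h e)) (sym (coeff-neg g e)))
            }
          ; comm = λ f g e → trans (coeff-+ f g e) (trans (+-comm _ _) (sym (coeff-+ g f e)))
          }
        ; *-cong = λ {f} {f′} {g} {g′} → *ᴸ-cong f f′ g g′
        ; *-assoc = *ᴸ-assoc
        ; *-identity = (λ f e → trans (coeff-*-sym (const 1#) f e) (*ᴸ-identityʳ f e)) , *ᴸ-identityʳ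
        ; distrib = *ᴸ-distribˡ , *ᴸ-distribʳ
        }
      ; *-comm = coeff-*-sym
      }
    }

  mon : Carrier → Exponent → Laurent
  mon a d = (a , d) ∷ []

  coeff-mon-≡ : ∀ a d → coeff (mon a d) d ≈ a
  coeff-mon-≡ a d = trans (+-identityʳ _) (when-true (d ≟ᵉ d) ≡.refl)

  mon-cong : ∀ {a b d e} → a ≈ b → d ≡ e → mon a d ≈ᴸ mon b e
  mon-cong {d = d} a≈b ≡.refl e = +-congʳ (when-cong (d ≟ᵉ e) (λ _ → a≈b))

  mon-zero : ∀ {a} d → a ≈ 0# → mon a d ≈ᴸ []
  mon-zero d a≈0 e = trans (+-identityʳ _) (when-zero (d ≟ᵉ e) (λ _ → a≈0))

  open Alternants laurentRing public using (Regular)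

  coeff-*-difference : ∀ f α d β e p →
    coeff (f *ᴸ (mon α d ++ negᴸ (mon β e))) p ≈ coeff f (p ⊖ d) * α - coeff f (p ⊖ e) * β
  coeff-*-difference f α d β e p = trans (coeff-* f _ p)
    (+-congˡ (trans (+-identityʳ _) (sym (-‿distribʳ-* _ β))))

  -- Both terms have the exponent `d`, so the factor is a unit times a monomial.
  difference-regular-const : ∀ {α β γ} d → (α - β) * γ ≈ 1# → Regular (mon α d ++ negᴸ (mon β d))
  difference-regular-const {α} {β} {γ} d inv f h q = begin
    coeff f q ≈⟨ *-identityʳ _ ⟨
    coeff f q * 1# ≈⟨ *-congˡ inv ⟨
    coeff f q * ((α - β) * γ) ≈⟨ *-assoc _ _ _ ⟨
    (coeff f q * (α - β)) * γ ≈⟨ *-congʳ (trans (distribˡ _ _ _) (+-congˡ (sym (-‿distribʳ-* _ _)))) ⟩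
    (coeff f q * α - coeff f q * β) * γ
      ≡⟨ cong (λ e → (coeff f e * α - coeff f e * β) * γ) (⊕-⊖ q d) ⟨
    (coeff f ((q ⊕ d) ⊖ d) * α - coeff f ((q ⊕ d) ⊖ d) * β) * γ
      ≈⟨ *-congʳ (trans (sym (coeff-*-difference f α d β d (q ⊕ d))) (h (q ⊕ d))) ⟩
    0# * γ ≈⟨ zeroˡ γ ⟩
    0# ∎

  private
    orient : ∀ i → i ≢ ℤ.0ℤ → ∃ λ s → ℤ.1ℤ ℤ.≤ s ℤ.* i
    orient (ℤ.+ zero)    i≢0 = contradiction ≡.refl i≢0
    orient (ℤ.+ (suc n)) i≢0 = ℤ.1ℤ , subst (ℤ.1ℤ ℤ.≤_) (≡.sym (ℤ.*-identityˡ _)) (ℤ.+≤+ (ℕ.s≤s ℕ.z≤n))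
    orient ℤ.-[1+ n ]    i≢0 = ℤ.-1ℤ , subst (ℤ.1ℤ ℤ.≤_) (≡.sym (ℤ.-1*i≡-i ℤ.-[1+ n ])) (ℤ.+≤+ (ℕ.s≤s ℕ.z≤n))

    i≤+∣i∣ : ∀ i → i ℤ.≤ ℤ.+ ℤ.∣ i ∣
    i≤+∣i∣ (ℤ.+ n)    = ℤ.≤-refl
    i≤+∣i∣ ℤ.-[1+ n ] = ℤ.-≤+

  -- A relation f q = f (q + d - e) b propagates along a ray, and f vanishes far out
  -- on every ray.

  difference-regular : ∀ {α α⁻¹ β} d e k → α * α⁻¹ ≈ 1# → Vec.lookup d k ≢ Vec.lookup e k →
                       Regular (mon α d ++ negᴸ (mon β e))
  difference-regular {α} {α⁻¹} {β} d e k inv d≢e f h q =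
    -- Every step along the ray raises φ by at least one, and φ q is at least minus its absolute
    -- value, so this many steps lead beyond `B`.
    far (B ℕ.+ ℤ.∣ φ q ∣) q (ℤ.≤-trans (ℤ.≤-reflexive (≡.sym (ℤ.+-identityʳ (ℤ.+ B)))) (begin-ℤ))
    where
    gap = Vec.lookup d k ℤ.- Vec.lookup e k
    -- The sign `s` is chosen so that φ, the k-th exponent up to sign, grows along the ray.
    oriented = orient gap (λ g≡0 → d≢e (ℤ.i-j≡0⇒i≡j _ _ g≡0))
    s = proj₁ oriented
    φ : Exponent → ℤ.ℤ
    φ p = s ℤ.* Vec.lookup p k
    step : ∀ p → coeff f p ≈ coeff f ((p ⊕ d) ⊖ e) * (β * α⁻¹)
    step p = begin
      coeff f p ≈⟨ trans (sym (*-identityʳ _)) (trans (*-congˡ (sym inv)) (sym (*-assoc _ _ _))) ⟩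
      (coeff f p * α) * α⁻¹ ≡⟨ cong (λ e′ → (coeff f e′ * α) * α⁻¹) (⊕-⊖ p d) ⟨
      (coeff f ((p ⊕ d) ⊖ d) * α) * α⁻¹ ≈⟨ *-congʳ (x-y≈0 (trans
        (sym (coeff-*-difference f α d β e (p ⊕ d))) (h (p ⊕ d)))) ⟩
      (coeff f ((p ⊕ d) ⊖ e) * β) * α⁻¹ ≈⟨ *-assoc _ _ _ ⟩
      coeff f ((p ⊕ d) ⊖ e) * (β * α⁻¹) ∎
      where
      x-y≈0 : ∀ {x y} → x - y ≈ 0# → x ≈ y
      x-y≈0 {x} {y} g = trans (+-inverseˡ-unique _ _ g) (-‿involutive y)
    φ-step : ∀ p → φ p ℤ.+ ℤ.1ℤ ℤ.≤ φ ((p ⊕ d) ⊖ e)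
    φ-step p = subst (φ p ℤ.+ ℤ.1ℤ ℤ.≤_) (≡.sym (≡.trans (cong (s ℤ.*_) lookup-step)
      (ℤ.*-distribˡ-+ s _ gap))) (ℤ.+-monoʳ-≤ (φ p) (proj₂ oriented))
      where
      lookup-step : Vec.lookup ((p ⊕ d) ⊖ e) k ≡ Vec.lookup p k ℤ.+ gap
      lookup-step = ≡.trans (Vec.lookup-zipWith ℤ._+_ k (p ⊕ d) _) (≡.trans
        (cong₂ ℤ._+_ (Vec.lookup-zipWith ℤ._+_ k p d) (Vec.lookup-map k ℤ.-_ e)) (ℤ.+-assoc (Vec.lookup p k) _ _))
    -- The bound exceeds φ at every listed exponent, whether or not its coefficient is zero, so no
    -- coefficient has to be tested.
    support : ∀ (g : Laurent) → ∃ λ B → ∀ p → ℤ.+ B ℤ.≤ φ p → coeff g p ≈ 0#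
    support []            = 0 , λ p le → refl
    support ((a , d) ∷ g) with B , bound ← support g = suc ℤ.∣ φ d ∣ ℕ.⊔ B , λ p le → trans (+-cong
      (when-false (d ≟ᵉ p) (λ { ≡.refl → ℤ.<-irrefl ≡.refl (ℤ.<-≤-trans
        (ℤ.≤-<-trans (i≤+∣i∣ (φ d)) (ℤ.+<+ (ℕ.m≤m⊔n (suc ℤ.∣ φ d ∣) B))) le) }))
      (bound p (ℤ.≤-trans (ℤ.+≤+ (ℕ.m≤n⊔m _ B)) le))) (+-identityʳ 0#)
    B = proj₁ (support f)
    far : ∀ n p → ℤ.+ B ℤ.≤ φ p ℤ.+ ℤ.+ n → coeff f p ≈ 0#
    far zero    p le = proj₂ (support f) p (subst (ℤ.+ B ℤ.≤_) (ℤ.+-identityʳ (φ p)) le)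
    far (suc n) p le = trans (step p) (trans (*-congʳ (far n _ (ℤ.≤-trans
      (subst (ℤ.+ B ℤ.≤_) (≡.sym (ℤ.+-assoc (φ p) ℤ.1ℤ (ℤ.+ n))) le)
      (ℤ.+-monoˡ-≤ (ℤ.+ n) (φ-step p))))) (zeroˡ _))
    begin-ℤ : ℤ.+ B ℤ.+ ℤ.0ℤ ℤ.≤ φ q ℤ.+ ℤ.+ (B ℕ.+ ℤ.∣ φ q ∣)
    begin-ℤ = subst (ℤ.+ B ℤ.+ ℤ.0ℤ ℤ.≤_) (≡.trans (≡.sym (ℤ.+-assoc (ℤ.+ B) (φ q) _))
      (≡.trans (cong (ℤ._+ ℤ.+ ℤ.∣ φ q ∣) (ℤ.+-comm (ℤ.+ B) (φ q))) (ℤ.+-assoc (φ q) (ℤ.+ B) _)))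
      (ℤ.+-monoʳ-≤ (ℤ.+ B) (nonneg (φ q)))
      where
      nonneg : ∀ i → ℤ.0ℤ ℤ.≤ i ℤ.+ ℤ.+ ℤ.∣ i ∣
      nonneg (ℤ.+ n)    = ℤ.+≤+ ℕ.z≤n
      nonneg ℤ.-[1+ n ] = ℤ.≤-reflexive (≡.sym (ℤ.+-inverseˡ (ℤ.+ suc n)))

-- Counting, ranks and a discrete intermediate value

bit : ∀ {p} {P : Set p} → Dec P → ℕ
bit (yes _) = 1
bit (no _)  = 0

count : ∀ {n p} {P : Fin n → Set p} → (∀ i → Dec (P i)) → ℕ
count {zero}  P? = 0
count {suc n} P? = bit (P? zero) ℕ.+ count (P? ∘ suc)

bit-⊆ : ∀ {p q} {P : Set p} {Q : Set q} (P? : Dec P) (Q? : Dec Q) → (P → Q) → bit P? ℕ.≤ bit Q?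
bit-⊆ (yes p) (yes q) h = ℕ.≤-refl
bit-⊆ (yes p) (no ¬q) h = contradiction (h p) ¬q
bit-⊆ (no _)  Q?      h = ℕ.z≤n

bit-yes : ∀ {p} {P : Set p} (P? : Dec P) → P → bit P? ≡ 1
bit-yes (yes _) p = ≡.refl
bit-yes (no ¬p) p = contradiction p ¬p

bit-no : ∀ {p} {P : Set p} (P? : Dec P) → ¬ P → bit P? ≡ 0
bit-no (yes p) ¬p = contradiction p ¬p
bit-no (no _)  ¬p = ≡.refl

count-none : ∀ {n p} {P : Fin n → Set p} (P? : ∀ i → Dec (P i)) → (∀ i → ¬ P i) → count P? ≡ 0
count-none {zero}  P? h = ≡.refl
count-none {suc n} P? h = cong₂ ℕ._+_ (bit-no (P? zero) (h zero)) (count-none (P? ∘ suc) (h ∘ suc))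

module _ {p q : Level} where

  count-⊆ : ∀ {n} {P : Fin n → Set p} {Q : Fin n → Set q} (P? : ∀ i → Dec (P i)) (Q? : ∀ i → Dec (Q i)) →
            (∀ i → P i → Q i) → count P? ℕ.≤ count Q?
  count-⊆ {zero}  P? Q? h = ℕ.z≤n
  count-⊆ {suc n} P? Q? h = ℕ.+-mono-≤ (bit-⊆ (P? zero) (Q? zero) (h zero)) (count-⊆ (P? ∘ suc) (Q? ∘ suc) (h ∘ suc))

  count-⊂ : ∀ {n} {P : Fin n → Set p} {Q : Fin n → Set q} (P? : ∀ i → Dec (P i)) (Q? : ∀ i → Dec (Q i)) →
            (∀ i → P i → Q i) → ∀ j → Q j → ¬ P j → count P? ℕ.< count Q?
  count-⊂ {suc n} P? Q? h zero Qj ¬Pj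
    rewrite bit-no (P? zero) ¬Pj | bit-yes (Q? zero) Qj = ℕ.s≤s (count-⊆ (P? ∘ suc) (Q? ∘ suc) (h ∘ suc))
  count-⊂ {suc n} P? Q? h (suc j) Qj ¬Pj = ℕ.+-mono-≤-< (bit-⊆ (P? zero) (Q? zero) (h zero))
    (count-⊂ (P? ∘ suc) (Q? ∘ suc) (h ∘ suc) j Qj ¬Pj)

  count-almost-⊆ : ∀ {n} {P : Fin n → Set p} {Q : Fin n → Set q} (P? : ∀ i → Dec (P i)) (Q? : ∀ i → Dec (Q i)) →
    (∀ i j → P i → ¬ Q i → P j → ¬ Q j → i ≡ j) → count P? ℕ.≤ suc (count Q?)
  count-almost-⊆ {zero}  P? Q? h = ℕ.z≤n
  count-almost-⊆ {suc n} {P} {Q} P? Q? h with P? zero | Q? zero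
  ... | yes p | yes q = ℕ.s≤s (count-almost-⊆ (P? ∘ suc) (Q? ∘ suc)
    (λ i j pi qi pj qj → Fin.suc-injective (h _ _ pi qi pj qj)))
  ... | no _  | yes q = ℕ.m≤n⇒m≤1+n (count-almost-⊆ (P? ∘ suc) (Q? ∘ suc)
    (λ i j pi qi pj qj → Fin.suc-injective (h _ _ pi qi pj qj)))
  ... | no _  | no _  = count-almost-⊆ (P? ∘ suc) (Q? ∘ suc)
    (λ i j pi qi pj qj → Fin.suc-injective (h _ _ pi qi pj qj))
  ... | yes p | no ¬q = ℕ.s≤s (count-⊆ (P? ∘ suc) (Q? ∘ suc) included)
    where
    included : ∀ i → P (suc i) → Q (suc i)
    included i pi with Q? (suc i)
    ... | yes qi = qi
    ... | no ¬qi = contradiction (h zero (suc i) p ¬q pi ¬qi) (λ ())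

count-trichotomy : ∀ {n p q s} {P : Fin n → Set p} {Q : Fin n → Set q} {R : Fin n → Set s}
  (P? : ∀ i → Dec (P i)) (Q? : ∀ i → Dec (Q i)) (R? : ∀ i → Dec (R i)) →
  (∀ i → P i → ¬ Q i) → (∀ i → R i ⇔ (¬ P i × ¬ Q i)) → count P? ℕ.+ count Q? ℕ.+ count R? ≡ n
count-trichotomy {zero}  P? Q? R? h e = ≡.refl
count-trichotomy {suc n} P? Q? R? h e = ≡.trans
  (regroup (bit (P? zero)) (bit (Q? zero)) (bit (R? zero)) (count (P? ∘ suc)) (count (Q? ∘ suc)) _)
  (cong₂ ℕ._+_ (one (P? zero) (Q? zero) (R? zero) (h zero) (e zero))
    (count-trichotomy (P? ∘ suc) (Q? ∘ suc) (R? ∘ suc) (h ∘ suc) (e ∘ suc)))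
  where
  regroup : ∀ a b c x y z → (a ℕ.+ x) ℕ.+ (b ℕ.+ y) ℕ.+ (c ℕ.+ z) ≡ (a ℕ.+ b ℕ.+ c) ℕ.+ (x ℕ.+ y ℕ.+ z)
  regroup = ℕ-Solver.solve-∀
  one : ∀ {p q s} {P : Set p} {Q : Set q} {R : Set s} (P? : Dec P) (Q? : Dec Q) (R? : Dec R) →
    (P → ¬ Q) → R ⇔ (¬ P × ¬ Q) → bit P? ℕ.+ bit Q? ℕ.+ bit R? ≡ 1
  one (yes p) (yes q) R?      h e = contradiction q (h p)
  one (yes p) (no ¬q) (yes r) h e = contradiction p (proj₁ (Equivalence.to e r))
  one (yes p) (no ¬q) (no ¬r) h e = ≡.refl
  one (no ¬p) (yes q) (yes r) h e = contradiction q (proj₂ (Equivalence.to e r))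
  one (no ¬p) (yes q) (no ¬r) h e = ≡.refl
  one (no ¬p) (no ¬q) (yes r) h e = ≡.refl
  one (no ¬p) (no ¬q) (no ¬r) h e = contradiction (Equivalence.from e (¬p , ¬q)) ¬r

module Rank {n p} {P : Fin n → Set p} (P? : ∀ i → Dec (P i)) (κ : Fin n → ℕ) (κ-inj : Injective _≡_ _≡_ κ) where

  -- Rank 0 belongs to the largest key; with the keys used below this is the element farthest from
  -- c.
  rank : Fin n → ℕ
  rank j = count (λ i → P? i ×-dec (κ j ℕ.<? κ i))

  rank<count : ∀ {j} → P j → rank j ℕ.< count P?
  rank<count {j} Pj = count-⊂ (λ i → P? i ×-dec (κ j ℕ.<? κ i)) P? (λ i → proj₁) j Pj (ℕ.<-irrefl ≡.refl ∘ proj₂)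

  rank-antitone : ∀ {i j} → P j → κ i ℕ.< κ j → rank j ℕ.< rank i
  rank-antitone {i} {j} Pj lt = count-⊂ (λ l → P? l ×-dec (κ j ℕ.<? κ l)) (λ l → P? l ×-dec (κ i ℕ.<? κ l))
    (λ l (Pl , h) → Pl , ℕ.<-trans lt h) j (Pj , lt) (ℕ.<-irrefl ≡.refl ∘ proj₂)

  rank-injective : ∀ {i j} → P i → P j → rank i ≡ rank j → i ≡ j
  rank-injective {i} {j} Pi Pj e with ℕ.<-cmp (κ i) (κ j)
  ... | tri< lt _ _ = contradiction (≡.sym e) (ℕ.<⇒≢ (rank-antitone Pj lt))
  ... | tri≈ _ eq _ = κ-inj eq
  ... | tri> _ _ gt = contradiction e (ℕ.<⇒≢ (rank-antitone Pi gt))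

  rank≤⇒key≤ : ∀ {i j} → P i → rank j ℕ.≤ rank i → κ i ℕ.≤ κ j
  rank≤⇒key≤ Pi le = ℕ.≮⇒≥ (λ lt → ℕ.<⇒≱ (rank-antitone Pi lt) le)

-- The ranks of the elements `f a` are distinct numbers below the count.
count-lower-bound : ∀ {n k p} {P : Fin n → Set p} (P? : ∀ i → Dec (P i)) (f : Fin k → Fin n) →
                    Injective _≡_ _≡_ f → (∀ a → P (f a)) → k ℕ.≤ count P?
count-lower-bound P? f f-inj Pf = Fin.injective⇒≤ {f = λ a → Fin.fromℕ< (rank<count (Pf a))}
  (λ {a} {b} e → f-inj (rank-injective (Pf a) (Pf b) (Fin.fromℕ<-injective _ _ _ _ e)))
  where open Rank P? toℕ Fin.toℕ-injective

bounded : ∀ {n} (b : Fin n → ℕ) → ∃ λ B → ∀ i → b i ℕ.≤ B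
bounded {zero}  b = 0 , λ ()
bounded {suc n} b with B , h ← bounded (b ∘ suc) = b zero ℕ.⊔ B , λ
  { zero → ℕ.m≤m⊔n _ B ; (suc i) → ℕ.≤-trans (h i) (ℕ.m≤n⊔m (b zero) B) }

-- Walk down from M while the value stays at most r. Where the walk stops above 0 the value one step
-- lower exceeds r, so f m is still at least r.
descend : ∀ (f : ℕ → ℕ) r → (∀ m → f m ℕ.≤ suc (f (suc m))) → ∀ M → f M ℕ.≤ r →
          ∃ λ m → f m ℕ.≤ r × (m ≡ 0 ⊎ r ℕ.≤ f m)
descend f r step zero    le = 0 , le , inj₁ ≡.refl
descend f r step (suc M) le with f M ℕ.≤? r
... | yes le′ = descend f r step M le′
... | no  ¬le = suc M , le , inj₂ (ℕ.s≤s⁻¹ (ℕ.≤-trans (ℕ.≰⇒> ¬le) (step M)))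

-- Labels play two roles: they name the rows, that is the variables of the point, and the vectors
-- over which the columns are expanded. In the first role `res i` is the row of ζ^i, in the second
-- `res a` is the vector of the residue a.
data Label (t r : ℕ) : Set where
  res     : Fin t → Label t r
  pos neg : Fin r → Label t r

module ℤ-Sums = Sums ℤ.+-*-commutativeRing

module Signs {t r : ℕ} where

  open ℤ-Sums

  δ⁺ δ⁻ : Fin r → Label t r → ℤ.ℤ
  δ⁺ k (pos k′) = when (k′ Fin.≟ k) ℤ.1ℤ
  δ⁺ k _        = ℤ.0ℤ
  δ⁻ k (neg k′) = when (k′ Fin.≟ k) ℤ.1ℤ
  δ⁻ k _        = ℤ.0ℤ

  sign : Fin r → Label t r → ℤ.ℤ
  sign k l = δ⁺ k l ℤ.- δ⁻ k l

  -- Written as a sum over k so that exchanging sums turns the sum of `total (lab (τ j))` times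
  -- `b j` over j into the sum of all energies.
  total : Label t r → ℤ.ℤ
  total l = ∑ (allFin r) (λ k → sign k l)

  total-res : ∀ a → total (res a) ≡ ℤ.0ℤ
  total-res a = ∑-zero (allFin r) (λ k → ≡.refl)

  total-pos : ∀ k → total (pos k) ≡ ℤ.1ℤ
  total-pos k = ≡.trans (∑-allFin-single r k _ (λ k′ k′≢k →
    cong (ℤ._- ℤ.0ℤ) (when-false (k Fin.≟ k′) (k′≢k ∘ ≡.sym))))
    (cong (ℤ._- ℤ.0ℤ) (when-true (k Fin.≟ k) ≡.refl))

  total-neg : ∀ k → total (neg k) ≡ ℤ.-1ℤ
  total-neg k = ≡.trans (∑-allFin-single r k _ (λ k′ k′≢k →
    cong (λ z → ℤ.0ℤ ℤ.- z) (when-false (k Fin.≟ k′) (k′≢k ∘ ≡.sym))))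
    (cong (λ z → ℤ.0ℤ ℤ.- z) (when-true (k Fin.≟ k) ≡.refl))

-- The centre c, distances to it, and the choice of representatives

double-≤ : ∀ {m n} → m ℕ.+ m ℕ.≤ n ℕ.+ n → m ℕ.≤ n
double-≤ le = ℕ.≮⇒≥ (λ lt → ℕ.<⇒≱ (ℕ.+-mono-< lt lt) le)

double-injective : ∀ {m n} → m ℕ.+ m ≡ n ℕ.+ n → m ≡ n
double-injective e = ℕ.≤-antisym (double-≤ (ℕ.≤-reflexive e)) (double-≤ (ℕ.≤-reflexive (≡.sym e)))

-- The hypotheses amount to c ≤ a ≤ -c.
abs-≤ : ∀ a c → a ℤ.+ c ℤ.≤ ℤ.0ℤ → c ℤ.≤ a → ℤ.∣ a ∣ ℕ.≤ ℤ.∣ c ∣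
abs-≤ a c a+c≤0 c≤a = ℤ.drop‿+≤+ (ℤ.≤-trans bound (-i≤∣i∣ c))
  where
  -i≤∣i∣ : ∀ i → ℤ.- i ℤ.≤ ℤ.+ ℤ.∣ i ∣
  -i≤∣i∣ (ℤ.+ n)    = ℤ.neg-≤-pos
  -i≤∣i∣ ℤ.-[1+ n ] = ℤ.≤-refl
  a≤-c : a ℤ.≤ ℤ.- c
  a≤-c = subst₂ ℤ._≤_ (cancel a c) (ℤ.+-identityˡ _) (ℤ.+-monoˡ-≤ (ℤ.- c) a+c≤0)
    where
    cancel : ∀ a c → (a ℤ.+ c) ℤ.+ ℤ.- c ≡ a
    cancel = ℤ-Solver.solve-∀
  bound : ℤ.+ ℤ.∣ a ∣ ℤ.≤ ℤ.- c
  bound with ℤ.+∣i∣≡i⊎+∣i∣≡-i a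
  ... | inj₁ e = subst (ℤ._≤ ℤ.- c) (≡.sym e) a≤-c
  ... | inj₂ e = subst (ℤ._≤ ℤ.- c) (≡.sym e) (ℤ.neg-mono-≤ c≤a)

abs-≤′ : ∀ a c → ℤ.0ℤ ℤ.≤ a ℤ.+ c → a ℤ.≤ c → ℤ.∣ a ∣ ℕ.≤ ℤ.∣ c ∣
abs-≤′ a c 0≤a+c a≤c = subst₂ ℕ._≤_ (ℤ.∣-i∣≡∣i∣ a) (ℤ.∣-i∣≡∣i∣ c)
  (abs-≤ (ℤ.- a) (ℤ.- c) (subst (ℤ._≤ ℤ.0ℤ) (ℤ.neg-distrib-+ a c) (ℤ.neg-mono-≤ 0≤a+c)) (ℤ.neg-mono-≤ a≤c))

module Selection {t r N : ℕ} (b : Fin N → ℕ) (b-inj : Injective _≡_ _≡_ b) (cls : Fin N → Fin t)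
  (halving : ∀ i i′ j j′ → cls i ≡ cls i′ → cls j ≡ cls j′ → b i ℕ.+ b i′ ≡ b j ℕ.+ b j′ → cls i ≡ cls j)
  (occupied : ∀ a → ∃ λ j → cls j ≡ a) (size : N ≡ t ℕ.+ r ℕ.* 2) where

  -- j lies above (below) the element of its class closest to m / 2 + 1 / 4.

  Upper Lower Middle : ℕ → Fin N → Set
  Upper m j = ∃ λ j′ → cls j′ ≡ cls j × b j′ ℕ.< b j × m ℕ.< b j ℕ.+ b j′
  Lower m j = ∃ λ j′ → cls j′ ≡ cls j × b j ℕ.< b j′ × b j ℕ.+ b j′ ℕ.≤ m
  Middle m j = ¬ Upper m j × ¬ Lower m j

  upper? : ∀ m j → Dec (Upper m j)
  upper? m j = Fin.any? λ j′ → (cls j′ Fin.≟ cls j) ×-dec (b j′ ℕ.<? b j) ×-dec (m ℕ.<? b j ℕ.+ b j′)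

  lower? : ∀ m j → Dec (Lower m j)
  lower? m j = Fin.any? λ j′ → (cls j′ Fin.≟ cls j) ×-dec (b j ℕ.<? b j′) ×-dec (b j ℕ.+ b j′ ℕ.≤? m)

  middle? : ∀ m j → Dec (Middle m j)
  middle? m j = ¬? (upper? m j) ×-dec ¬? (lower? m j)

  upper⇒ : ∀ {m j} → Upper m j → m ℕ.< b j ℕ.+ b j
  upper⇒ {j = j} (j′ , _ , lt , m<) = ℕ.<-trans m< (ℕ.+-monoʳ-< (b j) lt)

  lower⇒ : ∀ {m j} → Lower m j → b j ℕ.+ b j ℕ.≤ m
  lower⇒ {j = j} (j′ , _ , lt , ≤m) = ℕ.≤-trans (ℕ.<⇒≤ (ℕ.+-monoʳ-< (b j) lt)) ≤m

  -- By halving, the class of a pair with sum m + 1 is determined by m.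

  upper-step : ∀ m → count (upper? m) ℕ.≤ suc (count (upper? (suc m)))
  upper-step m = count-almost-⊆ (upper? m) (upper? (suc m)) unique
    where
    tight : ∀ {i i′} → cls i′ ≡ cls i → b i′ ℕ.< b i → m ℕ.< b i ℕ.+ b i′ → ¬ Upper (suc m) i →
            b i ℕ.+ b i′ ≡ suc m
    tight c lt m< ¬u = ℕ.≤-antisym (ℕ.≮⇒≥ (λ gt → ¬u (_ , c , lt , gt))) m<
    -- Within one class, the witness of the smaller element also serves the larger one and gives it
    -- a sum above m + 1, so the larger one stays upper.
    impossible : ∀ {i i′ j} → cls i′ ≡ cls i → cls i ≡ cls j → b i′ ℕ.< b i → b i ℕ.+ b i′ ≡ suc m →
                 ¬ Upper (suc m) j → ¬ (b i ℕ.< b j)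
    impossible {i} {i′} {j} ci cij lti e ¬u lt = ¬u (i′ , ≡.trans ci cij , ℕ.<-trans lti lt ,
      subst (ℕ._< b j ℕ.+ b i′) e (ℕ.+-monoˡ-< (b i′) lt))
    unique : ∀ i j → Upper m i → ¬ Upper (suc m) i → Upper m j → ¬ Upper (suc m) j → i ≡ j
    unique i j (i′ , ci , lti , mi) ¬ui (j′ , cj , ltj , mj) ¬uj = b-inj (ℕ.≤-antisym
      (ℕ.≮⇒≥ (impossible cj (≡.sym cij) ltj ej ¬ui)) (ℕ.≮⇒≥ (impossible ci cij lti ei ¬uj)))
      where
      ei = tight ci lti mi ¬ui
      ej = tight cj ltj mj ¬uj
      cij = halving i i′ j j′ (≡.sym ci) (≡.sym cj) (≡.trans ei (≡.sym ej))

  -- This is 4 (b j - c), as 4 c = 2 m + 1. It is odd and therefore never zero.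
  weight : ℕ → Fin N → ℤ.ℤ
  weight m j = (ℤ.+ 2 ℤ.* (ℤ.+ b j ℤ.+ ℤ.+ b j)) ℤ.- (ℤ.+ 2 ℤ.* ℤ.+ m ℤ.+ ℤ.+ 1)

  key : ℕ → Fin N → ℕ
  key m j = ℤ.∣ weight m j ∣

  above-weight : ∀ {m j} x → suc m ℕ.+ x ≡ b j ℕ.+ b j → weight m j ≡ ℤ.+ suc (x ℕ.+ x)
  above-weight {m} {j} x e = ≡.trans
    (cong (λ z → (ℤ.+ 2 ℤ.* ℤ.+ z) ℤ.- (ℤ.+ 2 ℤ.* ℤ.+ m ℤ.+ ℤ.+ 1)) (≡.sym e)) (identity (ℤ.+ m) (ℤ.+ x))
    where
    identity : ∀ m x → (ℤ.+ 2 ℤ.* (ℤ.+ 1 ℤ.+ (m ℤ.+ x))) ℤ.- (ℤ.+ 2 ℤ.* m ℤ.+ ℤ.+ 1) ≡ ℤ.+ 1 ℤ.+ (x ℤ.+ x)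
    identity = ℤ-Solver.solve-∀

  below-weight : ∀ {m j} x → b j ℕ.+ b j ℕ.+ x ≡ m → weight m j ≡ ℤ.-[1+ x ℕ.+ x ]
  below-weight {j = j} x ≡.refl = identity (ℤ.+ (b j ℕ.+ b j)) (ℤ.+ x)
    where
    identity : ∀ s x → (ℤ.+ 2 ℤ.* s) ℤ.- (ℤ.+ 2 ℤ.* (s ℤ.+ x) ℤ.+ ℤ.+ 1) ≡ ℤ.- (ℤ.+ 1 ℤ.+ (x ℤ.+ x))
    identity = ℤ-Solver.solve-∀

  -- The parameter x makes the weight 2 x + 1 above c and -(2 x + 1) below it.
  data Side (m : ℕ) (j : Fin N) : Set where
    above : ∀ x → suc m ℕ.+ x ≡ b j ℕ.+ b j → Side m j
    below : ∀ x → b j ℕ.+ b j ℕ.+ x ≡ m → Side m j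

  side : ∀ m j → Side m j
  side m j with m ℕ.<? b j ℕ.+ b j
  ... | yes lt with x , e ← ℕ.m≤n⇒∃[o]m+o≡n lt = above x e
  ... | no ¬lt with x , e ← ℕ.m≤n⇒∃[o]m+o≡n (ℕ.≮⇒≥ ¬lt) = below x e

  key-above : ∀ {m j} x → suc m ℕ.+ x ≡ b j ℕ.+ b j → key m j ≡ suc (x ℕ.+ x)
  key-above {m} {j} x e = cong ℤ.∣_∣ (above-weight {m} {j} x e)

  key-below : ∀ {m j} x → b j ℕ.+ b j ℕ.+ x ≡ m → key m j ≡ suc (x ℕ.+ x)
  key-below {m} {j} x e = cong ℤ.∣_∣ (below-weight {m} {j} x e)

  private
    parity : ∀ a c x y → a ℕ.+ a ≡ suc ((c ℕ.+ c) ℕ.+ y) ℕ.+ x → x ≢ y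
    parity a c x .x h ≡.refl = ℕ.even≢odd a (c ℕ.+ x) (≡.trans (cong (a ℕ.+_) (ℕ.+-identityʳ a))
      (≡.trans h (rearrange c x)))
      where
      rearrange : ∀ c x → suc ((c ℕ.+ c) ℕ.+ x) ℕ.+ x ≡ suc (2 ℕ.* (c ℕ.+ x))
      rearrange = ℕ-Solver.solve-∀

  -- On one side of c the key determines `b`. Equal keys on opposite sides would make 2 (b i + b j)
  -- equal to the odd number 2 m + 1, the contradiction in `parity`.
  key-injective : ∀ m → Injective _≡_ _≡_ (key m)
  key-injective m {i} {j} e with side m i | side m j
  ... | above x p | above y q = b-inj (double-injective (≡.trans (≡.sym p) (≡.trans (cong (suc m ℕ.+_)
    (double-injective (ℕ.suc-injective (≡.trans (≡.sym (key-above x p)) (≡.trans e (key-above y q)))))) q)))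
  ... | below x p | below y q = b-inj (double-injective (ℕ.+-cancelʳ-≡ y _ _ (≡.trans (cong ((b i ℕ.+ b i) ℕ.+_)
    (≡.sym (double-injective (ℕ.suc-injective (≡.trans (≡.sym (key-below x p)) (≡.trans e (key-below y q)))))))
    (≡.trans p (≡.sym q)))))
  ... | above x p | below y q = ⊥-elim (parity (b i) (b j) x y
      (≡.trans (≡.sym p) (cong (λ z → suc z ℕ.+ x) (≡.sym q)))
      (double-injective (ℕ.suc-injective (≡.trans (≡.sym (key-above x p)) (≡.trans e (key-below y q))))))
  ... | below x p | above y q = ⊥-elim (parity (b j) (b i) y x
      (≡.trans (≡.sym q) (cong (λ z → suc z ℕ.+ y) (≡.sym p)))
      (double-injective (ℕ.suc-injective (≡.trans (≡.sym (key-above y q)) (≡.trans (≡.sym e) (key-below x p))))))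

  weight-mono : ∀ m {i j} → b i ℕ.≤ b j → weight m i ℤ.≤ weight m j
  weight-mono m le = ℤ.+-monoˡ-≤ (ℤ.- (ℤ.+ 2 ℤ.* ℤ.+ m ℤ.+ ℤ.+ 1))
    (ℤ.*-monoˡ-≤-nonNeg (ℤ.+ 2) (ℤ.+≤+ (ℕ.+-mono-≤ le le)))

  -- The two weights add up to 4 (b j + b j′ - m) - 2, which is negative, and the weight of j is the
  -- larger one.
  key-≤-low : ∀ m {j j′} → b j′ ℕ.≤ b j → b j ℕ.+ b j′ ℕ.≤ m → key m j ℕ.≤ key m j′
  key-≤-low m {j} {j′} le ≤m = abs-≤ (weight m j) (weight m j′)
    (subst (ℤ._≤ ℤ.0ℤ) (≡.sym (identity (ℤ.+ b j) (ℤ.+ b j′) (ℤ.+ m)))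
      (ℤ.+-mono-≤ {y = ℤ.0ℤ} (ℤ.i≤j⇒i-j≤0 (ℤ.*-monoˡ-≤-nonNeg (ℤ.+ 4) (ℤ.+≤+ ≤m))) (ℤ.-≤+ {1} {0})))
    (weight-mono m le)
    where
    identity : ∀ x y m → ((ℤ.+ 2 ℤ.* (x ℤ.+ x)) ℤ.- (ℤ.+ 2 ℤ.* m ℤ.+ ℤ.+ 1)) ℤ.+
      ((ℤ.+ 2 ℤ.* (y ℤ.+ y)) ℤ.- (ℤ.+ 2 ℤ.* m ℤ.+ ℤ.+ 1)) ≡ (ℤ.+ 4 ℤ.* (x ℤ.+ y) ℤ.- ℤ.+ 4 ℤ.* m) ℤ.+ ℤ.-[1+ 1 ]
    identity = ℤ-Solver.solve-∀

  -- The two weights add up to 4 (b j + b j′ - (m + 1)) + 2, which is positive, and the weight of j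
  -- is the smaller one.
  key-≤-high : ∀ m {j j′} → b j ℕ.≤ b j′ → m ℕ.< b j ℕ.+ b j′ → key m j ℕ.≤ key m j′
  key-≤-high m {j} {j′} le m< = abs-≤′ (weight m j) (weight m j′)
    (subst (ℤ.0ℤ ℤ.≤_) (≡.sym (identity (ℤ.+ b j) (ℤ.+ b j′) (ℤ.+ m)))
      (ℤ.+-mono-≤ (ℤ.i≤j⇒0≤j-i (ℤ.*-monoˡ-≤-nonNeg (ℤ.+ 4) {ℤ.+ suc m} (ℤ.+≤+ m<))) (ℤ.+≤+ (ℕ.z≤n {2}))))
    (weight-mono m le)
    where
    identity : ∀ x y m → ((ℤ.+ 2 ℤ.* (x ℤ.+ x)) ℤ.- (ℤ.+ 2 ℤ.* m ℤ.+ ℤ.+ 1)) ℤ.+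
      ((ℤ.+ 2 ℤ.* (y ℤ.+ y)) ℤ.- (ℤ.+ 2 ℤ.* m ℤ.+ ℤ.+ 1)) ≡
      (ℤ.+ 4 ℤ.* (x ℤ.+ y) ℤ.- ℤ.+ 4 ℤ.* (ℤ.+ 1 ℤ.+ m)) ℤ.+ ℤ.+ 2
    identity = ℤ-Solver.solve-∀

  middle-closest : ∀ m {j j′} → Middle m j → cls j′ ≡ cls j → key m j ℕ.≤ key m j′
  middle-closest m {j} {j′} (¬u , ¬l) c with ℕ.<-cmp (b j′) (b j)
  ... | tri≈ _ e _  = ℕ.≤-reflexive (cong (key m) (b-inj (≡.sym e)))
  ... | tri< lt _ _ = key-≤-low m (ℕ.<⇒≤ lt) (ℕ.≮⇒≥ (λ m< → ¬u (j′ , c , lt , m<)))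
  ... | tri> _ _ gt = key-≤-high m (ℕ.<⇒≤ gt) (ℕ.≰⇒> (λ ≤m → ¬l (j′ , c , gt , ≤m)))

  middle-unique : ∀ m {i j} → Middle m i → Middle m j → cls i ≡ cls j → i ≡ j
  middle-unique m Mi Mj c = key-injective m
    (ℕ.≤-antisym (middle-closest m Mi (≡.sym c)) (middle-closest m Mj c))

  closest : ∀ m a → ∃ λ j → Middle m j × cls j ≡ a
  closest m a with j₀ , c₀ ← occupied a = search (key m j₀) j₀ ℕ.≤-refl c₀
    where
    -- Each replacement lowers the key, so the initial key is enough fuel. At a minimum, a witness
    -- of `Upper` or `Lower` would have a smaller key still.
    search : ∀ fuel j → key m j ℕ.≤ fuel → cls j ≡ a → ∃ λ j → Middle m j × cls j ≡ a
    search fuel j le c with Fin.any? (λ j′ → (cls j′ Fin.≟ a) ×-dec (key m j′ ℕ.<? key m j))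
    search zero       j le c | yes (j′ , _ , lt) = contradiction (ℕ.<-≤-trans lt le) (λ ())
    search (suc fuel) j le c | yes (j′ , c′ , lt) = search fuel j′ (ℕ.s≤s⁻¹ (ℕ.≤-trans lt le)) c′
    search fuel       j le c | no minimal = j , ((¬u , ¬l) , c)
      where
      ¬u : ¬ Upper m j
      ¬u (j′ , c′ , lt , m<) = minimal (j′ , ≡.trans c′ c , ℕ.≤∧≢⇒<
        (key-≤-high m (ℕ.<⇒≤ lt) (subst (m ℕ.<_) (ℕ.+-comm (b j) (b j′)) m<))
        (λ e → ℕ.<⇒≢ lt (cong b (key-injective m e))))
      ¬l : ¬ Lower m j
      ¬l (j′ , c′ , lt , ≤m) = minimal (j′ , ≡.trans c′ c , ℕ.≤∧≢⇒<
        (key-≤-low m (ℕ.<⇒≤ lt) (subst (ℕ._≤ m) (ℕ.+-comm (b j) (b j′)) ≤m))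
        (λ e → ℕ.<⇒≢ lt (cong b (≡.sym (key-injective m e)))))

  -- Bounds by r are enough: they let ranks serve as indices of the variables, and the injectivity
  -- of `τ*` makes every label occur.
  balanced : ∃ λ m → count (upper? m) ℕ.≤ r × count (lower? m) ℕ.≤ r
  balanced with B , bound ← bounded b
           with descend (λ m → count (upper? m)) r upper-step (B ℕ.+ B)
             (ℕ.≤-trans (ℕ.≤-reflexive (count-none (upper? (B ℕ.+ B)) (λ j (j′ , _ , _ , lt) →
               ℕ.<⇒≱ lt (ℕ.+-mono-≤ (bound j) (bound j′))))) ℕ.z≤n)
  -- At m = 0 nothing is lower, since the larger element of a pair makes the sum positive.
  ... | .0 , up , inj₁ ≡.refl = 0 , up , ℕ.≤-trans (ℕ.≤-reflexive (count-none (lower? 0)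
        (λ j (j′ , _ , lt , ≤0) → ℕ.<⇒≱ (ℕ.≤-trans lt (ℕ.m≤n+m (b j′) (b j))) (ℕ.≤-trans ≤0 ℕ.z≤n)))) ℕ.z≤n
  -- At least r upper elements and at least t middle ones, one per class, leave at most r of the t +
  -- 2 r elements.
  ... | m , up , inj₂ r≤up = m , up , ℕ.+-cancelˡ-≤ (r ℕ.+ t) _ _ (ℕ.≤-trans
        (ℕ.≤-reflexive (shuffle₁ r t _)) (ℕ.≤-trans
          (ℕ.+-mono-≤ (ℕ.+-monoˡ-≤ (count (lower? m)) r≤up)
            (count-lower-bound (middle? m) (λ a → proj₁ (closest m a))
              (λ {x} {y} e → ≡.trans (≡.sym (proj₂ (proj₂ (closest m x))))
                (≡.trans (cong cls e) (proj₂ (proj₂ (closest m y)))))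
              (λ a → proj₁ (proj₂ (closest m a)))))
          (ℕ.≤-reflexive (≡.trans (count-trichotomy (upper? m) (lower? m) (middle? m)
            (λ j u l → ℕ.<⇒≱ (upper⇒ u) (lower⇒ l)) (λ j → mk⇔ id id)) (≡.trans size (shuffle₂ r t))))))
    where
    shuffle₁ : ∀ r t l → (r ℕ.+ t) ℕ.+ l ≡ (r ℕ.+ l) ℕ.+ t
    shuffle₁ = ℕ-Solver.solve-∀
    shuffle₂ : ∀ r t → t ℕ.+ r ℕ.* 2 ≡ (r ℕ.+ t) ℕ.+ r
    shuffle₂ = ℕ-Solver.solve-∀

-- Integer sums: reindexing along a permutation, and equality in termwise bounds

∑-↭ : ∀ {A : Set} {xs ys : List A} (f : A → ℤ.ℤ) → xs ↭ ys → ℤ-Sums.∑ xs f ≡ ℤ-Sums.∑ ys f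
∑-↭ f ↭.refl         = ≡.refl
∑-↭ f (↭.prep x p)   = cong (λ z → f x ℤ.+ z) (∑-↭ f p)
∑-↭ f (↭.swap x y p) = ≡.trans (cong (λ z → f x ℤ.+ (f y ℤ.+ z)) (∑-↭ f p)) (exchange (f x) (f y) _)
  where
  exchange : ∀ x y z → x ℤ.+ (y ℤ.+ z) ≡ y ℤ.+ (x ℤ.+ z)
  exchange = ℤ-Solver.solve-∀
∑-↭ f (↭.trans p q)  = ≡.trans (∑-↭ f p) (∑-↭ f q)

∑-≤ : ∀ {A : Set} (xs : List A) {f g : A → ℤ.ℤ} → (∀ x → f x ℤ.≤ g x) → ℤ-Sums.∑ xs f ℤ.≤ ℤ-Sums.∑ xs g
∑-≤ []       h = ℤ.≤-refl
∑-≤ (x ∷ xs) h = ℤ.+-mono-≤ (h x) (∑-≤ xs h)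

∑-≤-tight : ∀ {A : Set} {xs : List A} {f g : A → ℤ.ℤ} → (∀ x → f x ℤ.≤ g x) →
            ℤ-Sums.∑ xs f ≡ ℤ-Sums.∑ xs g → ∀ {x} → x ∈ xs → f x ≡ g x
∑-≤-tight {xs = x ∷ xs} {f} {g} h e (here ≡.refl) = ℤ.≤-antisym (h x) (ℤ.≮⇒≥ (λ lt →
  ℤ.<-irrefl e (ℤ.+-mono-<-≤ lt (∑-≤ xs h))))
∑-≤-tight {xs = x ∷ xs} {f} {g} h e (there p) = ∑-≤-tight h (ℤ.≤-antisym (∑-≤ xs h) (ℤ.≮⇒≥ (λ lt →
  ℤ.<-irrefl e (ℤ.+-mono-≤-< (h x) lt)))) p

module Inverse {N} (τ : Fin N → Fin N) (τ-inj : Injective _≡_ _≡_ τ) where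

  open ℤ-Sums using (∑; ∑-cong; ∑-tabulate)

  inv : Fin N → Fin N
  inv s = proj₁ (injective⇒surjective τ-inj s)

  τ-inv : ∀ s → τ (inv s) ≡ s
  τ-inv s = proj₂ (injective⇒surjective τ-inj s)

  inv-τ : ∀ j → inv (τ j) ≡ j
  inv-τ j = τ-inj (τ-inv (τ j))

  inv-injective : Injective _≡_ _≡_ inv
  inv-injective {x} {y} e = ≡.trans (≡.sym (τ-inv x)) (≡.trans (cong τ e) (τ-inv y))

  ∑-reindex : ∀ (g : Fin N → Fin N → ℤ.ℤ) →
              ∑ (allFin N) (λ j → g (τ j) j) ≡ ∑ (allFin N) (λ s → g s (inv s))
  ∑-reindex g = ≡.trans (≡.sym (∑-↭ _ (tabulate-↭ inv-injective id))) (≡.trans (∑-tabulate N inv _)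
    (∑-cong (allFin N) (λ s → cong (λ z → g z (inv s)) (τ-inv s))))

-- The extremal assignment and its uniqueness

module Assignment {t r N : ℕ} (b : Fin N → ℕ) (b-inj : Injective _≡_ _≡_ b) (cls : Fin N → Fin t)
  (halving : ∀ i i′ j j′ → cls i ≡ cls i′ → cls j ≡ cls j′ → b i ℕ.+ b i′ ≡ b j ℕ.+ b j′ → cls i ≡ cls j)
  (occupied : ∀ a → ∃ λ j → cls j ≡ a) (size : N ≡ t ℕ.+ r ℕ.* 2)
  (lab : Fin N → Label t r) (unlab : Label t r → Fin N)
  (lab-unlab : ∀ l → lab (unlab l) ≡ l) (unlab-lab : ∀ s → unlab (lab s) ≡ s)
  (m : ℕ) (up≤r : count (Selection.upper? {t} {r} b b-inj cls halving occupied size m) ℕ.≤ r)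
  (low≤r : count (Selection.lower? {t} {r} b b-inj cls halving occupied size m) ℕ.≤ r) where

  open Selection {t} {r} b b-inj cls halving occupied size
  open Signs {t} {r}
  open ℤ-Sums using (∑; ∑-cong; ∑-+; ∑-swap; *-distribˡ-∑; *-distribʳ-∑;
    ∑-allFin-single; when-true; when-false)

  module Up = Rank (upper? m) (key m) (key-injective m)
  module Low = Rank (lower? m) (key m) (key-injective m)

  -- The variables z k go to the upper elements, and the inverses of the z k to the lower
  -- ones, in order of decreasing distance.

  data Assigned (j : Fin N) : Label t r → Set where
    inUpper  : Upper m j → ∀ k → toℕ k ≡ Up.rank j → Assigned j (pos k)
    inLower  : Lower m j → ∀ k → toℕ k ≡ Low.rank j → Assigned j (neg k)
    inMiddle : Middle m j → ∀ a → cls j ≡ a → Assigned j (res a)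

  assign : ∀ j → ∃ (Assigned j)
  assign j with upper? m j | lower? m j
  ... | yes u | _     = _ , inUpper u (Fin.fromℕ< lt) (Fin.toℕ-fromℕ< lt)
    where lt = ℕ.<-≤-trans (Up.rank<count u) up≤r
  ... | no ¬u | yes l = _ , inLower l (Fin.fromℕ< lt) (Fin.toℕ-fromℕ< lt)
    where lt = ℕ.<-≤-trans (Low.rank<count l) low≤r
  ... | no ¬u | no ¬l = _ , inMiddle (¬u , ¬l) (cls j) ≡.refl

  assigned-unique : ∀ {i j l} → Assigned i l → Assigned j l → i ≡ j
  assigned-unique (inUpper u k e) (inUpper u′ .k e′) = Up.rank-injective u u′ (≡.trans (≡.sym e) e′)
  assigned-unique (inLower u k e) (inLower u′ .k e′) = Low.rank-injective u u′ (≡.trans (≡.sym e) e′)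
  assigned-unique (inMiddle u a e) (inMiddle u′ .a e′) = middle-unique m u u′ (≡.trans e (≡.sym e′))

  τ* : Fin N → Fin N
  τ* j = unlab (proj₁ (assign j))

  assigned : ∀ j → Assigned j (lab (τ* j))
  assigned j = subst (Assigned j) (≡.sym (lab-unlab _)) (proj₂ (assign j))

  τ*-injective : Injective _≡_ _≡_ τ*
  τ*-injective {i} {j} e = assigned-unique (assigned i) (subst (Assigned j ∘ lab) (≡.sym e) (assigned j))

  τ*-compatible : ∀ j a → lab (τ* j) ≡ res a → cls j ≡ a
  τ*-compatible j a e = middle-class (subst (Assigned j) e (assigned j))
    where
    middle-class : ∀ {j a} → Assigned j (res a) → cls j ≡ a
    middle-class (inMiddle _ _ e) = e

  module P* = Inverse τ* τ*-injective

  assigned* : ∀ l → Assigned (P*.inv (unlab l)) l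
  assigned* l = subst (Assigned _) (≡.trans (cong lab (P*.τ-inv _)) (lab-unlab l)) (assigned _)

  -- The exponent of z k in the monomial of τ, as `exponent-energy` confirms.
  energy : (Fin N → Fin N) → Fin r → ℤ.ℤ
  energy τ k = ∑ (allFin N) (λ j → sign k (lab (τ j)) ℤ.* ℤ.+ b j)

  -- The deficit is nonnegative, and its sum over all elements depends only on the
  -- energy; the optimal assignment has no deficit at a nonresidue label.

  deficit : Label t r → Fin N → ℤ.ℤ
  deficit l j = ℤ.+ key m j ℤ.- total l ℤ.* weight m j

  deficit-res : ∀ a j → deficit (res a) j ≡ ℤ.+ key m j
  deficit-res a j = ≡.trans (cong (λ z → ℤ.+ key m j ℤ.- z ℤ.* weight m j) (total-res a))
    (≡.trans (cong (λ z → ℤ.+ key m j ℤ.- z) (ℤ.*-zeroˡ (weight m j))) (ℤ.+-identityʳ _))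

  deficit-pos : ∀ k j → deficit (pos k) j ≡ ℤ.+ key m j ℤ.- weight m j
  deficit-pos k j = ≡.trans (cong (λ z → ℤ.+ key m j ℤ.- z ℤ.* weight m j) (total-pos k))
    (cong (λ z → ℤ.+ key m j ℤ.- z) (ℤ.*-identityˡ (weight m j)))

  deficit-neg : ∀ k j → deficit (neg k) j ≡ ℤ.+ key m j ℤ.+ weight m j
  deficit-neg k j = ≡.trans (cong (λ z → ℤ.+ key m j ℤ.- z ℤ.* weight m j) (total-neg k))
    (cong (λ z → ℤ.+ key m j ℤ.+ z) (≡.trans (cong ℤ.-_ (ℤ.-1*i≡-i (weight m j))) (ℤ.neg-involutive _)))

  key-weight-above : ∀ {j} → m ℕ.< b j ℕ.+ b j → ℤ.+ key m j ≡ weight m j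
  key-weight-above {j} lt with side m j
  ... | above x e = ≡.trans (cong ℤ.+_ (key-above x e)) (≡.sym (above-weight {m} {j} x e))
  ... | below x e = contradiction (ℕ.≤-trans (ℕ.m≤m+n _ x) (ℕ.≤-reflexive e)) (ℕ.<⇒≱ lt)

  key-weight-below : ∀ {j} → b j ℕ.+ b j ℕ.≤ m → ℤ.+ key m j ≡ ℤ.- weight m j
  key-weight-below {j} le with side m j
  ... | below x e = ≡.trans (cong ℤ.+_ (key-below x e)) (cong ℤ.-_ (≡.sym (below-weight {m} {j} x e)))
  ... | above x e = contradiction le (ℕ.<⇒≱ (ℕ.≤-trans (ℕ.m≤m+n _ x) (ℕ.≤-reflexive e)))

  key>0 : ∀ j → 0 ℕ.< key m j
  key>0 j with side m j
  ... | above x e = subst (0 ℕ.<_) (≡.sym (key-above x e)) ℕ.z<s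
  ... | below x e = subst (0 ℕ.<_) (≡.sym (key-below x e)) ℕ.z<s

  private
    doubled : ∀ {i w} → ℤ.+ i ≡ w → ℤ.+ i ℤ.+ w ≡ ℤ.+ (i ℕ.+ i)
    doubled ≡.refl = ≡.refl

    doubled′ : ∀ {i w} → ℤ.+ i ≡ ℤ.- w → ℤ.+ i ℤ.- w ≡ ℤ.+ (i ℕ.+ i)
    doubled′ {i} e = cong (λ z → ℤ.+ i ℤ.+ z) (≡.sym e)

    cancelled : ∀ {i w} → ℤ.+ i ≡ w → ℤ.+ i ℤ.- w ≡ ℤ.0ℤ
    cancelled {i} ≡.refl = ℤ.+-inverseʳ (ℤ.+ i)

    cancelled′ : ∀ {i w} → ℤ.+ i ≡ ℤ.- w → ℤ.+ i ℤ.+ w ≡ ℤ.0ℤ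
    cancelled′ {w = w} e = ≡.trans (cong (ℤ._+ w) e) (ℤ.+-inverseˡ w)

    double≢0 : ∀ j → ℤ.+ (key m j ℕ.+ key m j) ≢ ℤ.0ℤ
    double≢0 j e = ℕ.<⇒≢ (ℕ.<-≤-trans (key>0 j) (ℕ.m≤m+n _ _)) (≡.sym (ℤ.+-injective e))

  deficit-≥0 : ∀ l j → ℤ.0ℤ ℤ.≤ deficit l j
  deficit-≥0 (res a) j = subst (ℤ.0ℤ ℤ.≤_) (≡.sym (deficit-res a j)) (ℤ.+≤+ ℕ.z≤n)
  deficit-≥0 (pos k) j with m ℕ.<? b j ℕ.+ b j
  ... | yes lt = ℤ.≤-reflexive (≡.sym (≡.trans (deficit-pos k j) (cancelled (key-weight-above lt))))
  ... | no ¬lt = subst (ℤ.0ℤ ℤ.≤_) (≡.sym (≡.trans (deficit-pos k j)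
    (doubled′ (key-weight-below (ℕ.≮⇒≥ ¬lt))))) (ℤ.+≤+ ℕ.z≤n)
  deficit-≥0 (neg k) j with m ℕ.<? b j ℕ.+ b j
  ... | yes lt = subst (ℤ.0ℤ ℤ.≤_) (≡.sym (≡.trans (deficit-neg k j)
    (doubled (key-weight-above lt)))) (ℤ.+≤+ ℕ.z≤n)
  ... | no ¬lt = ℤ.≤-reflexive (≡.sym (≡.trans (deficit-neg k j) (cancelled′ (key-weight-below (ℕ.≮⇒≥ ¬lt)))))

  -- On the wrong side of c the deficit is twice the key, and keys are positive.
  pos-above : ∀ {k j} → deficit (pos k) j ≡ ℤ.0ℤ → m ℕ.< b j ℕ.+ b j
  pos-above {k} {j} e with m ℕ.<? b j ℕ.+ b j
  ... | yes lt = lt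
  ... | no ¬lt = contradiction (≡.trans (≡.sym (≡.trans (deficit-pos k j)
    (doubled′ (key-weight-below (ℕ.≮⇒≥ ¬lt))))) e) (double≢0 j)

  neg-below : ∀ {k j} → deficit (neg k) j ≡ ℤ.0ℤ → b j ℕ.+ b j ℕ.≤ m
  neg-below {k} {j} e with m ℕ.<? b j ℕ.+ b j
  ... | no ¬lt = ℕ.≮⇒≥ ¬lt
  ... | yes lt = contradiction (≡.trans (≡.sym (≡.trans (deficit-neg k j)
    (doubled (key-weight-above lt)))) e) (double≢0 j)

  assigned-pos : ∀ {k j} → Assigned j (pos k) → deficit (pos k) j ≡ ℤ.0ℤ
  assigned-pos (inUpper u k _) = ≡.trans (deficit-pos k _) (cancelled (key-weight-above (upper⇒ u)))

  assigned-neg : ∀ {k j} → Assigned j (neg k) → deficit (neg k) j ≡ ℤ.0ℤ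
  assigned-neg (inLower u k _) = ≡.trans (deficit-neg k _) (cancelled′ (key-weight-below (lower⇒ u)))

  above-mono : ∀ {i j} → m ℕ.< b i ℕ.+ b i → m ℕ.< b j ℕ.+ b j → key m i ℕ.≤ key m j → b i ℕ.≤ b j
  above-mono {i} {j} lti ltj le = ℕ.≮⇒≥ (λ lt → ℕ.<⇒≱ (ℕ.≤∧≢⇒<
    (key-≤-high m (ℕ.<⇒≤ lt) (ℕ.<-≤-trans ltj (ℕ.+-monoʳ-≤ (b j) (ℕ.<⇒≤ lt))))
    (λ e → ℕ.<⇒≢ lt (cong b (key-injective m e)))) le)

  below-mono : ∀ {i j} → b i ℕ.+ b i ℕ.≤ m → b j ℕ.+ b j ℕ.≤ m → key m i ℕ.≤ key m j → b j ℕ.≤ b i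
  below-mono {i} {j} lei lej le = ℕ.≮⇒≥ (λ lt → ℕ.<⇒≱ (ℕ.≤∧≢⇒<
    (key-≤-low m (ℕ.<⇒≤ lt) (ℕ.≤-trans (ℕ.+-monoʳ-≤ (b j) (ℕ.<⇒≤ lt)) lej))
    (λ e → ℕ.<⇒≢ lt (cong b (≡.sym (key-injective m e))))) le)

  energy-inverse : ∀ τ (τ-inj : Injective _≡_ _≡_ τ) k → let open Inverse τ τ-inj in
    energy τ k ≡ ℤ.+ b (inv (unlab (pos k))) ℤ.- ℤ.+ b (inv (unlab (neg k)))
  energy-inverse τ τ-inj k = ≡.trans (∑-reindex (λ s j → sign k (lab s) ℤ.* ℤ.+ b j)) (≡.trans
    (∑-cong (allFin N) (λ s → split (δ⁺ k (lab s)) (δ⁻ k (lab s)) (ℤ.+ b (inv s))))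
    (≡.trans (∑-+ (allFin N) _ _) (cong₂ ℤ._+_
      (≡.trans (∑-allFin-single N (unlab (pos k)) _ (λ s s≢ → ≡.trans
          (cong (ℤ._* ℤ.+ b (inv s)) (δ⁺-off (lab s) (λ e → s≢ (≡.trans (≡.sym (unlab-lab s)) (cong unlab e)))))
          (ℤ.*-zeroˡ (ℤ.+ b (inv s)))))
        (≡.trans (cong (ℤ._* ℤ.+ b _) (≡.trans (cong (δ⁺ k) (lab-unlab (pos k))) (when-true (k Fin.≟ k) ≡.refl)))
          (ℤ.*-identityˡ _)))
      (≡.trans (∑-allFin-single N (unlab (neg k)) _ (λ s s≢ → ≡.trans
          (cong (λ z → ℤ.- (z ℤ.* ℤ.+ b (inv s))) (δ⁻-off (lab s) (λ e → s≢ (≡.trans (≡.sym (unlab-lab s)) (cong unlab e)))))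
          (cong ℤ.-_ (ℤ.*-zeroˡ (ℤ.+ b (inv s))))))
        (cong ℤ.-_ (≡.trans (cong (ℤ._* ℤ.+ b _) (≡.trans (cong (δ⁻ k) (lab-unlab (neg k))) (when-true (k Fin.≟ k) ≡.refl)))
          (ℤ.*-identityˡ _)))))))
    where
    open Inverse τ τ-inj
    split : ∀ p q x → (p ℤ.- q) ℤ.* x ≡ p ℤ.* x ℤ.+ ℤ.- (q ℤ.* x)
    split = ℤ-Solver.solve-∀
    δ⁺-off : ∀ l → l ≢ pos k → δ⁺ k l ≡ ℤ.0ℤ
    δ⁺-off (pos k′) l≢ = when-false (k′ Fin.≟ k) (l≢ ∘ cong pos)
    δ⁺-off (neg _)  l≢ = ≡.refl
    δ⁺-off (res _)  l≢ = ≡.refl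
    δ⁻-off : ∀ l → l ≢ neg k → δ⁻ k l ≡ ℤ.0ℤ
    δ⁻-off (neg k′) l≢ = when-false (k′ Fin.≟ k) (l≢ ∘ cong neg)
    δ⁻-off (pos _)  l≢ = ≡.refl
    δ⁻-off (res _)  l≢ = ≡.refl

  -- Substitute 4 b j - (2 m + 1) for the weight. The keys are summed over all elements and the
  -- totals over all labels, so τ matters only through its energies.
  ∑-deficit : ∀ τ → Injective _≡_ _≡_ τ → ∑ (allFin N) (λ j → deficit (lab (τ j)) j) ≡
    ∑ (allFin N) (λ j → ℤ.+ key m j) ℤ.+ (ℤ.- ℤ.+ 4 ℤ.* ∑ (allFin r) (energy τ) ℤ.+
      (ℤ.+ 2 ℤ.* ℤ.+ m ℤ.+ ℤ.+ 1) ℤ.* ∑ (allFin N) (λ s → total (lab s)))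
  ∑-deficit τ τ-inj = ≡.trans (∑-cong (allFin N) (λ j → expand (ℤ.+ key m j) (total (lab (τ j))) (ℤ.+ b j) (ℤ.+ m)))
    (≡.trans (∑-+ (allFin N) _ _) (cong (λ z → ∑ (allFin N) (λ j → ℤ.+ key m j) ℤ.+ z)
      (≡.trans (∑-+ (allFin N) _ _) (cong₂ ℤ._+_
        (≡.trans (≡.sym (*-distribˡ-∑ (ℤ.- ℤ.+ 4) (allFin N) _)) (cong (ℤ.- ℤ.+ 4 ℤ.*_)
          (≡.trans (∑-cong (allFin N) (λ j → *-distribʳ-∑ (ℤ.+ b j) (allFin r) _)) (∑-swap (allFin N) (allFin r) _))))
        (≡.trans (≡.sym (*-distribˡ-∑ (ℤ.+ 2 ℤ.* ℤ.+ m ℤ.+ ℤ.+ 1) (allFin N) _))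
          (cong ((ℤ.+ 2 ℤ.* ℤ.+ m ℤ.+ ℤ.+ 1) ℤ.*_) (∑-reindex (λ s j → total (lab s)))))))))
    where
    open Inverse τ τ-inj
    expand : ∀ κ T B M → κ ℤ.- T ℤ.* ((ℤ.+ 2 ℤ.* (B ℤ.+ B)) ℤ.- (ℤ.+ 2 ℤ.* M ℤ.+ ℤ.+ 1)) ≡
      κ ℤ.+ (ℤ.- ℤ.+ 4 ℤ.* (T ℤ.* B) ℤ.+ (ℤ.+ 2 ℤ.* M ℤ.+ ℤ.+ 1) ℤ.* T)
    expand = ℤ-Solver.solve-∀

  module Uniqueness (τ : Fin N → Fin N) (τ-inj : Injective _≡_ _≡_ τ)
    (compatible : ∀ j a → lab (τ j) ≡ res a → cls j ≡ a)
    (same-energy : ∀ k → energy τ k ≡ energy τ* k) where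

    module P = Inverse τ τ-inj

    i i* : Label t r → Fin N
    i l = P.inv (unlab l)
    i* l = P*.inv (unlab l)

    i-injective : Injective _≡_ _≡_ i
    i-injective {l} {l′} e = ≡.trans (≡.sym (lab-unlab l))
      (≡.trans (cong lab (P.inv-injective e)) (lab-unlab l′))

    compatible-inv : ∀ a → cls (i (res a)) ≡ a
    compatible-inv a = compatible (i (res a)) a (≡.trans (cong lab (P.τ-inv _)) (lab-unlab _))

    deficit-≤ : ∀ l → deficit l (i* l) ℤ.≤ deficit l (i l)
    deficit-≤ (pos k) = subst (ℤ._≤ deficit (pos k) (i (pos k))) (≡.sym (assigned-pos (assigned* (pos k))))
      (deficit-≥0 (pos k) _)
    deficit-≤ (neg k) = subst (ℤ._≤ deficit (neg k) (i (neg k))) (≡.sym (assigned-neg (assigned* (neg k))))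
      (deficit-≥0 (neg k) _)
    deficit-≤ (res a) = subst₂ ℤ._≤_ (≡.sym (deficit-res a _)) (≡.sym (deficit-res a _))
      (ℤ.+≤+ (smallest (assigned* (res a))))
      where
      smallest : ∀ {j} → Assigned j (res a) → key m j ℕ.≤ key m (i (res a))
      smallest (inMiddle M _ c) = middle-closest m M (≡.trans (compatible-inv a) (≡.sym c))

    -- Equal energies give equal sums by `∑-deficit`, which leaves no room in the termwise bounds
    -- `deficit-≤`.
    deficit-≡ : ∀ l → deficit l (i* l) ≡ deficit l (i l)
    deficit-≡ l = subst (λ z → deficit z (i* l) ≡ deficit z (i l)) (lab-unlab l)
      (∑-≤-tight {f = λ s → deficit (lab s) (P*.inv s)} {λ s → deficit (lab s) (P.inv s)}
        (λ s → subst (λ z → deficit (lab s) (P*.inv z) ℤ.≤ deficit (lab s) (P.inv z)) (unlab-lab s) (deficit-≤ (lab s)))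
        (≡.trans (≡.sym (P*.∑-reindex (λ s → deficit (lab s)))) (≡.trans (∑-deficit τ* τ*-injective)
          (≡.trans (cong (λ z → ∑ (allFin N) (λ j → ℤ.+ key m j) ℤ.+ (ℤ.- ℤ.+ 4 ℤ.* z ℤ.+
              (ℤ.+ 2 ℤ.* ℤ.+ m ℤ.+ ℤ.+ 1) ℤ.* ∑ (allFin N) (λ s → total (lab s))))
              (∑-cong (allFin r) (λ k → ≡.sym (same-energy k))))
            (≡.trans (≡.sym (∑-deficit τ τ-inj)) (P.∑-reindex (λ s → deficit (lab s)))))))
        (∈-allFin (unlab l)))

    agree-res : ∀ a → i (res a) ≡ i* (res a)
    agree-res a = key-injective m (ℤ.+-injective
      (≡.trans (≡.sym (deficit-res a _)) (≡.trans (≡.sym (deficit-≡ (res a))) (deficit-res a _))))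

    i-pos-above : ∀ k → m ℕ.< b (i (pos k)) ℕ.+ b (i (pos k))
    i-pos-above k = pos-above {k} (≡.trans (≡.sym (deficit-≡ (pos k))) (assigned-pos (assigned* (pos k))))

    i-neg-below : ∀ k → b (i (neg k)) ℕ.+ b (i (neg k)) ℕ.≤ m
    i-neg-below k = neg-below {k} (≡.trans (≡.sym (deficit-≡ (neg k))) (assigned-neg (assigned* (neg k))))

    -- The element that `τ*` gives to `res a` already has the label `res a` under τ, by `agree-res`.
    not-middle : ∀ {l a} → Assigned (i l) (res a) → l ≡ res a
    not-middle {l} {a} A = i-injective (≡.trans (assigned-unique A (assigned* (res a))) (≡.sym (agree-res a)))

    classify-pos : ∀ k {l} → Assigned (i (pos k)) l → ∃ λ k′ → l ≡ pos k′
    classify-pos k (inUpper _ k′ _)      = k′ , ≡.refl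
    classify-pos k (inLower l _ _)       = contradiction (lower⇒ l) (ℕ.<⇒≱ (i-pos-above k))
    classify-pos k A@(inMiddle M a c)    = contradiction (not-middle A) (λ ())

    classify-neg : ∀ k {l} → Assigned (i (neg k)) l → ∃ λ k′ → l ≡ neg k′
    classify-neg k (inLower _ k′ _)      = k′ , ≡.refl
    classify-neg k (inUpper u _ _)       = contradiction (i-neg-below k) (ℕ.<⇒≱ (upper⇒ u))
    classify-neg k A@(inMiddle M a c)    = contradiction (not-middle A) (λ ())

    module _ (k : Fin r) (earlier-pos : ∀ k′ → k′ Fin.< k → i (pos k′) ≡ i* (pos k′))
             (earlier-neg : ∀ k′ → k′ Fin.< k → i (neg k′) ≡ i* (neg k′)) where

      private
        -- Under `τ*` the element `i (pos k)` has some label `pos k′`. If k′ came before k,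
        -- agreement there would give two labels to one element under τ. So its rank is at least k,
        -- and it is no farther from c than the element of rank k.
        farther-pos : ∀ {k′ j} → Assigned (i (pos k)) (pos k′) → Assigned j (pos k) → b (i (pos k)) ℕ.≤ b j
        farther-pos {k′} A@(inUpper u .k′ e) (inUpper u* .k e*) = above-mono (upper⇒ u) (upper⇒ u*)
          (Up.rank≤⇒key≤ u (subst₂ ℕ._≤_ e* e (ℕ.≮⇒≥ (λ lt → Fin.<⇒≢ lt (pos-injective
            (i-injective (≡.trans (earlier-pos k′ lt) (assigned-unique (assigned* (pos k′)) A))))))))
          where
          pos-injective : ∀ {k k′} → pos {t} {r} k ≡ pos k′ → k ≡ k′
          pos-injective ≡.refl = ≡.refl

        farther-neg : ∀ {k′ j} → Assigned (i (neg k)) (neg k′) → Assigned j (neg k) → b j ℕ.≤ b (i (neg k))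
        farther-neg {k′} A@(inLower u .k′ e) (inLower u* .k e*) = below-mono (lower⇒ u) (lower⇒ u*)
          (Low.rank≤⇒key≤ u (subst₂ ℕ._≤_ e* e (ℕ.≮⇒≥ (λ lt → Fin.<⇒≢ lt (neg-injective
            (i-injective (≡.trans (earlier-neg k′ lt) (assigned-unique (assigned* (neg k′)) A))))))))
          where
          neg-injective : ∀ {k k′} → neg {t} {r} k ≡ neg k′ → k ≡ k′
          neg-injective ≡.refl = ≡.refl

        pos-≤ : b (i (pos k)) ℕ.≤ b (i* (pos k))
        pos-≤ with k′ , e ← classify-pos k (proj₂ (assign (i (pos k)))) =
          farther-pos (subst (Assigned _) e (proj₂ (assign (i (pos k))))) (assigned* (pos k))

        neg-≥ : b (i* (neg k)) ℕ.≤ b (i (neg k))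
        neg-≥ with k′ , e ← classify-neg k (proj₂ (assign (i (neg k)))) =
          farther-neg (subst (Assigned _) e (proj₂ (assign (i (neg k))))) (assigned* (neg k))

        sums : b (i (pos k)) ℕ.+ b (i* (neg k)) ≡ b (i* (pos k)) ℕ.+ b (i (neg k))
        sums = ℤ.+-injective (transfer (ℤ.+ b (i (pos k))) (ℤ.+ b (i (neg k))) (ℤ.+ b (i* (pos k))) (ℤ.+ b (i* (neg k))) (≡.trans (≡.sym (energy-inverse τ τ-inj k))
          (≡.trans (same-energy k) (energy-inverse τ* τ*-injective k))))
          where
          transfer : ∀ p n p* n* → p ℤ.- n ≡ p* ℤ.- n* → p ℤ.+ n* ≡ p* ℤ.+ n
          transfer p n p* n* e = ≡.trans (left p n n*) (≡.trans (cong (ℤ._+ (n ℤ.+ n*)) e) (right p* n n*))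
            where
            left : ∀ p n n* → p ℤ.+ n* ≡ (p ℤ.- n) ℤ.+ (n ℤ.+ n*)
            left = ℤ-Solver.solve-∀
            right : ∀ p* n n* → (p* ℤ.- n*) ℤ.+ (n ℤ.+ n*) ≡ p* ℤ.+ n
            right = ℤ-Solver.solve-∀

      -- The energy at k fixes the difference of the two elements. Compared with `τ*`, the positive
      -- one can only be smaller and the negative one only larger, so a change of either would
      -- shrink the difference.
      agree-step : i (pos k) ≡ i* (pos k) × i (neg k) ≡ i* (neg k)
      agree-step =
        b-inj (ℕ.≤-antisym pos-≤ (ℕ.≮⇒≥ (λ lt → ℕ.<⇒≢ (ℕ.+-mono-<-≤ lt neg-≥) sums))) ,
        b-inj (ℕ.≤-antisym (ℕ.≮⇒≥ (λ lt → ℕ.<⇒≢ (ℕ.+-mono-≤-< pos-≤ lt) sums)) neg-≥)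

    agree : ∀ n k → toℕ k ℕ.< n → i (pos k) ≡ i* (pos k) × i (neg k) ≡ i* (neg k)
    agree (suc n) k lt = agree-step k
      (λ k′ lt′ → proj₁ (agree n k′ (ℕ.≤-trans lt′ (ℕ.s≤s⁻¹ lt))))
      (λ k′ lt′ → proj₂ (agree n k′ (ℕ.≤-trans lt′ (ℕ.s≤s⁻¹ lt))))

    agree-all : ∀ l → i l ≡ i* l
    agree-all (res a) = agree-res a
    agree-all (pos k) = proj₁ (agree r k (Fin.toℕ<n k))
    agree-all (neg k) = proj₂ (agree r k (Fin.toℕ<n k))

    τ-unique : ∀ j → τ j ≡ τ* j
    τ-unique j = ≡.trans (≡.sym (P*.τ-inv (τ j))) (cong τ* (≡.trans
      (cong P*.inv (≡.sym (unlab-lab (τ j)))) (≡.trans (≡.sym (agree-all (lab (τ j))))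
        (≡.trans (cong P.inv (unlab-lab (τ j))) (P.inv-τ j)))))

-- Residues, exponents and the layout of the labels

module Residues (t : ℕ) .{{_ : ℕ.NonZero t}} where

  %-≡⇒∣ : ∀ a b → a % t ≡ b % t → t ∣ ℕ.∣ a - b ∣
  %-≡⇒∣ a b e = divides ℕ.∣ a / t - b / t ∣ (≡.trans (cong₂ ℕ.∣_-_∣ (m≡m%n+[m/n]*n a t)
    (≡.trans (m≡m%n+[m/n]*n b t) (cong (ℕ._+ b / t ℕ.* t) (≡.sym e))))
    (≡.trans (ℕ.∣m+n-m+o∣≡∣n-o∣ (a % t) _ _) (≡.sym (ℕ.*-distribʳ-∣-∣ t (a / t) (b / t)))))

  ∣⇒%-≡ : ∀ a b → t ∣ ℕ.∣ a - b ∣ → a % t ≡ b % t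
  ∣⇒%-≡ a b h with ℕ.≤-total a b
  ... | inj₁ a≤b = ≡.sym (shift a≤b (subst (t ∣_) (ℕ.m≤n⇒∣m-n∣≡n∸m a≤b) h))
    where
    shift : ∀ {a b} → a ℕ.≤ b → t ∣ b ℕ.∸ a → b % t ≡ a % t
    shift {a} a≤b (divides q e) = ≡.trans (cong (_% t) (≡.trans (≡.sym (ℕ.m+[n∸m]≡n a≤b)) (cong (a ℕ.+_) e)))
      ([m+kn]%n≡m%n a q t)
  ... | inj₂ b≤a with divides q e ← subst (t ∣_) (ℕ.m≤n⇒∣n-m∣≡n∸m b≤a) h =
    ≡.trans (cong (_% t) (≡.trans (≡.sym (ℕ.m+[n∸m]≡n b≤a)) (cong (b ℕ.+_) e))) ([m+kn]%n≡m%n b q t)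

  %-cong-+ : ∀ a b c → b % t ≡ c % t → (a ℕ.+ b) % t ≡ (a ℕ.+ c) % t
  %-cong-+ a b c e = ≡.trans (%-distribˡ-+ a b t)
    (≡.trans (cong (λ z → (a % t ℕ.+ z) % t) e) (≡.sym (%-distribˡ-+ a c t)))

  odd⇒coprime : ¬ (2 ∣ t) → Coprime t 2
  odd⇒coprime odd {zero}              (_ , 0∣2)   = contradiction (0∣⇒≡0 0∣2) (λ ())
  odd⇒coprime odd {suc zero}          (_ , _)     = ≡.refl
  odd⇒coprime odd {suc (suc zero)}    (2∣t , _)   = contradiction 2∣t odd
  odd⇒coprime odd {suc (suc (suc d))} (_ , d∣2)   with ∣⇒≤ d∣2
  ... | ℕ.s≤s (ℕ.s≤s ())

  -- Modulo t, 2 a ≡ a + a′ = c + c′ ≡ 2 c, and 2 may be cancelled as it is coprime to t.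
  halve : ¬ (2 ∣ t) → ∀ {a a′ c c′} → a % t ≡ a′ % t → c % t ≡ c′ % t →
          a ℕ.+ a′ ≡ c ℕ.+ c′ → a % t ≡ c % t
  halve odd {a} {a′} {c} {c′} p q e = ∣⇒%-≡ a c (coprime-divisor (odd⇒coprime odd)
    (subst (t ∣_) (≡.sym (ℕ.*-distribˡ-∣-∣ 2 a c)) (%-≡⇒∣ (2 ℕ.* a) (2 ℕ.* c) doubled)))
    where
    twice : ∀ n → 2 ℕ.* n ≡ n ℕ.+ n
    twice n = cong (n ℕ.+_) (ℕ.+-identityʳ n)
    doubled : (2 ℕ.* a) % t ≡ (2 ℕ.* c) % t
    doubled = ≡.trans (cong (_% t) (twice a)) (≡.trans (%-cong-+ a a a′ p) (≡.trans (cong (_% t) e)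
      (≡.trans (%-cong-+ c c′ c (≡.sym q)) (cong (_% t) (≡.sym (twice c))))))

  residue : ℕ → Fin t
  residue n = Fin.fromℕ< (m%n<n n t)

  toℕ-residue : ∀ n → toℕ (residue n) ≡ n % t
  toℕ-residue n = Fin.toℕ-fromℕ< (m%n<n n t)

  residue-≡ : ∀ {m n} → residue m ≡ residue n → m % t ≡ n % t
  residue-≡ {m} {n} e = ≡.trans (≡.sym (toℕ-residue m)) (≡.trans (cong toℕ e) (toℕ-residue n))

  residue-≡⁻ : ∀ {m n} → m % t ≡ n % t → residue m ≡ residue n
  residue-≡⁻ {m} {n} e = Fin.toℕ-injective (≡.trans (toℕ-residue m) (≡.trans e (≡.sym (toℕ-residue n))))

  residue-mod : ∀ n a → (residue n ≡ a) ⇔ (n ≡ toℕ a [mod t ])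
  residue-mod n a = mk⇔
    (λ e → %-≡⇒∣ n (toℕ a) (≡.trans (≡.sym (toℕ-residue n)) (≡.trans (cong toℕ e) (≡.sym (m<n⇒m%n≡m (Fin.toℕ<n a))))))
    (λ h → Fin.toℕ-injective (≡.trans (toℕ-residue n) (≡.trans (∣⇒%-≡ n (toℕ a) h) (m<n⇒m%n≡m (Fin.toℕ<n a)))))

-- For the parts of a partition this unfolds to `β`, and it is also the exponent of column j in
-- `alternant`.
exponents : ∀ {N} → Shape N → Fin N → ℕ
exponents {N} κ j = κ j ℕ.+ (N ℕ.∸ suc (toℕ j))

exponents-injective : ∀ {N} (κ : Shape N) → Decreasing κ → Injective _≡_ _≡_ (exponents κ)
exponents-injective {N} κ κ↓ {i} {j} e with Fin.<-cmp i j
... | tri≈ _ i≡j _ = i≡j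
... | tri< i<j _ _ = contradiction (≡.sym e) (ℕ.<⇒≢ (strict i<j))
  where
  strict : ∀ {i j} → i Fin.< j → exponents κ j ℕ.< exponents κ i
  strict {i} {j} lt = ℕ.+-mono-≤-< (κ↓ i j (ℕ.<⇒≤ lt)) (ℕ.∸-monoʳ-< (ℕ.s≤s lt) (Fin.toℕ<n j))
... | tri> _ _ j<i = contradiction e (ℕ.<⇒≢ (ℕ.+-mono-≤-< (κ↓ j i (ℕ.<⇒≤ j<i)) (ℕ.∸-monoʳ-< (ℕ.s≤s j<i) (Fin.toℕ<n i))))

module Labels (t r : ℕ) where

  -- Decodes an index with the same `splitAt` and `quotRem` as the concatenations in
  -- `specialisation`, so that `specialisation-point` is a mere case distinction.
  label : Fin (t ℕ.+ r ℕ.* 2) → Label t r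
  label s = [ res , (λ u → signed (quotRem 2 u)) ]′ (splitAt t s)
    where
    signed : Fin 2 × Fin r → Label t r
    signed (zero , k)     = pos k
    signed (suc zero , k) = neg k

  unlabel : Label t r → Fin (t ℕ.+ r ℕ.* 2)
  unlabel (res a) = a ↑ˡ (r ℕ.* 2)
  unlabel (pos k) = t ↑ʳ combine k zero
  unlabel (neg k) = t ↑ʳ combine {r} {2} k (suc zero)

  label-unlabel : ∀ l → label (unlabel l) ≡ l
  label-unlabel (res a) rewrite Fin.splitAt-↑ˡ t a (r ℕ.* 2) = ≡.refl
  label-unlabel (pos k) rewrite Fin.splitAt-↑ʳ t (r ℕ.* 2) (combine k zero)
    with quotRem {r} 2 (combine k zero) | Fin.remQuot-combine {r} {2} k zero
  ... | zero , .k | ≡.refl = ≡.refl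
  label-unlabel (neg k) rewrite Fin.splitAt-↑ʳ t (r ℕ.* 2) (combine {r} {2} k (suc zero))
    with quotRem {r} 2 (combine {r} {2} k (suc zero)) | Fin.remQuot-combine {r} {2} k (suc zero)
  ... | suc zero , .k | ≡.refl = ≡.refl

  unlabel-label : ∀ s → unlabel (label s) ≡ s
  unlabel-label s with splitAt t s in eq
  ... | inj₁ a = Fin.splitAt⁻¹-↑ˡ eq
  ... | inj₂ u with quotRem {r} 2 u | Fin.combine-remQuot {r} 2 u
  ...   | zero , k     | e = ≡.trans (cong (t ↑ʳ_) e) (Fin.splitAt⁻¹-↑ʳ eq)
  ...   | suc zero , k | e = ≡.trans (cong (t ↑ʳ_) e) (Fin.splitAt⁻¹-↑ʳ eq)

injective? : ∀ {n m} (f : Fin n → Fin m) → (∃ λ i → ∃ λ j → i Fin.< j × f i ≡ f j) ⊎ Injective _≡_ _≡_ f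
injective? f with Fin.any? (λ i → Fin.any? (λ j → (i Fin.<? j) ×-dec (f i Fin.≟ f j)))
... | yes collision = inj₁ collision
... | no none = inj₂ injective
  where
  injective : Injective _≡_ _≡_ f
  injective {i} {j} e with Fin.<-cmp i j
  ... | tri< lt _ _ = contradiction (i , j , lt , e) none
  ... | tri≈ _ eq _ = eq
  ... | tri> _ _ gt = contradiction (j , i , gt , ≡.sym e) none

-- Expansion of an alternant over a family of vectors

module Expansion {a ℓ} (S : CommutativeRing a ℓ) where

  open Sums S
  open Exterior S
  open Bialternant S using (schurSum; schurSum-empty)
  open Alternants S

  product-zero : ∀ {n} (f : Fin n → Carrier) j → f j ≈ 0# → product f ≈ 0#
  product-zero f zero    e = trans (*-congʳ e) (zeroˡ _)
  product-zero f (suc j) e = trans (*-congˡ (product-zero (f ∘ suc) j e)) (zeroʳ _)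

  ∑-choices-single : ∀ n {m} (f₀ : Fin n → Fin m) {G : (Fin n → Fin m) → Carrier} → Extensional G →
    (∀ f → ¬ (∀ j → f j ≡ f₀ j) → G f ≈ 0#) → ∑ (choices n (λ _ → allFin m)) G ≈ G f₀
  ∑-choices-single zero    f₀ {G} ext h = ∑-choices-zero (λ _ → allFin _) ext f₀
  ∑-choices-single (suc n) {m} f₀ {G} ext h = begin
    ∑ (choices (suc n) (λ _ → allFin m)) G ≈⟨ ∑-choices-suc (λ _ → allFin m) ext ⟩
    ∑ (allFin m) (λ x → ∑ (choices n (λ _ → allFin m)) (λ f → G (x ∷ᵈ f)))
      ≈⟨ ∑-allFin-single m (f₀ zero) _ (λ x x≢ → ∑-zero (choices n (λ _ → allFin m)) (λ f →
           h (x ∷ᵈ f) (λ e → x≢ (e zero)))) ⟩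
    ∑ (choices n (λ _ → allFin m)) (λ f → G (f₀ zero ∷ᵈ f))
      ≈⟨ ∑-choices-single n (f₀ ∘ suc) (∷ᵈ-ext ext (f₀ zero)) (λ f ¬e →
           h (f₀ zero ∷ᵈ f) (λ e → ¬e (e ∘ suc))) ⟩
    G (f₀ zero ∷ᵈ (f₀ ∘ suc)) ≈⟨ ext _ f₀ (λ { zero → ≡.refl ; (suc j) → ≡.refl }) ⟩
    G f₀ ∎

  module _ {n} (κ : Shape n) (x : Vect n) (M : Fin n → Fin n → Carrier) (b : Fin n → Vect n)
    (column : ∀ j i → x i ^ exponents κ j ≈ ∑ (allFin n) (λ s → M s j * b s i)) where

    alternant-expand : alternant n κ x ≈ ∑ (choices n (λ _ → allFin n)) (λ τ →
      product (λ j → M (τ j) j) * det n (b ∘ τ))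
    alternant-expand = trans (wedges-cong n column (λ _ → refl) full)
      (wedges-multilinear n (λ _ → allFin n) (λ j s → M s j) (λ _ → b) unit full)

    -- A repeated vector kills the determinant, so only bijections need a reason. An empty class
    -- supplies the first of the two reasons, a vanishing determinant of the basis vectors the
    -- second.
    alternant-zero : (∀ τ → Injective _≡_ _≡_ τ → product (λ j → M (τ j) j) ≈ 0# ⊎ det n (b ∘ τ) ≈ 0#) →
                     alternant n κ x ≈ 0#
    alternant-zero h = trans alternant-expand (∑-zero (choices n (λ _ → allFin n)) (λ τ → vanish τ (injective? τ)))
      where
      vanish : ∀ τ → (∃ λ i → ∃ λ j → i Fin.< j × τ i ≡ τ j) ⊎ Injective _≡_ _≡_ τ →
               product (λ j → M (τ j) j) * det n (b ∘ τ) ≈ 0#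
      vanish τ (inj₁ (i , j , lt , e)) = trans (*-congˡ (det-noninjective b i j lt e)) (zeroʳ _)
      vanish τ (inj₂ inj) with h τ inj
      ... | inj₁ e = trans (*-congʳ e) (zeroˡ _)
      ... | inj₂ e = trans (*-congˡ e) (zeroʳ _)

  schurSum-zero : ∀ n (κ : Shape n) x → Decreasing κ → Regular (vandermonde n x) →
                  alternant n κ x ≈ 0# → schurSum κ x ≈ 0#
  schurSum-zero n κ x κ↓ reg e = reg _ (trans (bialternant n κ x κ↓) e)

  alternant-zero⁻ : ∀ n (κ : Shape n) x → Decreasing κ → schurSum κ x ≈ 0# → alternant n κ x ≈ 0#
  alternant-zero⁻ n κ x κ↓ e = trans (sym (bialternant n κ x κ↓)) (trans (*-congʳ e) (zeroˡ _))

  -- The Schur polynomial of the empty partition is 1, so its alternant is the Vandermonde product.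

  vandermonde-nonzero : ∀ n x → Regular (vandermonde n x) → alternant n (λ _ → 0) x ≈ 0# → 1# ≈ 0#
  vandermonde-nonzero n x reg e = trans (sym (schurSum-empty {n} {n} x))
    (schurSum-zero n (λ _ → 0) x (λ _ _ _ → ℕ.z≤n) reg e)

-- The alternant at the specialised point

module Specialised {c ℓ} (R : CommutativeRing c ℓ) (t r : ℕ) .{{_ : ℕ.NonZero t}}
  (ζ : CommutativeRing.Carrier R)
  (ζ^t≈1 : CommutativeRing._≈_ R (Sums._^_ R ζ t) (CommutativeRing.1# R)) where

  open Sums R
  open LaurentRing R r
  open Laurent R r using () renaming (_≈_ to _≈ᴸ_)
  open Residues t
  open Labels t r
  open Signs {t} {r} using (sign)
  module L = Sums laurentRing
  module E = Exterior laurentRing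
  open Alternants laurentRing using (alternant)
  module X = Expansion laurentRing

  N : ℕ
  N = t ℕ.+ r ℕ.* 2

  infixr 7 _⊗_

  _⊗_ : ℕ → Exponent → Exponent
  zero  ⊗ e = 0ᵉ
  suc n ⊗ e = e ⊕ n ⊗ e

  lookup-⊗ : ∀ n e k → Vec.lookup (n ⊗ e) k ≡ ℤ.+ n ℤ.* Vec.lookup e k
  lookup-⊗ zero    e k = Vec.lookup-replicate k ℤ.0ℤ
  lookup-⊗ (suc n) e k = ≡.trans (Vec.lookup-zipWith ℤ._+_ k e (n ⊗ e))
    (≡.trans (cong (λ z → Vec.lookup e k ℤ.+ z) (lookup-⊗ n e k)) (≡.sym (ℤ.suc-* (ℤ.+ n) (Vec.lookup e k))))

  ⨁ : ∀ {n} → (Fin n → Exponent) → Exponent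
  ⨁ {zero}  e = 0ᵉ
  ⨁ {suc n} e = e zero ⊕ ⨁ (e ∘ suc)

  lookup-⨁ : ∀ {n} (e : Fin n → Exponent) k →
             Vec.lookup (⨁ e) k ≡ ℤ-Sums.∑ (allFin n) (λ j → Vec.lookup (e j) k)
  lookup-⨁ {zero}  e k = Vec.lookup-replicate k ℤ.0ℤ
  lookup-⨁ {suc n} e k = ≡.trans (Vec.lookup-zipWith ℤ._+_ k (e zero) _) (cong (λ z → Vec.lookup (e zero) k ℤ.+ z)
    (≡.trans (lookup-⨁ (e ∘ suc) k) (≡.sym (ℤ-Sums.∑-tabulate n suc (λ j → Vec.lookup (e j) k)))))

  mon-^ : ∀ a e n → mon a e L.^ n ≡ mon (a ^ n) (n ⊗ e)
  mon-^ a e zero    = ≡.refl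
  mon-^ a e (suc n) = cong (mon a e L.*_) (mon-^ a e n)

  mon-product : ∀ {n} (a : Fin n → Carrier) (e : Fin n → Exponent) →
                L.product (λ j → mon (a j) (e j)) ≡ mon (product a) (⨁ e)
  mon-product {zero}  a e = ≡.refl
  mon-product {suc n} a e = cong (mon (a zero) (e zero) L.*_) (mon-product (a ∘ suc) (e ∘ suc))

  coeff-mon : ∀ a d e → coeff (mon a d) e ≈ when (d ≟ᵉ e) a
  coeff-mon a d e = +-identityʳ _

  coeff-L∑ : ∀ {b} {A : Set b} (xs : List A) f e → coeff (L.∑ xs f) e ≈ ∑ xs (λ x → coeff (f x) e)
  coeff-L∑ []       f e = refl
  coeff-L∑ (x ∷ xs) f e = trans (coeff-+ (f x) (L.∑ xs f) e) (+-congˡ (coeff-L∑ xs f e))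

  IsConstant : Laurent → Set _
  IsConstant f = ∃ λ a → f ≈ᴸ const a

  -- The entries of `basis` are constants, so every assignment contributes a scalar times a single
  -- monomial.
  det-constant : ∀ n (m : Fin n → Fin n → Carrier) → IsConstant (E.det n (λ j i → const (m j i)))
  det-constant n m = E.det-closed {P = IsConstant}
    (0# , λ e → sym (mon-zero 0ᵉ refl e)) (1# , λ e → refl)
    (λ {f} {g} → subtract {f} {g}) (λ {f} {g} → multiply {f} {g}) n (λ j i → m j i , λ e → refl)
    where
    when-sub : ∀ {p} {P : Set p} (P? : Dec P) a b → when P? a - when P? b ≈ when P? (a - b)
    when-sub (yes _) a b = refl
    when-sub (no _)  a b = -‿inverseʳ 0#
    subtract : ∀ {f g} → IsConstant f → IsConstant g → IsConstant (f ++ negᴸ g)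
    subtract {f} {g} (a , h) (b , k) = a - b , λ e → begin
      coeff (f ++ negᴸ g) e ≈⟨ trans (coeff-+ f (negᴸ g) e) (+-congˡ (coeff-neg g e)) ⟩
      coeff f e - coeff g e
        ≈⟨ +-cong (trans (h e) (coeff-mon a 0ᵉ e)) (-‿cong (trans (k e) (coeff-mon b 0ᵉ e))) ⟩
      when (0ᵉ ≟ᵉ e) a - when (0ᵉ ≟ᵉ e) b ≈⟨ when-sub (0ᵉ ≟ᵉ e) a b ⟩
      when (0ᵉ ≟ᵉ e) (a - b) ≈⟨ coeff-mon (a - b) 0ᵉ e ⟨
      coeff (const (a - b)) e ∎
    multiply : ∀ {f g} → IsConstant f → IsConstant g → IsConstant (f L.* g)
    multiply {f} {g} (a , h) (b , k) = a * b , λ e → trans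
      (L.*-cong {f} {const a} {g} {const b} h k e) (mon-cong refl (⊕-identityʳ 0ᵉ) e)

  direction : Label t r → Exponent
  direction (res a) = 0ᵉ
  direction (pos k) = 0ᵉ Vec.[ k ]≔ ℤ.1ℤ
  direction (neg k) = 0ᵉ Vec.[ k ]≔ ℤ.-1ℤ

  lookup-direction : ∀ l k → Vec.lookup (direction l) k ≡ sign k l
  lookup-direction (res a)  k = Vec.lookup-replicate k ℤ.0ℤ
  lookup-direction (pos k′) k with k′ Fin.≟ k
  ... | yes ≡.refl = Vec.lookup∘update k 0ᵉ ℤ.1ℤ
  ... | no  k′≢k   = ≡.trans (Vec.lookup∘update′ (k′≢k ∘ ≡.sym) 0ᵉ ℤ.1ℤ) (Vec.lookup-replicate k ℤ.0ℤ)
  lookup-direction (neg k′) k with k′ Fin.≟ k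
  ... | yes ≡.refl = Vec.lookup∘update k 0ᵉ ℤ.-1ℤ
  ... | no  k′≢k   = ≡.trans (Vec.lookup∘update′ (k′≢k ∘ ≡.sym) 0ᵉ ℤ.-1ℤ) (Vec.lookup-replicate k ℤ.0ℤ)

  scalar : Label t r → Carrier
  scalar (res a) = ζ ^ toℕ a
  scalar (pos k) = 1#
  scalar (neg k) = 1#

  point : Fin N → Laurent
  point s = mon (scalar (label s)) (direction (label s))

  one-^ : ∀ n → 1# ^ n ≈ 1#
  one-^ zero    = refl
  one-^ (suc n) = trans (*-identityˡ _) (one-^ n)

  ^-cong : ∀ {x y} n → x ≈ y → x ^ n ≈ y ^ n
  ^-cong zero    e = refl
  ^-cong (suc n) e = *-cong e (^-cong n e)

  ^-* : ∀ x m n → x ^ (n ℕ.* m) ≈ (x ^ m) ^ n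
  ^-* x m zero    = refl
  ^-* x m (suc n) = trans (^-+ x m (n ℕ.* m)) (*-congˡ (^-* x m n))

  ^-period : ∀ {x} → x ^ t ≈ 1# → ∀ n → x ^ n ≈ x ^ (n % t)
  ^-period {x} e n = begin
    x ^ n ≡⟨ cong (x ^_) (m≡m%n+[m/n]*n n t) ⟩
    x ^ (n % t ℕ.+ n / t ℕ.* t) ≈⟨ ^-+ x (n % t) _ ⟩
    x ^ (n % t) * x ^ (n / t ℕ.* t) ≈⟨ *-congˡ (trans (^-* x t (n / t)) (trans (^-cong (n / t) e) (one-^ (n / t)))) ⟩
    x ^ (n % t) * 1# ≈⟨ *-identityʳ _ ⟩
    x ^ (n % t) ∎

  root-^t : ∀ n → (ζ ^ n) ^ t ≈ 1#
  root-^t n = begin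
    (ζ ^ n) ^ t       ≈⟨ ^-* ζ n t ⟨
    ζ ^ (t ℕ.* n)     ≡⟨ cong (ζ ^_) (ℕ.*-comm t n) ⟩
    ζ ^ (n ℕ.* t)     ≈⟨ ^-* ζ t n ⟩
    (ζ ^ t) ^ n       ≈⟨ trans (^-cong n ζ^t≈1) (one-^ n) ⟩
    1#                ∎

  -- The columns of the alternant in terms of the constant vectors (ζ^(ia))ᵢ,
  -- supported on the rows i < t, and the unit vectors of the remaining rows.

  entry : Label t r → Label t r → Fin N → Fin N → Carrier
  entry (res a) (res i) _ _ = (ζ ^ toℕ i) ^ toℕ a
  entry (res a) _       _ _ = 0#
  entry _       _       s i = when (s Fin.≟ i) 1#

  basis : Fin N → Fin N → Laurent
  basis s i = const (entry (label s) (label i) s i)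

  module _ (κ : Shape N) where

    cls : Fin N → Fin t
    cls j = residue (exponents κ j)

    -- Column j is the vector of its own residue class plus, for every row of a variable, the
    -- matching power times the unit vector. So a residue label has coefficient 1 or 0, and a
    -- variable always has coefficient 1 with a monomial.
    indicator : Label t r → Fin N → Carrier
    indicator (res a) j = when (cls j Fin.≟ a) 1#
    indicator _       j = 1#

    monomial : Fin N → Fin N → Laurent
    monomial s j = mon (indicator (label s) j) (exponents κ j ⊗ direction (label s))

    private
      off-residue : ∀ j i s l l′ a → label s ≡ l → label i ≡ l′ → l′ ≡ res a → s ≢ unlabel (res (cls j)) →
                    indicator l j * entry l l′ s i ≈ 0#
      off-residue j i s (res a′) .(res a) a e e′ ≡.refl s≢ = trans (*-congʳ (when-false (cls j Fin.≟ a′)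
        (λ c → s≢ (≡.trans (≡.sym (unlabel-label s)) (≡.trans (cong unlabel e)
          (cong (unlabel ∘ res) (≡.sym c))))))) (zeroˡ _)
      off-residue j i s (pos k) .(res a) a e e′ ≡.refl s≢ = trans (*-identityˡ _) (when-false (s Fin.≟ i)
        (λ { ≡.refl → contradiction (≡.trans (≡.sym e) e′) (λ ()) }))
      off-residue j i s (neg k) .(res a) a e e′ ≡.refl s≢ = trans (*-identityˡ _) (when-false (s Fin.≟ i)
        (λ { ≡.refl → contradiction (≡.trans (≡.sym e) e′) (λ ()) }))

      off-diagonal : ∀ j i s l l′ → (∀ a → l′ ≢ res a) → s ≢ i → indicator l j * entry l l′ s i ≈ 0#
      off-diagonal j i s (res a) (res a′) h s≢i = contradiction ≡.refl (h a′)
      off-diagonal j i s (res a) (pos k)  h s≢i = zeroʳ _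
      off-diagonal j i s (res a) (neg k)  h s≢i = zeroʳ _
      off-diagonal j i s (pos k) l′       h s≢i = trans (*-identityˡ _) (when-false (s Fin.≟ i) s≢i)
      off-diagonal j i s (neg k) l′       h s≢i = trans (*-identityˡ _) (when-false (s Fin.≟ i) s≢i)

      diagonal : ∀ j i l → label i ≡ l → (∀ a → l ≢ res a) → indicator l j * entry l l i i ≈ scalar l ^ exponents κ j
      diagonal j i (res a) e h = contradiction ≡.refl (h a)
      diagonal j i (pos k) e h = trans (*-identityˡ _) (trans (when-true (i Fin.≟ i) ≡.refl) (sym (one-^ (exponents κ j))))
      diagonal j i (neg k) e h = trans (*-identityˡ _) (trans (when-true (i Fin.≟ i) ≡.refl) (sym (one-^ (exponents κ j))))

      residue-row : ∀ j i a s l → label i ≡ res a → l ≡ res (cls j) →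
                    indicator l j * entry l (label i) s i ≈ scalar (label i) ^ exponents κ j
      residue-row j i a s .(res (cls j)) e ≡.refl rewrite e = trans
        (*-congʳ (when-true (cls j Fin.≟ cls j) ≡.refl)) (trans (*-identityˡ _)
          (trans (reflexive (cong ((ζ ^ toℕ a) ^_) (toℕ-residue (exponents κ j))))
            (sym (^-period (root-^t (toℕ a)) (exponents κ j)))))

      power : ∀ j i → point i L.^ exponents κ j ≡
        mon (scalar (label i) ^ exponents κ j) (exponents κ j ⊗ direction (label i))
      power j i = mon-^ (scalar (label i)) (direction (label i)) (exponents κ j)

      term : Fin N → Fin N → Fin N → Laurent
      term j i s = monomial s j L.* basis s i

      -- In each row a single vector contributes: that of the residue of column j in the row of a
      -- root of unity, the unit vector of the row otherwise.
      select : ∀ j i s₀ → (∀ s → s ≢ s₀ → indicator (label s) j * entry (label s) (label i) s i ≈ 0#) →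
        indicator (label s₀) j * entry (label s₀) (label i) s₀ i ≈ scalar (label i) ^ exponents κ j →
        exponents κ j ⊗ direction (label s₀) ≡ exponents κ j ⊗ direction (label i) →
        point i L.^ exponents κ j ≈ᴸ L.∑ (allFin N) (term j i)
      select j i s₀ off on dir e = begin
        coeff (point i L.^ exponents κ j) e ≡⟨ cong (λ f → coeff f e) (power j i) ⟩
        coeff (mon (scalar (label i) ^ exponents κ j) (exponents κ j ⊗ direction (label i))) e
          ≈⟨ mon-cong (sym on) (≡.trans (≡.sym dir) (≡.sym (⊕-identityʳ _))) e ⟩
        coeff (term j i s₀) e
          ≈⟨ L.∑-allFin-single N s₀ (term j i) (λ s s≢ → mon-zero ((exponents κ j ⊗ direction (label s)) ⊕ 0ᵉ) (off s s≢)) e ⟨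
        coeff (L.∑ (allFin N) (term j i)) e ∎

      column′ : ∀ j i l → label i ≡ l → point i L.^ exponents κ j ≈ᴸ L.∑ (allFin N) (term j i)
      column′ j i (res a) e = select j i s₀
        (λ s s≢ → off-residue j i s (label s) (label i) a ≡.refl ≡.refl e s≢)
        (residue-row j i a s₀ (label s₀) e (label-unlabel _))
        (cong (exponents κ j ⊗_) (≡.trans (cong direction (label-unlabel (res (cls j)))) (≡.sym (cong direction e))))
        where s₀ = unlabel (res (cls j))
      column′ j i (pos k) e = select j i i
        (λ s s≢ → off-diagonal j i s (label s) (label i) (λ a e′ → contradiction (≡.trans (≡.sym e) e′) λ ()) s≢)
        (diagonal j i (label i) ≡.refl (λ a e′ → contradiction (≡.trans (≡.sym e) e′) λ ())) ≡.refl
      column′ j i (neg k) e = select j i i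
        (λ s s≢ → off-diagonal j i s (label s) (label i) (λ a e′ → contradiction (≡.trans (≡.sym e) e′) λ ()) s≢)
        (diagonal j i (label i) ≡.refl (λ a e′ → contradiction (≡.trans (≡.sym e) e′) λ ())) ≡.refl

    column : ∀ j i → point i L.^ exponents κ j ≈ᴸ L.∑ (allFin N) (λ s → monomial s j L.* basis s i)
    column j i = column′ j i (label i) ≡.refl

    indicators : (Fin N → Fin N) → Carrier
    indicators τ = product (λ j → indicator (label (τ j)) j)

    exponent : (Fin N → Fin N) → Exponent
    exponent τ = ⨁ (λ j → exponents κ j ⊗ direction (label (τ j)))

    monomials : ∀ τ → L.product (λ j → monomial (τ j) j) ≡ mon (indicators τ) (exponent τ)
    monomials τ = mon-product (λ j → indicator (label (τ j)) j) _

    incompatible : ∀ τ j a → label (τ j) ≡ res a → cls j ≢ a → indicators τ ≈ 0#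
    incompatible τ j a e c≢a = Expansion.product-zero R (λ i → indicator (label (τ i)) i) j (trans
      (reflexive (cong (λ l → indicator l j) e)) (when-false (cls j Fin.≟ a) c≢a))

    compatible-one : ∀ τ → (∀ j a → label (τ j) ≡ res a → cls j ≡ a) → indicators τ ≈ 1#
    compatible-one τ h = product-one (λ j → one j (label (τ j)) (h j))
      where
      one : ∀ j l → (∀ a → l ≡ res a → cls j ≡ a) → indicator l j ≈ 1#
      one j (res a) h = when-true (cls j Fin.≟ a) (h a ≡.refl)
      one j (pos k) h = refl
      one j (neg k) h = refl

    missing⇒alternant-zero : ∀ a → (∀ j → cls j ≢ a) → alternant N κ point ≈ᴸ []
    missing⇒alternant-zero a none = X.alternant-zero κ point monomial basis column (λ τ τ-inj →
      let j , e = injective⇒surjective τ-inj (unlabel (res a)) in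
      inj₁ (λ p → trans (reflexive (cong (λ f → coeff f p) (monomials τ)))
        (mon-zero (exponent τ) (incompatible τ j a (≡.trans (cong label e) (label-unlabel (res a))) (none j)) p)))

-- Cancellable Vandermonde product and the isolated monomial

module Nonvanishing {c ℓ} (R : CommutativeRing c ℓ) (t r : ℕ) .{{_ : ℕ.NonZero t}}
  (ζ : CommutativeRing.Carrier R)
  (ζ^t≈1 : CommutativeRing._≈_ R (Sums._^_ R ζ t) (CommutativeRing.1# R))
  (unit : ∀ k → 0 ℕ.< k → k ℕ.< t → ∃ λ γ → CommutativeRing._≈_ R
    (CommutativeRing._*_ R (CommutativeRing._-_ R (Sums._^_ R ζ k) (CommutativeRing.1# R)) γ) (CommutativeRing.1# R)) where

  open Sums R
  open LaurentRing R r
  open Laurent R r using () renaming (_≈_ to _≈ᴸ_)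
  open Residues t
  open Labels t r
  open Signs {t} {r} using (sign)
  open Specialised R t r ζ ζ^t≈1
  open Alternants laurentRing using (alternant; vandermonde; vandermonde-regular)
  open Bialternant laurentRing using (schurSum)

  root-inverse : ∀ {n} → n ℕ.≤ t → ζ ^ n * ζ ^ (t ℕ.∸ n) ≈ 1#
  root-inverse {n} n≤t = begin
    ζ ^ n * ζ ^ (t ℕ.∸ n) ≈⟨ ^-+ ζ n (t ℕ.∸ n) ⟨
    ζ ^ (n ℕ.+ (t ℕ.∸ n)) ≡⟨ cong (ζ ^_) (ℕ.m+[n∸m]≡n n≤t) ⟩
    ζ ^ t                 ≈⟨ ζ^t≈1 ⟩
    1#                    ∎

  root-difference-< : ∀ {m n} → m ℕ.< n → n ℕ.< t → ∃ λ γ → (ζ ^ n - ζ ^ m) * γ ≈ 1#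
  root-difference-< {m} {n} m<n n<t
    with γ , e ← unit (n ℕ.∸ m) (ℕ.m<n⇒0<n∸m m<n) (ℕ.≤-<-trans (ℕ.m∸n≤m n m) n<t) =
    γ * ζ ^ (t ℕ.∸ m) , (begin
      (ζ ^ n - ζ ^ m) * (γ * ζ ^ (t ℕ.∸ m)) ≈⟨ *-congʳ factor ⟩
      ((ζ ^ (n ℕ.∸ m) - 1#) * ζ ^ m) * (γ * ζ ^ (t ℕ.∸ m)) ≈⟨ *-interchange _ _ _ _ ⟩
      ((ζ ^ (n ℕ.∸ m) - 1#) * γ) * (ζ ^ m * ζ ^ (t ℕ.∸ m))
        ≈⟨ *-cong e (root-inverse (ℕ.<⇒≤ (ℕ.<-trans m<n n<t))) ⟩
      1# * 1# ≈⟨ *-identityʳ 1# ⟩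
      1# ∎)
    where
    factor : ζ ^ n - ζ ^ m ≈ (ζ ^ (n ℕ.∸ m) - 1#) * ζ ^ m
    factor = begin
      ζ ^ n - ζ ^ m ≡⟨ cong (λ k → ζ ^ k - ζ ^ m) (ℕ.m∸n+n≡m (ℕ.<⇒≤ m<n)) ⟨
      ζ ^ ((n ℕ.∸ m) ℕ.+ m) - ζ ^ m
        ≈⟨ +-cong (^-+ ζ (n ℕ.∸ m) m) (trans (-‿cong (sym (*-identityˡ _))) (-‿distribˡ-* 1# _)) ⟩
      ζ ^ (n ℕ.∸ m) * ζ ^ m + - 1# * ζ ^ m ≈⟨ distribʳ _ _ _ ⟨
      (ζ ^ (n ℕ.∸ m) - 1#) * ζ ^ m ∎

  root-difference : ∀ (a b : Fin t) → a ≢ b → ∃ λ γ → (ζ ^ toℕ a - ζ ^ toℕ b) * γ ≈ 1#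
  root-difference a b a≢b with Fin.<-cmp a b
  ... | tri≈ _ e _ = contradiction e a≢b
  ... | tri> _ _ gt = root-difference-< gt (Fin.toℕ<n a)
  ... | tri< lt _ _ with γ , e ← root-difference-< lt (Fin.toℕ<n b) = - γ , (begin
    (ζ ^ toℕ a - ζ ^ toℕ b) * - γ ≈⟨ -‿distribʳ-* _ γ ⟨
    - ((ζ ^ toℕ a - ζ ^ toℕ b) * γ) ≈⟨ -‿distribˡ-* _ γ ⟩
    - (ζ ^ toℕ a - ζ ^ toℕ b) * γ
      ≈⟨ *-congʳ (trans (sym (-‿+-comm _ _)) (trans (+-congˡ (-‿involutive _)) (+-comm _ _))) ⟩
    (ζ ^ toℕ b - ζ ^ toℕ a) * γ ≈⟨ e ⟩
    1# ∎)

  scalar-unit : ∀ l → ∃ λ u → scalar l * u ≈ 1#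
  scalar-unit (res a) = _ , root-inverse (ℕ.<⇒≤ (Fin.toℕ<n a))
  scalar-unit (pos k) = 1# , *-identityʳ 1#
  scalar-unit (neg k) = 1# , *-identityʳ 1#

  sign-pos : ∀ k → sign k (pos k) ≡ ℤ.1ℤ
  sign-pos k = cong (ℤ._- ℤ.0ℤ) (ℤ-Sums.when-true (k Fin.≟ k) ≡.refl)

  sign-neg : ∀ k → sign k (neg k) ≡ ℤ.-1ℤ
  sign-neg k = cong (λ z → ℤ.0ℤ ℤ.- z) (ℤ-Sums.when-true (k Fin.≟ k) ≡.refl)

  sign-pos-unique : ∀ k l → sign k l ≡ ℤ.1ℤ → l ≡ pos k
  sign-pos-unique k (res a)  ()
  sign-pos-unique k (pos k′) e with k′ Fin.≟ k
  ... | yes ≡.refl = ≡.refl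
  sign-pos-unique k (pos k′) () | no _
  sign-pos-unique k (neg k′) e with k′ Fin.≟ k
  sign-pos-unique k (neg k′) () | yes _
  sign-pos-unique k (neg k′) () | no _

  sign-neg-unique : ∀ k l → sign k l ≡ ℤ.-1ℤ → l ≡ neg k
  sign-neg-unique k (res a)  ()
  sign-neg-unique k (neg k′) e with k′ Fin.≟ k
  ... | yes ≡.refl = ≡.refl
  sign-neg-unique k (neg k′) () | no _
  sign-neg-unique k (pos k′) e with k′ Fin.≟ k
  sign-neg-unique k (pos k′) () | yes _
  sign-neg-unique k (pos k′) () | no _

  difference : Label t r → Label t r → Laurent
  difference l l′ = mon (scalar l) (direction l) ++ negᴸ (mon (scalar l′) (direction l′))

  private
    by-sign : ∀ {l l′} k → sign k l ≢ sign k l′ → Regular (difference l l′)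
    by-sign {l} {l′} k h = difference-regular (direction l) (direction l′) k (proj₂ (scalar-unit l))
      (λ e → h (≡.trans (≡.sym (lookup-direction l k)) (≡.trans e (lookup-direction l′ k))))

  -- Distinct powers of ζ differ by a unit. In every other case the exponents differ at some z k,
  -- which `difference-regular` exploits.
  labels-regular : ∀ l l′ → l ≢ l′ → Regular (difference l l′)
  labels-regular (res a) (res b) h =
    difference-regular-const 0ᵉ (proj₂ (root-difference a b (h ∘ cong res)))
  labels-regular (pos k) l′ h = by-sign {pos k} {l′} k (λ e →
    h (≡.sym (sign-pos-unique k l′ (≡.trans (≡.sym e) (sign-pos k)))))
  labels-regular (neg k) l′ h = by-sign {neg k} {l′} k (λ e →
    h (≡.sym (sign-neg-unique k l′ (≡.trans (≡.sym e) (sign-neg k)))))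
  labels-regular (res a) (pos k) h = by-sign {res a} {pos k} k (λ e →
    h (sign-pos-unique k (res a) (≡.trans e (sign-pos k))))
  labels-regular (res a) (neg k) h = by-sign {res a} {neg k} k (λ e →
    h (sign-neg-unique k (res a) (≡.trans e (sign-neg k))))

  specialised-vandermonde-regular : Regular (vandermonde N point)
  specialised-vandermonde-regular = vandermonde-regular N point (λ s s′ s≢s′ → labels-regular (label s) (label s′)
    (λ e → s≢s′ (≡.trans (≡.sym (unlabel-label s)) (≡.trans (cong unlabel e) (unlabel-label s′)))))

  module _ (odd : ¬ (2 ∣ t)) (κ : Shape N) (κ↓ : Decreasing κ)
           (occupied : ∀ a → ∃ λ j → cls κ j ≡ a) where

    private
      class : Fin N → Fin t
      class = cls κ

    class-halving : ∀ i i′ j j′ → class i ≡ class i′ → class j ≡ class j′ →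
      exponents κ i ℕ.+ exponents κ i′ ≡ exponents κ j ℕ.+ exponents κ j′ → class i ≡ class j
    class-halving i i′ j j′ p q e = residue-≡⁻ {exponents κ i} {exponents κ j}
      (halve odd {exponents κ i} {exponents κ i′} {exponents κ j} {exponents κ j′}
        (residue-≡ {exponents κ i} {exponents κ i′} p) (residue-≡ {exponents κ j} {exponents κ j′} q) e)

    module _ (m : ℕ)
      (up≤r : count (Selection.upper? {t} {r} (exponents κ) (exponents-injective κ κ↓) class class-halving occupied ≡.refl m) ℕ.≤ r)
      (low≤r : count (Selection.lower? {t} {r} (exponents κ) (exponents-injective κ κ↓) class class-halving occupied ≡.refl m) ℕ.≤ r)
      where

      open Assignment {t} {r} (exponents κ) (exponents-injective κ κ↓) class class-halving occupied ≡.refl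
        label unlabel label-unlabel unlabel-label m up≤r low≤r
        using (τ*; τ*-injective; τ*-compatible; energy; module Uniqueness)

      private
        term : (Fin N → Fin N) → Laurent
        term τ = L.product (λ j → monomial κ (τ j) j) L.* E.det N (λ j → basis (τ j))

        detc : ∀ (τ : Fin N → Fin N) → IsConstant (E.det N (λ j → basis (τ j)))
        detc τ = det-constant N (λ j i → entry (label (τ j)) (label i) (τ j) i)

        δ : (Fin N → Fin N) → Carrier
        δ τ = proj₁ (detc τ)

      term-coeff : ∀ τ e → coeff (term τ) e ≈ when ((exponent κ τ ⊕ 0ᵉ) ≟ᵉ e) (indicators κ τ * δ τ)
      term-coeff τ e = trans
        (L.*-cong {L.product (λ j → monomial κ (τ j) j)} {mon (indicators κ τ) (exponent κ τ)}
          {E.det N (λ j → basis (τ j))} {const (δ τ)}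
          (λ p → reflexive (cong (λ f → coeff f p) (monomials κ τ))) (proj₂ (detc τ)) e)
        (coeff-mon (indicators κ τ * δ τ) (exponent κ τ ⊕ 0ᵉ) e)

      exponent-energy : ∀ τ k → Vec.lookup (exponent κ τ) k ≡ energy τ k
      exponent-energy τ k = ≡.trans (lookup-⨁ (λ j → exponents κ j ⊗ direction (label (τ j))) k) (ℤ-Sums.∑-cong (allFin N) (λ j →
        ≡.trans (lookup-⊗ (exponents κ j) (direction (label (τ j))) k)
          (≡.trans (cong (ℤ.+ exponents κ j ℤ.*_) (lookup-direction (label (τ j)) k))
            (ℤ.*-comm (ℤ.+ exponents κ j) _))))

      const-zero : ∀ {a f} → f ≈ᴸ const a → f ≈ᴸ [] → a ≈ 0#
      const-zero {a} h z = trans (sym (coeff-mon-≡ a 0ᵉ)) (trans (sym (h 0ᵉ)) (z 0ᵉ))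

      -- There are three reasons: a repeated vector annihilates the determinant, a residue given to
      -- the wrong class annihilates the coefficient, and otherwise equal exponents would contradict
      -- `τ-unique`.
      other-term : ∀ τ → ¬ (∀ j → τ j ≡ τ* j) → coeff (term τ) (exponent κ τ*) ≈ 0#
      other-term τ τ≢τ* = trans (term-coeff τ (exponent κ τ*)) (by-injectivity (injective? τ))
        where
        clash : Dec (∃ λ j → ∃ λ a → τ j ≡ unlabel (res a) × ¬ (class j ≡ a))
        clash = Fin.any? (λ j → Fin.any? (λ a → (τ j Fin.≟ unlabel (res a)) ×-dec ¬? (class j Fin.≟ a)))
        by-compatibility : Injective _≡_ _≡_ τ → Dec (∃ λ j → ∃ λ a → τ j ≡ unlabel (res a) × ¬ (class j ≡ a)) →
                           when ((exponent κ τ ⊕ 0ᵉ) ≟ᵉ exponent κ τ*) (indicators κ τ * δ τ) ≈ 0#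
        by-compatibility inj (yes (j , a , e , c≢a)) = when-zero ((exponent κ τ ⊕ 0ᵉ) ≟ᵉ exponent κ τ*) (λ _ → trans
          (*-congʳ (incompatible κ τ j a (≡.trans (cong label e) (label-unlabel (res a))) c≢a)) (zeroˡ _))
        by-compatibility inj (no no-clash) = when-zero ((exponent κ τ ⊕ 0ᵉ) ≟ᵉ exponent κ τ*) (λ e → contradiction
          (Uniqueness.τ-unique τ inj
            (λ j a e′ → Dec.decidable-stable (class j Fin.≟ a) (λ c≢a → no-clash
              (j , a , ≡.trans (≡.sym (unlabel-label (τ j))) (cong unlabel e′) , c≢a)))
            (λ k → ≡.trans (≡.sym (exponent-energy τ k)) (≡.trans
              (cong (λ d → Vec.lookup d k) (≡.trans (≡.sym (⊕-identityʳ (exponent κ τ))) e)) (exponent-energy τ* k))))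
          τ≢τ*)
        by-injectivity : (∃ λ i → ∃ λ j → i Fin.< j × τ i ≡ τ j) ⊎ Injective _≡_ _≡_ τ →
                         when ((exponent κ τ ⊕ 0ᵉ) ≟ᵉ exponent κ τ*) (indicators κ τ * δ τ) ≈ 0#
        by-injectivity (inj₁ (i , j , lt , e)) = when-zero ((exponent κ τ ⊕ 0ᵉ) ≟ᵉ exponent κ τ*) (λ _ → trans
          (*-congˡ (const-zero {f = E.det N (λ j → basis (τ j))} (proj₂ (detc τ)) (E.det-noninjective basis i j lt e)))
          (zeroʳ _))
        by-injectivity (inj₂ inj) = by-compatibility inj clash

      extremal-term : coeff (term τ*) (exponent κ τ*) ≈ δ τ*
      extremal-term = trans (term-coeff τ* (exponent κ τ*)) (trans
        (when-true ((exponent κ τ* ⊕ 0ᵉ) ≟ᵉ exponent κ τ*) (⊕-identityʳ (exponent κ τ*)))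
        (trans (*-congʳ (compatible-one κ τ* τ*-compatible)) (*-identityˡ _)))

      term-ext : Extensional (λ τ → coeff (term τ) (exponent κ τ*))
      term-ext τ σ e = L.*-cong {L.product (λ j → monomial κ (τ j) j)}
        {L.product (λ j → monomial κ (σ j) j)} {E.det N (λ j → basis (τ j))} {E.det N (λ j → basis (σ j))}
        (L.product-cong {N} {λ j → monomial κ (τ j) j} {λ j → monomial κ (σ j) j}
          (λ j p → reflexive (cong (λ s → coeff (monomial κ s j) p) (e j))))
        (E.wedges-cong N {λ j → basis (τ j)} {λ j → basis (σ j)} {E.unit} {E.unit}
          (λ j i p → reflexive (cong (λ s → coeff (basis s i) p) (e j))) (λ s p → refl) E.full)
        (exponent κ τ*)

      alternant-zero⇒trivial : alternant N κ point ≈ᴸ [] → 1# ≈ 0#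
      alternant-zero⇒trivial alt≈0 = trans (sym (coeff-mon-≡ 1# 0ᵉ)) (X.vandermonde-nonzero N point
        specialised-vandermonde-regular
        -- The vectors `basis` do not depend on the shape, so the expansion for the empty shape has
        -- the same determinants up to the order of the columns.
        (X.alternant-zero (λ _ → 0) point (monomial (λ _ → 0)) basis (column (λ _ → 0))
          (λ τ τ-inj → inj₂ (E.det-permute basis τ-inj τ*-injective det*≈0))) 0ᵉ)
        where
        δ*≈0 : δ τ* ≈ 0#
        δ*≈0 = begin
          δ τ* ≈⟨ extremal-term ⟨
          coeff (term τ*) (exponent κ τ*)
            ≈⟨ Expansion.∑-choices-single R N τ* term-ext other-term ⟨
          ∑ (choices N (λ _ → allFin N)) (λ τ → coeff (term τ) (exponent κ τ*))
            ≈⟨ coeff-L∑ (choices N (λ _ → allFin N)) term (exponent κ τ*) ⟨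
          coeff (L.∑ (choices N (λ _ → allFin N)) term) (exponent κ τ*)
            ≈⟨ X.alternant-expand κ point (monomial κ) basis (column κ) (exponent κ τ*) ⟨
          coeff (alternant N κ point) (exponent κ τ*) ≈⟨ alt≈0 (exponent κ τ*) ⟩
          0# ∎
        det*≈0 : E.det N (λ j → basis (τ* j)) ≈ᴸ []
        det*≈0 e = trans (proj₂ (detc τ*) e) (mon-zero 0ᵉ δ*≈0 e)

    occupied⇒schur-nonzero : ¬ (1# ≈ 0#) → ¬ (schurSum κ point ≈ᴸ [])
    occupied⇒schur-nonzero 1≢0 schur≈0
      with m , up≤r , low≤r ← Selection.balanced {t} {r} (exponents κ) (exponents-injective κ κ↓) class class-halving occupied ≡.refl
      = 1≢0 (alternant-zero⇒trivial m up≤r low≤r (X.alternant-zero⁻ N κ point κ↓ schur≈0))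

  missing⇒schur-zero : ∀ (κ : Shape N) → Decreasing κ → ∀ a → (∀ j → residue (exponents κ j) ≢ a) →
                       schurSum κ point ≈ᴸ []
  missing⇒schur-zero κ κ↓ a none = X.schurSum-zero N κ point κ↓ specialised-vandermonde-regular
    (missing⇒alternant-zero κ a none)

-- The equivalence for a field with a primitive root of unity

open import Data.Nat.Base using (_+_; _*_; _≤_)

corollary8p22 : ∀ {c ℓ₁ ℓ₂} (K : HeytingField c ℓ₁ ℓ₂) → CharacteristicZero K →
    (t r : ℕ) → 2 ≤ t → ¬ (2 ∣ t) → 1 ≤ r →
    (ζ : HeytingField.Carrier K) → IsPrimitiveRoot K t ζ →
    (lam : Partition (t + r * 2)) →
    Laurent._≈_ (ring K) r
        (schur (Laurent.rawSemiring (ring K) r) lam (specialisation K t r ζ))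
        (RawSemiring.0# (Laurent.rawSemiring (ring K) r))
      ⇔ (Σ (Fin t) λ a → ∀ j → ¬ (β lam j ≡ toℕ a [mod t ]))
corollary8p22 K char-zero t r 2≤t odd 1≤r ζ ζ-primitive lam = mk⇔ zero⇒missing missing⇒zero
  where
  open IsPrimitiveRoot ζ-primitive
  module K = HeytingField K
  module R = CommutativeRing (ring K)

  instance
    t≢0 : ℕ.NonZero t
    t≢0 = ℕ.>-nonZero (ℕ.≤-trans (ℕ.s≤s ℕ.z≤n) 2≤t)

  open Residues t
  open Specialised (ring K) t r ζ ζ^t≈1 using (point)

  unit : ∀ k → 0 ℕ.< k → k ℕ.< t → ∃ λ γ → ((Sums._^_ (ring K) ζ k R.- K.1#) K.* γ) K.≈ K.1#
  unit k 0<k k<t with γ , _ , e ← K.#⇒invertible (ζ^k#1 k 0<k k<t) = γ , e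

  open Nonvanishing (ring K) t r ζ ζ^t≈1 unit
  open LaurentRing (ring K) r using (laurentRing)
  module L = CommutativeRing laurentRing
  open Bialternant laurentRing using (schurSum; schur≈schurSum; schurSum-congʳ)

  1≢0 : ¬ (K.1# K.≈ K.0#)
  -- `1 · 1#` unfolds to `1# + 0#`.
  1≢0 e = K.#-irrefl (R.trans (R.+-identityʳ K.1#) e) (char-zero 1 (ℕ.s≤s ℕ.z≤n))

  specialisation-point : ∀ s → specialisation K t r ζ s ≡ point s
  specialisation-point s with splitAt t s
  ... | inj₁ a = ≡.refl
  ... | inj₂ u with quotRem {r} 2 u
  ...   | zero , k     = ≡.refl
  ...   | suc zero , k = ≡.refl

  schur-point : schur (Laurent.rawSemiring (ring K) r) lam (specialisation K t r ζ)
                  L.≈ schurSum (part lam) point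
  schur-point e = R.trans (schur≈schurSum lam (specialisation K t r ζ) e)
    (schurSum-congʳ (part lam) {specialisation K t r ζ} {point}
      (λ s d → R.reflexive (cong (λ f → Laurent.coeff (ring K) r f d) (specialisation-point s))) e)

  -- Finitely many divisibility tests decide the right-hand side, so it may be derived by refuting
  -- its negation, although vanishing itself is not decidable.
  missing? : Dec (Σ (Fin t) λ a → ∀ j → ¬ (β lam j ≡ toℕ a [mod t ]))
  missing? = Fin.any? (λ a → Fin.all? (λ j → ¬? (t ∣? ℕ.∣ β lam j - toℕ a ∣)))

  zero⇒missing : schur (Laurent.rawSemiring (ring K) r) lam (specialisation K t r ζ) L.≈ [] →
                 Σ (Fin t) λ a → ∀ j → ¬ (β lam j ≡ toℕ a [mod t ])
  zero⇒missing schur≈0 = Dec.decidable-stable missing? (λ none →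
    occupied⇒schur-nonzero odd (part lam) (decreasing lam) (occupied none) 1≢0
      (λ e → R.trans (R.sym (schur-point e)) (schur≈0 e)))
    where
    occupied : ¬ (Σ (Fin t) λ a → ∀ j → ¬ (β lam j ≡ toℕ a [mod t ])) → ∀ a → ∃ λ j → residue (β lam j) ≡ a
    occupied none a = Dec.decidable-stable (Fin.any? (λ j → residue (β lam j) Fin.≟ a))
      (λ empty → none (a , λ j h → empty (j , Equivalence.from (residue-mod (β lam j) a) h)))

  missing⇒zero : (Σ (Fin t) λ a → ∀ j → ¬ (β lam j ≡ toℕ a [mod t ])) →
                 schur (Laurent.rawSemiring (ring K) r) lam (specialisation K t r ζ) L.≈ []
  missing⇒zero (a , none) e = R.trans (schur-point e)
    (missing⇒schur-zero (part lam) (decreasing lam) a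
      (λ j h → none j (Equivalence.to (residue-mod (β lam j) a) h)) e)
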